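{- There is an algorithm that, given an unrooted tree $T$ with $n$ nodes and edges labeled by letters of an integer alphabet $\Sigma$ of size polynomial in $n$, computes the set $\mathrm{MAW}(T)$ of all minimal absent words of $T$ in time $O(n^{2}+|\mathrm{MAW}(T)|)$, using $O(n^2)$ space excluding the space necessary to store the results.
   Context: The model of computation is the word-RAM with machine words of $\Omega(\log n)$ bits; letters are integers bounded by a polynomial in $n$. Let $T$ be an unrooted tree (a finite connected acyclic undirected graph) whose edges are labeled by letters of $\Sigma$. The language $L(T)$ is the set of all words obtained by concatenating the edge labels along a simple path of $T$, read from one endpoint to the other (starting from any node, in either direction; the empty path gives the empty word). A word $aub$ with $a,b\in\Sigma$ and $u$ a (possibly empty) word over $\Sigma$ is a minimal absent word of $T$ if $aub\notin L(T)$ while $au\in L(T)$ and $ub\in L(T)$. The set of minimal absent words of $T$ is $\mathrm{MAW}(T)$. Each minimal absent word $aub$ is reported in a constant number of machine words: as a triple consisting of the letter $a$, a pointer representing $u$ (for instance, two nodes $v,r$ of $T$ and a length $\ell$ such that $u$ is the prefix of length $\ell$ of the word read along the simple path from $v$ to $r$), and the letter $b$. -}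

module Defs where

open import Data.Bool using (Bool; true; false; if_then_else_)
open import Data.Fin using (Fin; toℕ)
open import Data.List using (List; []; _∷_; _++_; _∷ʳ_; [_]; length; take; concatMap)
open import Data.List.Membership.Propositional using (_∈_)
open import Data.List.Relation.Unary.All using (All)
open import Data.List.Relation.Unary.AllPairs using (AllPairs)
open import Data.List.Relation.Unary.Unique.Propositional using (Unique)
open import Data.List.Relation.Binary.Pointwise using (Pointwise)
open import Data.Nat using (ℕ; zero; suc; _+_; _*_; _∸_; _^_; _≤_; _<_; _/_; _%_; _<ᵇ_; _≡ᵇ_; NonZero)
open import Data.Nat.DivMod using (_mod_)
open import Data.Nat.Properties using (m^n≢0)
open import Data.Product using (_×_; _,_; ∃-syntax)
open import Data.Sum using (_⊎_)
open import Data.Vec using (Vec; lookup; replicate; tabulate; _[_]≔_)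
open import Function using (_⇔_)
open import Relation.Binary.PropositionalEquality using (_≡_; _≢_)
open import Relation.Nullary using (¬_)
open import Relation.Unary using (Pred)
open import Level using (0ℓ)

------------------------------------------------------------------------
-- Edge-labelled unrooted trees

-- (u , v , a) is the undirected edge {u , v} labelled a; which endpoint
-- comes first is immaterial.
Edge : ℕ → ℕ → Set
Edge n σ = Fin n × Fin n × Fin σ

Graph : ℕ → ℕ → Set
Graph n σ = List (Edge n σ)

Word : ℕ → Set
Word σ = List (Fin σ)

module _ {n σ : ℕ} where

  _⊢_—[_]—_ : Graph n σ → Fin n → Fin σ → Fin n → Set
  G ⊢ u —[ a ]— v = (u , v , a) ∈ G ⊎ (v , u , a) ∈ G

  -- Walk G u v vs x : a walk from u to v visiting the nodes vs (both
  -- endpoints included) and reading the word x.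
  data Walk (G : Graph n σ) : Fin n → Fin n → List (Fin n) → Word σ → Set where
    stop : ∀ {u} → Walk G u u [ u ] []
    step : ∀ {u v z vs a x} → G ⊢ u —[ a ]— v → Walk G v z vs x →
           Walk G u z (u ∷ vs) (a ∷ x)

  SimplePath : Graph n σ → Fin n → Fin n → Word σ → Set
  SimplePath G u v x = ∃[ vs ] Walk G u v vs x × Unique vs

  Loop : Edge n σ → Set
  Loop (u , v , _) = u ≡ v

  Parallel : Edge n σ → Edge n σ → Set
  Parallel (u , v , _) (u′ , v′ , _) = (u ≡ u′ × v ≡ v′) ⊎ (u ≡ v′ × v ≡ u′)

  record IsTree (G : Graph n σ) : Set where
    field
      nonempty   : 0 < n
      loopless   : All (λ e → ¬ Loop e) G
      noParallel : AllPairs (λ e f → ¬ Parallel e f) G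
      connected  : ∀ u v → ∃[ vs ] ∃[ x ] Walk G u v vs x
      -- a cycle is a simple path with at least two edges together with
      -- an edge joining its endpoints
      acyclic    : ∀ {u v x a} → SimplePath G u v x → 2 ≤ length x →
                   ¬ (G ⊢ v —[ a ]— u)

record Tree (n σ : ℕ) : Set where
  field
    edges  : Graph n σ
    isTree : IsTree edges

open Tree public

------------------------------------------------------------------------
-- Minimal absent words

module _ {n σ : ℕ} where

  L : Tree n σ → Pred (Word σ) 0ℓ
  L T x = ∃[ u ] ∃[ v ] SimplePath (edges T) u v x

  MAW : Tree n σ → Pred (Word σ) 0ℓ
  MAW T x = ∃[ a ] ∃[ u ] ∃[ b ]
    x ≡ a ∷ u ++ [ b ] × ¬ L T (a ∷ u ++ [ b ]) × L T (a ∷ u) × L T (u ++ [ b ])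

-- The list enumerates the set without repetitions, so that its length is
-- the cardinality of the set.
_Lists_ : {A : Set} → List A → Pred A 0ℓ → Set
xs Lists P = Unique xs × (∀ x → x ∈ xs ⇔ P x)

------------------------------------------------------------------------
-- Reporting a minimal absent word in constantly many machine words

record Report (n σ : ℕ) : Set where
  constructor report
  field
    first  : Fin σ
    from   : Fin n
    to     : Fin n
    len    : ℕ
    last   : Fin σ

module _ {n σ : ℕ} where

  data _Denotes_within_ : Report n σ → Word σ → Tree n σ → Set where
    denotes : ∀ {T a v r ℓ b x} → SimplePath (edges T) v r x → ℓ ≤ length x →
              report a v r ℓ b Denotes (a ∷ take ℓ x ++ [ b ]) within T

  AllDenote : Tree n σ → List (Report n σ) → List (Word σ) → Set
  AllDenote T = Pointwise (λ ρ x → ρ Denotes x within T)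

  encodeReports : List (Report n σ) → List ℕ
  encodeReports = concatMap λ (report a v r ℓ b) →
    toℕ a ∷ toℕ v ∷ toℕ r ∷ ℓ ∷ toℕ b ∷ []

  encodeTree : Tree n σ → List ℕ
  encodeTree T = n ∷ length (edges T) ∷
    concatMap (λ (u , v , a) → toℕ u ∷ toℕ v ∷ toℕ a ∷ []) (edges T)

------------------------------------------------------------------------
-- The word-RAM

-- The contents of a cell or register of a machine with w-bit words.
MWord : ℕ → Set
MWord w = Fin (2 ^ w)

trunc : ∀ w → ℕ → MWord w
trunc w x = _mod_ x (2 ^ w) {{m^n≢0 2 w}}

data BinOp : Set where
  add sub mul div rem and or xor shl shr lt eq : BinOp

toBit : Bool → ℕ
toBit b = if b then 1 else 0

bitwise : (ℕ → ℕ → ℕ) → ℕ → ℕ → ℕ → ℕ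
bitwise f zero    x y = 0
bitwise f (suc w) x y = f (x % 2) (y % 2) + 2 * bitwise f w (x / 2) (y / 2)

-- Division and remainder by zero yield zero.
quot : ℕ → ℕ → ℕ
quot x zero      = 0
quot x y@(suc _) = x / y

remainder : ℕ → ℕ → ℕ
remainder x zero      = 0
remainder x y@(suc _) = x % y

evalℕ : ℕ → BinOp → ℕ → ℕ → ℕ
evalℕ w add x y = x + y
evalℕ w sub x y = x + 2 ^ w ∸ y
evalℕ w mul x y = x * y
evalℕ w div x y = quot x y
evalℕ w rem x y = remainder x y
evalℕ w and x y = bitwise (λ p q → p * q) w x y
evalℕ w or  x y = bitwise (λ p q → p + q ∸ p * q) w x y
evalℕ w xor x y = bitwise (λ p q → (p + q) % 2) w x y
evalℕ w shl x y = x * 2 ^ y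
evalℕ w shr x y = _/_ x (2 ^ y) {{m^n≢0 2 y}}
evalℕ w lt  x y = toBit (x <ᵇ y)
evalℕ w eq  x y = toBit (x ≡ᵇ y)

eval : ∀ w → BinOp → MWord w → MWord w → MWord w
eval w o x y = trunc w (evalℕ w o (toℕ x) (toℕ y))

data Operand (r : ℕ) : Set where
  reg   : Fin r → Operand r
  const : ℕ → Operand r

data Instr (r : ℕ) : Set where
  move  : Fin r → Operand r → Instr r
  arith : Fin r → BinOp → Operand r → Operand r → Instr r
  load  : Fin r → (address : Operand r) → Instr r
  store : (address value : Operand r) → Instr r
  emit  : Operand r → Instr r

infixr 5 _⨾_

-- Programs of a machine with r registers. Jumps are structured; each
-- instruction and each test of a condition takes one unit of time. A program
-- is fixed before the input size and the word size are known.
data Program (r : ℕ) : Set where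
  skip      : Program r
  instr     : Instr r → Program r
  _⨾_       : Program r → Program r → Program r
  ifNonZero : Operand r → (then else : Program r) → Program r
  while     : Operand r → Program r → Program r

-- w-bit words, r registers, S memory cells. The output is write-only.
record State (w r S : ℕ) : Set where
  constructor state
  field
    regs   : Vec (MWord w) r
    mem    : Vec (MWord w) S
    output : List (MWord w)

open State public

module _ {w r S : ℕ} where

  value : Operand r → State w r S → MWord w
  value (reg i)   s = lookup (regs s) i
  value (const k) s = trunc w k

  IsZero IsNonZero : Operand r → State w r S → Set
  IsZero    o s = toℕ (value o s) ≡ 0
  IsNonZero o s = toℕ (value o s) ≢ 0

  setReg : Fin r → MWord w → State w r S → State w r S
  setReg i x s = record s { regs = regs s [ i ]≔ x }

  -- An access outside the S memory cells has no successor state.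
  data _—⟨_⟩→_ (s : State w r S) : Instr r → State w r S → Set where
    move  : ∀ {i o} → s —⟨ move i o ⟩→ setReg i (value o s) s
    arith : ∀ {i f o o′} →
            s —⟨ arith i f o o′ ⟩→ setReg i (eval w f (value o s) (value o′ s)) s
    load  : ∀ {i o} (p : Fin S) → toℕ p ≡ toℕ (value o s) →
            s —⟨ load i o ⟩→ setReg i (lookup (mem s) p) s
    store : ∀ {o o′} (p : Fin S) → toℕ p ≡ toℕ (value o s) →
            s —⟨ store o o′ ⟩→ record s { mem = mem s [ p ]≔ value o′ s }
    emit  : ∀ {o} → s —⟨ emit o ⟩→ record s { output = output s ∷ʳ value o s }

  -- ⟨ P , s ⟩⇓[ t ] s′ : started in s, P halts in s′ after t units of time.
  data ⟨_,_⟩⇓[_]_ : Program r → State w r S → ℕ → State w r S → Set where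
    skip       : ∀ {s} → ⟨ skip , s ⟩⇓[ 1 ] s
    instr      : ∀ {ι s s′} → s —⟨ ι ⟩→ s′ → ⟨ instr ι , s ⟩⇓[ 1 ] s′
    _⨾_        : ∀ {P Q s s′ s″ t t′} →
                 ⟨ P , s ⟩⇓[ t ] s′ → ⟨ Q , s′ ⟩⇓[ t′ ] s″ →
                 ⟨ P ⨾ Q , s ⟩⇓[ t + t′ ] s″
    ifTrue     : ∀ {o P Q s s′ t} → IsNonZero o s → ⟨ P , s ⟩⇓[ t ] s′ →
                 ⟨ ifNonZero o P Q , s ⟩⇓[ suc t ] s′
    ifFalse    : ∀ {o P Q s s′ t} → IsZero o s → ⟨ Q , s ⟩⇓[ t ] s′ →
                 ⟨ ifNonZero o P Q , s ⟩⇓[ suc t ] s′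
    whileTrue  : ∀ {o P s s′ s″ t t′} → IsNonZero o s →
                 ⟨ P , s ⟩⇓[ t ] s′ → ⟨ while o P , s′ ⟩⇓[ t′ ] s″ →
                 ⟨ while o P , s ⟩⇓[ suc (t + t′) ] s″
    whileFalse : ∀ {o P s} → IsZero o s → ⟨ while o P , s ⟩⇓[ 1 ] s

nth : List ℕ → ℕ → ℕ
nth []       _       = 0
nth (x ∷ _)  zero    = x
nth (_ ∷ xs) (suc i) = nth xs i

-- The input occupies the first memory cells; everything else is zero.
initial : ∀ {w r S} → List ℕ → State w r S
initial {w} {r} input =
  state (replicate r (trunc w 0)) (tabulate λ i → trunc w (nth input (toℕ i))) []

-- The words of L(T) are the labels W v x of the n² simple paths of T, so the
-- trie of L(T) has at most n² nodes. It is built breadth first: each node keeps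
-- the list of the pairs (v , x) spelling its word; extending these paths by
-- the neighbours of x and grouping the extensions by their last letter costs
-- O(n²) altogether, because every pair is extended once and the degrees of a tree
-- sum to at most 2n. A letter is represented by the first edge carrying it.
--
-- The word a u b is minimal absent if a u and u b are nodes of the trie and a u b
-- is not. So for every node a u the letters of its children are marked, and every
-- unmarked letter b of a child of u is reported. A scanned child of u is either
-- reported or matched by a child of a u, which bounds the time by
-- O(n² + |MAW(T)|). The node u is found by reversing paths.

module Submission where

open import Defs
open import Data.Bool using (Bool; true; false; if_then_else_; T)
open import Data.Empty using (⊥; ⊥-elim)
open import Data.Fin using (Fin; zero; suc; toℕ; fromℕ<; combine)
open import Data.Fin.Properties using (toℕ-injective; toℕ<n; toℕ-fromℕ<; combine-injectiveˡ; combine-injectiveʳ; toℕ-combine; injective⇒≤) renaming (_≟_ to _≟ᶠ_)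
open import Data.List using (List; []; _∷_; _++_; [_]; _∷ʳ_; length; map; reverse; cartesianProduct; allFin)
import Data.List as List
open import Data.List.Membership.Propositional using (_∈_; _∉_)
open import Data.List.Membership.Propositional.Properties using (∈-++⁺ˡ; ∈-++⁺ʳ; ∈-++⁻; ∈-lookup; ∈-∃++; ∈-applyUpTo⁺; ∈-allFin; ∈-cartesianProduct⁺)
open import Data.List.Properties using (map-++; reverse-++; reverse-injective; reverse-involutive; length-reverse; ++-identityʳ; concatMap-++; length-applyUpTo; take-all; length-tabulate; length-++; map-∘; unfold-reverse; ∷-injective; ∷ʳ-injective; ∷ʳ-injectiveˡ)
open import Data.List.Relation.Binary.Pointwise using ([]; _∷_) renaming (++⁺ to Pointwise-++⁺)
open import Data.List.Relation.Unary.All using (All; []; _∷_)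
import Data.List.Relation.Unary.All as All
open import Data.List.Relation.Unary.All.Properties using (¬Any⇒All¬)
open import Data.List.Relation.Unary.AllPairs using (AllPairs; []; _∷_)
open import Data.List.Relation.Unary.Any using (here; there)
import Data.List.Relation.Unary.Any as Any
open import Data.List.Relation.Unary.Any.Properties using (lookup-index; reverse⁻)
open import Data.List.Relation.Unary.Unique.Propositional using (Unique)
open import Data.List.Relation.Unary.Unique.Propositional.Properties using (Unique[x∷xs]⇒x∉xs; allFin⁺) renaming (++⁺ to Unique-++⁺)
open import Data.Nat using (ℕ; zero; suc; _+_; _*_; _∸_; _^_; _≤_; _<_; z≤n; s≤s; ⌊_/2⌋; ⌈_/2⌉; _<?_; _≟_; NonZero; >-nonZero; _<ᵇ_; _≡ᵇ_)
open import Data.Nat.DivMod using (m<n⇒m%n≡m)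
open import Data.Nat.Induction using (<-rec)
open import Data.Nat.ListAction using (sum)
open import Data.Nat.Logarithm using (⌈log₂_⌉; ⌈log₂⌉-mono-≤; ⌈log₂⌈n/2⌉⌉≡⌈log₂n⌉∸1)
open import Data.Nat.Properties hiding (_≟_; _<?_)
open import Algebra.Properties.CommutativeSemigroup +-commutativeSemigroup using (x∙yz≈y∙xz)
open import Data.Nat.Solver using (module +-*-Solver)
open +-*-Solver using (solve; _:=_; _:+_; _:*_; con)
open import Data.Product using (_×_; _,_; ∃-syntax; Σ-syntax; proj₁; proj₂)
open import Data.Sum using (_⊎_; inj₁; inj₂; swap; [_,_]′)
open import Data.Unit using (tt)
open import Data.Vec using (lookup; _[_]≔_)
open import Data.Vec.Properties using (lookup∘tabulate; lookup-replicate; lookup∘update; lookup∘update′)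
open import Function using (_∘_; mk⇔)
open import Relation.Binary.PropositionalEquality using (_≡_; _≢_; refl; sym; trans; cong; cong₂; subst; subst₂; module ≡-Reasoning)
open import Relation.Nullary using (¬_; yes; no; contradiction)

-- A structured language and its weakest preconditions

-- The program is not verified on the machine directly. It is written in a small structured language
-- over natural numbers and unbounded arrays, in which safety conditions are explicit and only loop
-- iterations are counted. A simulation turns every execution into a run of the word-RAM whose time
-- is at most a constant, read off the syntax, times one more than the number of iterations. The
-- obstacle to quadratic time is that grouping and marking by letters happen once per trie node:
-- clearing an array indexed by letters each time could cost n³. The arrays `lChild` and `lMark`
-- therefore store class numbers, which only grow, and entries left behind by earlier nodes are
-- recognised by being too small. Since nodes are numbered in order of creation, the children of a
-- node form an interval and need no lists of their own. Reversal replaces suffix links: L(T) is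
-- closed under it, so the reverse of a u is again a node, with last letter a and with the reverse
-- of u as its parent.

_≡ᶠ_ : ∀ {m} → Fin m → Fin m → Bool
zero  ≡ᶠ zero  = true
zero  ≡ᶠ suc _ = false
suc _ ≡ᶠ zero  = false
suc i ≡ᶠ suc j = i ≡ᶠ j

≡ᶠ-refl : ∀ {m} (i : Fin m) → (i ≡ᶠ i) ≡ true
≡ᶠ-refl zero    = refl
≡ᶠ-refl (suc i) = ≡ᶠ-refl i

≢⇒≡ᶠ : ∀ {m} {i j : Fin m} → i ≢ j → (i ≡ᶠ j) ≡ false
≢⇒≡ᶠ {i = zero}  {zero}  i≢j = contradiction refl i≢j
≢⇒≡ᶠ {i = zero}  {suc _} _   = refl
≢⇒≡ᶠ {i = suc _} {zero}  _   = refl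
≢⇒≡ᶠ {i = suc _} {suc _} i≢j = ≢⇒≡ᶠ (i≢j ∘ cong suc)

-- On the closed names of registers and arrays in a program the Boolean test `_≡ᶠ_` evaluates, so
-- that a lookup after several assignments is resolved by computation. Array indices are symbolic,
-- which is why `put` decides equality instead.
assign : ∀ {A : Set} {m} → Fin m → A → (Fin m → A) → Fin m → A
assign i x f j = if j ≡ᶠ i then x else f j

put : ∀ {A : Set} → ℕ → A → (ℕ → A) → ℕ → A
put i x f j with j ≟ i
... | yes _ = x
... | no  _ = f j

put-same : ∀ {A : Set} i (x : A) f → put i x f i ≡ x
put-same i x f with i ≟ i
... | yes _   = refl
... | no  i≢i = contradiction refl i≢i

put-other : ∀ {A : Set} {i j} (x : A) f → j ≢ i → put i x f j ≡ f j
put-other {i = i} {j} x f j≢i with j ≟ i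
... | yes j≡i = contradiction j≡i j≢i
... | no  _   = refl

-- A structured language over registers, K unbounded arrays, a read-only input
-- and an output. Array f occupies the memory cells I + (K j + f), so that
-- distinct arrays never interfere.
module Lang (R K : ℕ) where

  -- Literals stay below 8, so that they fit into a machine word as soon as `8 ≤ 2 ^ w`.
  data Opd : Set where
    var : Fin R → Opd
    lit : Fin 8 → Opd

  infixr 5 _⨾_

  -- The multiply-add `fma` is the only arithmetic: assignment, increment, the index `n * v + x` of
  -- a pair of vertices and the input address `3 * j + b` are all instances of it.
  data Cmd : Set where
    fma      : Fin R → (a b c : Opd) → Cmd
    eqT      : Fin R → (a b : Opd) → Cmd
    ld       : Fin R → Fin K → Opd → Cmd
    st       : Fin K → (a b : Opd) → Cmd
    inp      : Fin R → Opd → Cmd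
    out      : Opd → Cmd
    skip     : Cmd
    _⨾_      : Cmd → Cmd → Cmd
    ifLt     : (a b : Opd) → (P Q : Cmd) → Cmd
    whileLt  : (a b : Opd) → Cmd → Cmd
    call     : Cmd → Cmd

  record St : Set where
    constructor ⟪_,_,_,_⟫
    field
      regsᴴ : Fin R → ℕ
      arrs  : Fin K → ℕ → ℕ
      outᴴ  : List ℕ
      ticks : ℕ

  open St public

  valueᴴ : (Fin R → ℕ) → Opd → ℕ
  valueᴴ ρ (var i) = ρ i
  valueᴴ ρ (lit k) = toℕ k

  _⟦_⟧ : St → Opd → ℕ
  s ⟦ a ⟧ = valueᴴ (regsᴴ s) a

  setᴿ : Fin R → ℕ → St → St
  setᴿ i x s = ⟪ assign i x (regsᴴ s) , arrs s , outᴴ s , ticks s ⟫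

  setᴬ : Fin K → ℕ → ℕ → St → St
  setᴬ f j x s = ⟪ regsᴴ s , assign f (put j x (arrs s f)) (arrs s) , outᴴ s , ticks s ⟫

  write : ℕ → St → St
  write x s = ⟪ regsᴴ s , arrs s , outᴴ s ∷ʳ x , ticks s ⟫

  tick : St → St
  tick s = ⟪ regsᴴ s , arrs s , outᴴ s , suc (ticks s) ⟫

  -- `I` is the size of the input region and `N` bounds both array indices and arithmetic results.
  -- These side conditions are what the simulation uses to exclude overflow and accesses outside the
  -- memory.
  module Sem (input : ℕ → ℕ) (I N : ℕ) where

    -- Only iterations of loops are counted: up to a factor depending on the
    -- command, their number is the running time.
    data Exec : Cmd → St → St → Set where
      fma  : ∀ {x a b c s} → s ⟦ a ⟧ * s ⟦ b ⟧ + s ⟦ c ⟧ < N →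
             Exec (fma x a b c) s (setᴿ x (s ⟦ a ⟧ * s ⟦ b ⟧ + s ⟦ c ⟧) s)
      eqT  : ∀ {x a b s} → Exec (eqT x a b) s (setᴿ x (toBit (s ⟦ a ⟧ ≡ᵇ s ⟦ b ⟧)) s)
      ld   : ∀ {x f a s} → s ⟦ a ⟧ < N → Exec (ld x f a) s (setᴿ x (arrs s f (s ⟦ a ⟧)) s)
      st   : ∀ {f a b s} → s ⟦ a ⟧ < N → Exec (st f a b) s (setᴬ f (s ⟦ a ⟧) (s ⟦ b ⟧) s)
      inp  : ∀ {x a s} → s ⟦ a ⟧ < I → Exec (inp x a) s (setᴿ x (input (s ⟦ a ⟧)) s)
      out  : ∀ {a s} → Exec (out a) s (write (s ⟦ a ⟧) s)
      skip : ∀ {s} → Exec skip s s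
      _⨾_  : ∀ {P Q s s′ s″} → Exec P s s′ → Exec Q s′ s″ → Exec (P ⨾ Q) s s″
      ifT  : ∀ {a b P Q s s′} → s ⟦ a ⟧ < s ⟦ b ⟧ → Exec P s s′ → Exec (ifLt a b P Q) s s′
      ifF  : ∀ {a b P Q s s′} → ¬ s ⟦ a ⟧ < s ⟦ b ⟧ → Exec Q s s′ → Exec (ifLt a b P Q) s s′
      wT   : ∀ {a b P s s′ s″} → s ⟦ a ⟧ < s ⟦ b ⟧ → Exec P (tick s) s′ →
             Exec (whileLt a b P) s′ s″ → Exec (whileLt a b P) s s″
      call : ∀ {P s s′} → Exec P s s′ → Exec (call P) s s′
      wF   : ∀ {a b P s} → ¬ s ⟦ a ⟧ < s ⟦ b ⟧ → Exec (whileLt a b P) s s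

    WP : Cmd → (St → Set) → St → Set
    WP P Φ s = ∃[ s′ ] Exec P s s′ × Φ s′

    Predicate : Set₁
    Predicate = (Fin R → ℕ) → (Fin K → ℕ → ℕ) → List ℕ → ℕ → Set

    _∋_ : Predicate → St → Set
    Φ ∋ s = Φ (regsᴴ s) (arrs s) (outᴴ s) (ticks s)

    -- Weakest preconditions on the components of the state: on whole states
    -- the terms would grow much faster. A call behaves as its body, but is not
    -- unfolded.
    wpᶜ : Cmd → Predicate → Predicate
    wpᶜ (fma x a b c) Φ ρ α o τ =
      (valueᴴ ρ a * valueᴴ ρ b + valueᴴ ρ c < N) × Φ (assign x (valueᴴ ρ a * valueᴴ ρ b + valueᴴ ρ c) ρ) α o τ
    wpᶜ (eqT x a b) Φ ρ α o τ = Φ (assign x (toBit (valueᴴ ρ a ≡ᵇ valueᴴ ρ b)) ρ) α o τ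
    wpᶜ (ld x f a)  Φ ρ α o τ = (valueᴴ ρ a < N) × Φ (assign x (α f (valueᴴ ρ a)) ρ) α o τ
    wpᶜ (st f a b)  Φ ρ α o τ = (valueᴴ ρ a < N) × Φ ρ (assign f (put (valueᴴ ρ a) (valueᴴ ρ b) (α f)) α) o τ
    wpᶜ (inp x a)   Φ ρ α o τ = (valueᴴ ρ a < I) × Φ (assign x (input (valueᴴ ρ a)) ρ) α o τ
    wpᶜ (out a)     Φ ρ α o τ = Φ ρ α (o ∷ʳ valueᴴ ρ a) τ
    wpᶜ skip        Φ = Φ
    wpᶜ (P ⨾ Q)     Φ = wpᶜ P (wpᶜ Q Φ)
    wpᶜ (ifLt a b P Q) Φ ρ α o τ =
      (valueᴴ ρ a < valueᴴ ρ b → wpᶜ P Φ ρ α o τ) × (¬ valueᴴ ρ a < valueᴴ ρ b → wpᶜ Q Φ ρ α o τ)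
    wpᶜ (whileLt a b P) Φ ρ α o τ = WP (whileLt a b P) (Φ ∋_) ⟪ ρ , α , o , τ ⟫
    wpᶜ (call P)        Φ ρ α o τ = WP P (Φ ∋_) ⟪ ρ , α , o , τ ⟫

    wp : Cmd → (St → Set) → St → Set
    wp P Φ s = wpᶜ P (λ ρ α o τ → Φ ⟪ ρ , α , o , τ ⟫) ∋ s

    runᶜ : ∀ P {Φ s} → wpᶜ P Φ ∋ s → WP P (Φ ∋_) s
    runᶜ (fma x a b c) (safe , φ) = _ , fma safe , φ
    runᶜ (eqT x a b)   φ          = _ , eqT , φ
    runᶜ (ld x f a)    (safe , φ) = _ , ld safe , φ
    runᶜ (st f a b)    (safe , φ) = _ , st safe , φ
    runᶜ (inp x a)     (safe , φ) = _ , inp safe , φ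
    runᶜ (out a)       φ          = _ , out , φ
    runᶜ skip          φ          = _ , skip , φ
    runᶜ (P ⨾ Q) {Φ}   φ with runᶜ P {wpᶜ Q Φ} φ
    ... | _ , e , ψ with runᶜ Q {Φ} ψ
    ...   | _ , e′ , χ = _ , e ⨾ e′ , χ
    runᶜ (ifLt a b P Q) {Φ} {s} (φ , ψ) with s ⟦ a ⟧ <? s ⟦ b ⟧
    ... | yes a<b with runᶜ P {Φ} (φ a<b)
    ...   | _ , e , χ = _ , ifT a<b e , χ
    runᶜ (ifLt a b P Q) {Φ} {s} (φ , ψ) | no a≮b with runᶜ Q {Φ} (ψ a≮b)
    ...   | _ , e , χ = _ , ifF a≮b e , χ
    runᶜ (whileLt a b P) φ = φ
    runᶜ (call P) (s′ , e , φ) = s′ , call e , φ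

    run : ∀ P {Φ s} → wp P Φ s → WP P Φ s
    run P {Φ} {s} = runᶜ P {λ ρ α o τ → Φ ⟪ ρ , α , o , τ ⟫} {s}

    WP-mono : ∀ {P Φ Ψ s} → (∀ s′ → Φ s′ → Ψ s′) → WP P Φ s → WP P Ψ s
    WP-mono f (s′ , e , φ) = s′ , e , f s′ φ

    -- The index of the invariant is the number of iterations left.
    while-rule : ∀ {a b P} (J : ℕ → St → Set) →
      (∀ k s → J (suc k) s → s ⟦ a ⟧ < s ⟦ b ⟧ → wp P (J k) (tick s)) →
      (∀ s → J 0 s → ¬ s ⟦ a ⟧ < s ⟦ b ⟧) →
      ∀ k s → J k s → WP (whileLt a b P) (λ s′ → ∃[ k′ ] J k′ s′ × ¬ s′ ⟦ a ⟧ < s′ ⟦ b ⟧) s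
    while-rule {a} {b} {P} J stepJ stopJ k s j with s ⟦ a ⟧ <? s ⟦ b ⟧
    ... | no a≮b = s , wF a≮b , k , j , a≮b
    while-rule {a} {b} {P} J stepJ stopJ zero s j | yes a<b = contradiction a<b (stopJ s j)
    while-rule {a} {b} {P} J stepJ stopJ (suc k) s j | yes a<b with run P (stepJ k s j a<b)
    ... | s′ , e , j′ with while-rule J stepJ stopJ k s′ j′
    ...   | s″ , e′ , post = s″ , wT a<b e e′ , post

  -- Register 0 is scratch and register 1 holds the base address I.
  opd : Opd → Operand (2 + R)
  opd (var i) = reg (suc (suc i))
  opd (lit k) = const (toℕ k)

  scratch base : Fin (2 + R)
  scratch = zero
  base    = suc zero

  address : Fin K → Opd → Program (2 + R)
  address f a = instr (arith scratch mul (const K) (opd a)) ⨾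
                instr (arith scratch add (reg scratch) (const (toℕ f))) ⨾
                instr (arith scratch add (reg base) (reg scratch))

  test : Opd → Opd → Program (2 + R)
  test a b = instr (arith scratch lt (opd a) (opd b))

  compile : Cmd → Program (2 + R)
  compile (fma x a b c)   = instr (arith scratch mul (opd a) (opd b)) ⨾
                            instr (arith (suc (suc x)) add (reg scratch) (opd c))
  compile (eqT x a b)     = instr (arith (suc (suc x)) eq (opd a) (opd b))
  compile (ld x f a)      = address f a ⨾ instr (load (suc (suc x)) (reg scratch))
  compile (st f a b)      = address f a ⨾ instr (store (reg scratch) (opd b))
  compile (inp x a)       = instr (load (suc (suc x)) (opd a))
  compile (out a)         = instr (emit (opd a))
  compile skip            = skip
  compile (P ⨾ Q)         = compile P ⨾ compile Q
  compile (ifLt a b P Q)  = test a b ⨾ ifNonZero (reg scratch) (compile P) (compile Q)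
  compile (whileLt a b P) = test a b ⨾ while (reg scratch) (compile P ⨾ test a b)
  compile (call P)        = compile P

  -- Not a running time but the factor in the bound `t ≤ cost P * suc δ`, where `δ` is the number of
  -- loop iterations performed.
  cost : Cmd → ℕ
  cost (ld _ _ _)      = 4
  cost (st _ _ _)      = 4
  cost (fma _ _ _ _)   = 2
  cost (P ⨾ Q)         = cost P + cost Q
  cost (ifLt _ _ P Q)  = 2 + (cost P + cost Q)
  cost (whileLt _ _ P) = 2 + cost P
  cost (call P)        = cost P
  cost _               = 1

-- Simulation by the word-RAM

toℕ-trunc : ∀ w {x} → x < 2 ^ w → toℕ (trunc w x) ≡ x
toℕ-trunc w {x} x<2^w =
  trans (toℕ-fromℕ< _) (m<n⇒m%n≡m {{m^n≢0 2 w}} x<2^w)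

toBit-true : ∀ {x y} → x < y → toBit (x <ᵇ y) ≡ 1
toBit-true {x} {y} x<y with x <ᵇ y | <⇒<ᵇ x<y
... | true | _ = refl

toBit-false : ∀ {x y} → ¬ x < y → toBit (x <ᵇ y) ≡ 0
toBit-false {x} {y} x≮y with x <ᵇ y in e
... | false = refl
... | true  = contradiction (<ᵇ⇒< x y (subst T (sym e) tt)) x≮y

toBit<2 : ∀ b → toBit b < 2
toBit<2 true  = ≤-refl
toBit<2 false = s≤s z≤n

-- Uniqueness of quotient and remainder, obtained from the injectivity of `combine`. The bound
-- `suc (i + j)` only serves to place `i` and `j` in a common `Fin`.
pair-injective : ∀ k {i j x y} → x < k → y < k → k * i + x ≡ k * j + y → i ≡ j × x ≡ y
pair-injective k {i} {j} {x} {y} x<k y<k e =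
  trans (sym (toℕ-fromℕ< i<b)) (trans (cong toℕ (combine-injectiveˡ i′ x′ j′ y′ eq′)) (toℕ-fromℕ< j<b)) ,
  trans (sym (toℕ-fromℕ< x<k)) (trans (cong toℕ (combine-injectiveʳ i′ x′ j′ y′ eq′)) (toℕ-fromℕ< y<k))
  where
  b = suc (i + j)
  i<b : i < b
  i<b = s≤s (m≤m+n i j)
  j<b : j < b
  j<b = s≤s (m≤n+m j i)
  i′ = fromℕ< i<b
  j′ = fromℕ< j<b
  x′ = fromℕ< x<k
  y′ = fromℕ< y<k
  eq′ : combine i′ x′ ≡ combine j′ y′
  eq′ = toℕ-injective (trans (toℕ-combine i′ x′)
    (trans (cong₂ (λ p q → k * p + q) (toℕ-fromℕ< i<b) (toℕ-fromℕ< x<k))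
    (trans e (sym (trans (toℕ-combine j′ y′)
      (cong₂ (λ p q → k * p + q) (toℕ-fromℕ< j<b) (toℕ-fromℕ< y<k)))))))

pair-bound : ∀ {m k i x} → i < m → x < k → k * i + x < k * m
pair-bound {m} {k} {i} {x} i<m x<k = begin-strict
  k * i + x   <⟨ +-monoʳ-< (k * i) x<k ⟩
  k * i + k   ≡⟨ trans (+-comm (k * i) k) (sym (*-suc k i)) ⟩
  k * suc i   ≤⟨ *-monoʳ-≤ k i<m ⟩
  k * m       ∎
  where open ≤-Reasoning

module Simulation {R K : ℕ} (input : ℕ → ℕ) (I N : ℕ) {w S : ℕ}
  (fits : I + K * N ≤ S) (I+KN< : I + K * N < 2 ^ w) (N≤ : N ≤ 2 ^ w) (K< : K < 2 ^ w) (8≤ : 8 ≤ 2 ^ w) where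

  open Lang R K
  open Sem input I N

  -- The scratch register and the tick counter are left unconstrained, so that both may change
  -- freely. An unbounded array is represented only at the indices below `N`.
  record _≈_ (σ : State w (2 + R) S) (s : St) : Set where
    field
      regs≈  : ∀ i → toℕ (lookup (regs σ) (suc (suc i))) ≡ regsᴴ s i
      base≈  : toℕ (lookup (regs σ) base) ≡ I
      arrs≈  : ∀ f {j} → j < N → ∀ p → toℕ p ≡ I + (K * j + toℕ f) →
               toℕ (lookup (mem σ) p) ≡ arrs s f j
      input≈ : ∀ {i} → i < I → ∀ p → toℕ p ≡ i → toℕ (lookup (mem σ) p) ≡ input i
      out≈   : map toℕ (output σ) ≡ outᴴ s

  open _≈_

  value≈ : ∀ {σ s} → σ ≈ s → ∀ o → toℕ (value (opd o) σ) ≡ s ⟦ o ⟧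
  value≈ σ≈s (var i) = regs≈ σ≈s i
  value≈ σ≈s (lit k) = toℕ-trunc w (<-≤-trans (toℕ<n k) 8≤)

  tick≈ : ∀ {σ s} → σ ≈ s → σ ≈ tick s
  tick≈ σ≈s = record { regs≈ = regs≈ σ≈s ; base≈ = base≈ σ≈s ; arrs≈ = arrs≈ σ≈s
                     ; input≈ = input≈ σ≈s ; out≈ = out≈ σ≈s }

  scratch≈ : ∀ {σ s} x → σ ≈ s → setReg scratch x σ ≈ s
  scratch≈ {σ} x σ≈s = record
    { regs≈  = λ i → trans (cong toℕ (lookup∘update′ {i = suc (suc i)} {j = scratch} (λ ()) (regs σ) x)) (regs≈ σ≈s i)
    ; base≈  = trans (cong toℕ (lookup∘update′ {i = base} {j = scratch} (λ ()) (regs σ) x)) (base≈ σ≈s)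
    ; arrs≈  = arrs≈ σ≈s ; input≈ = input≈ σ≈s ; out≈ = out≈ σ≈s }

  suc-suc-injective : ∀ {m} {i j : Fin m} → Fin.suc (Fin.suc i) ≡ suc (suc j) → i ≡ j
  suc-suc-injective refl = refl

  set≈ : ∀ {σ s} x {y y′} → toℕ y ≡ y′ → σ ≈ s → setReg (suc (suc x)) y σ ≈ setᴿ x y′ s
  set≈ {σ} {s} x {y} {y′} y≡ σ≈s = record
    { regs≈  = regs′
    ; base≈  = trans (cong toℕ (lookup∘update′ {i = base} {j = suc (suc x)} (λ ()) (regs σ) y)) (base≈ σ≈s)
    ; arrs≈  = arrs≈ σ≈s ; input≈ = input≈ σ≈s ; out≈ = out≈ σ≈s }
    where
    regs′ : ∀ i → toℕ (lookup (regs σ [ suc (suc x) ]≔ y) (suc (suc i))) ≡ assign x y′ (regsᴴ s) i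
    regs′ i with i ≟ᶠ x
    ... | yes refl rewrite ≡ᶠ-refl x = trans (cong toℕ (lookup∘update (suc (suc x)) (regs σ) y)) y≡
    ... | no i≢x rewrite ≢⇒≡ᶠ i≢x =
      trans (cong toℕ (lookup∘update′ {i = suc (suc i)} {j = suc (suc x)} (i≢x ∘ suc-suc-injective) (regs σ) y)) (regs≈ σ≈s i)

  eval≈ : ∀ o {x y x′ y′} → toℕ x ≡ x′ → toℕ y ≡ y′ → evalℕ w o x′ y′ < 2 ^ w →
          toℕ (eval w o x y) ≡ evalℕ w o x′ y′
  eval≈ o refl refl b = toℕ-trunc w b

  1<2^w : 2 ≤ 2 ^ w
  1<2^w = ≤-trans (s≤s (s≤s z≤n)) 8≤

  Simulated : ∀ {r} → Program r → State w r S → (State w r S → Set) → ℕ → Set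
  Simulated P σ Φ t = ∃[ σ′ ] (⟨ P , σ ⟩⇓[ t ] σ′ × Φ σ′)

  address-correct : ∀ {σ s} → σ ≈ s → ∀ f o → s ⟦ o ⟧ < N →
    Simulated (address f o) σ
      (λ σ′ → σ′ ≈ s × toℕ (lookup (regs σ′) scratch) ≡ I + (K * s ⟦ o ⟧ + toℕ f)) 3
  address-correct {σ} {s} σ≈s f o o<N = _ , instr arith ⨾ instr arith ⨾ instr arith , ≈₃ , e₃
    where
    j = s ⟦ o ⟧
    bound : I + (K * j + toℕ f) < 2 ^ w
    bound = <-trans (+-monoʳ-< I (pair-bound {k = K} o<N (toℕ<n f))) I+KN<
    x₁ = eval w mul (trunc w K) (value (opd o) σ)
    e₁ : toℕ x₁ ≡ K * j
    e₁ = eval≈ mul (toℕ-trunc w K<) (value≈ σ≈s o)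
      (≤-<-trans (≤-trans (m≤m+n _ (toℕ f)) (m≤n+m _ I)) bound)
    σ₁ = setReg scratch x₁ σ
    ≈₁ : σ₁ ≈ s
    ≈₁ = scratch≈ x₁ σ≈s
    x₂ = eval w add (lookup (regs σ₁) scratch) (trunc w (toℕ f))
    e₂ : toℕ x₂ ≡ K * j + toℕ f
    e₂ = eval≈ add (trans (cong toℕ (lookup∘update scratch (regs σ) x₁)) e₁)
                   (toℕ-trunc w (<-trans (toℕ<n f) K<))
                   (≤-<-trans (m≤n+m _ I) bound)
    σ₂ = setReg scratch x₂ σ₁
    ≈₂ : σ₂ ≈ s
    ≈₂ = scratch≈ x₂ ≈₁
    x₃ = eval w add (lookup (regs σ₂) base) (lookup (regs σ₂) scratch)
    e₃′ : toℕ x₃ ≡ I + (K * j + toℕ f)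
    e₃′ = eval≈ add (base≈ ≈₂) (trans (cong toℕ (lookup∘update scratch (regs σ₁) x₂)) e₂) bound
    ≈₃ : setReg scratch x₃ σ₂ ≈ s
    ≈₃ = scratch≈ x₃ ≈₂
    e₃ : toℕ (lookup (regs σ₂ [ scratch ]≔ x₃) scratch) ≡ I + (K * j + toℕ f)
    e₃ = trans (cong toℕ (lookup∘update scratch (regs σ₂) x₃)) e₃′

  cell : ∀ f {j} → j < N → Σ[ p ∈ Fin S ] toℕ p ≡ I + (K * j + toℕ f)
  cell f {j} j<N = fromℕ< b , toℕ-fromℕ< b
    where
    b : I + (K * j + toℕ f) < S
    b = <-≤-trans (+-monoʳ-< I (pair-bound {k = K} j<N (toℕ<n f))) fits

  store≈ : ∀ {σ s} → σ ≈ s → ∀ f {j} → j < N → ∀ p → toℕ p ≡ I + (K * j + toℕ f) →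
           ∀ {y y′} → toℕ y ≡ y′ → record σ { mem = mem σ [ p ]≔ y } ≈ setᴬ f j y′ s
  store≈ {σ} {s} σ≈s f {j} j<N p p≡ {y} {y′} y≡ = record
    { regs≈ = regs≈ σ≈s ; base≈ = base≈ σ≈s ; arrs≈ = arrs′ ; input≈ = input′ ; out≈ = out≈ σ≈s }
    where
    arrs′ : ∀ g {i} → i < N → ∀ q → toℕ q ≡ I + (K * i + toℕ g) →
            toℕ (lookup (mem σ [ p ]≔ y) q) ≡ assign f (put j y′ (arrs s f)) (arrs s) g i
    arrs′ g {i} i<N q q≡ with g ≟ᶠ f
    ... | no g≢f rewrite ≢⇒≡ᶠ g≢f = trans (cong toℕ (lookup∘update′ q≢p (mem σ) y)) (arrs≈ σ≈s g i<N q q≡)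
      where
      q≢p : q ≢ p
      q≢p refl = g≢f (toℕ-injective (proj₂ (pair-injective K (toℕ<n g) (toℕ<n f) (+-cancelˡ-≡ I _ _ (trans (sym q≡) p≡)))))
    ... | yes refl rewrite ≡ᶠ-refl g with i ≟ j
    ...   | yes refl = trans (cong (λ z → toℕ (lookup (mem σ [ p ]≔ y) z)) (toℕ-injective (trans q≡ (sym p≡))))
                       (trans (cong toℕ (lookup∘update p (mem σ) y)) y≡)
    ...   | no i≢j = trans (cong toℕ (lookup∘update′ q≢p (mem σ) y)) (arrs≈ σ≈s g i<N q q≡)
      where
      q≢p : q ≢ p
      q≢p refl = i≢j (proj₁ (pair-injective K (toℕ<n g) (toℕ<n g) (+-cancelˡ-≡ I _ _ (trans (sym q≡) p≡))))
    input′ : ∀ {i} → i < I → ∀ q → toℕ q ≡ i → toℕ (lookup (mem σ [ p ]≔ y) q) ≡ input i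
    input′ i<I q refl = trans (cong toℕ (lookup∘update′ q≢p (mem σ) y)) (input≈ σ≈s i<I q refl)
      where
      q≢p : q ≢ p
      q≢p refl = <⇒≱ i<I (subst (I ≤_) (sym p≡) (m≤m+n I _))

  test-correct : ∀ {σ s} → σ ≈ s → ∀ a b →
    Simulated (test a b) σ
      (λ σ′ → σ′ ≈ s × toℕ (lookup (regs σ′) scratch) ≡ toBit (s ⟦ a ⟧ <ᵇ s ⟦ b ⟧)) 1
  test-correct {σ} {s} σ≈s a b = _ , instr arith , scratch≈ _ σ≈s ,
    trans (cong toℕ (lookup∘update scratch (regs σ) _))
      (eval≈ lt (value≈ σ≈s a) (value≈ σ≈s b) (<-≤-trans (toBit<2 _) 1<2^w))

  true≢0 : ∀ (σ : State w (2 + R) S) {x y} → toℕ (lookup (regs σ) scratch) ≡ toBit (x <ᵇ y) → x < y → IsNonZero (reg scratch) σ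
  true≢0 _ e x<y z with trans (sym z) (trans e (toBit-true x<y))
  ... | ()

  false≡0 : ∀ (σ : State w (2 + R) S) {x y} → toℕ (lookup (regs σ) scratch) ≡ toBit (x <ᵇ y) → ¬ x < y → IsZero (reg scratch) σ
  false≡0 _ e x≮y = trans e (toBit-false x≮y)

  -- The bound has `suc δ` in place of `δ` because commands without any iteration take time as well.
  Run : Program (2 + R) → ℕ → State w (2 + R) S → St → St → Set
  Run P κ σ s s′ = ∃[ σ′ ] ∃[ t ] ∃[ δ ]
    ⟨ P , σ ⟩⇓[ t ] σ′ × σ′ ≈ s′ × ticks s′ ≡ δ + ticks s × t ≤ κ * suc δ

  seq-bound : ∀ p q a b → p * suc a + q * suc b ≤ (p + q) * suc (b + a)
  seq-bound p q a b = begin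
    p * suc a + q * suc b                 ≤⟨ +-mono-≤ (*-monoʳ-≤ p (s≤s (m≤n+m a b))) (*-monoʳ-≤ q (s≤s (m≤m+n b a))) ⟩
    p * suc (b + a) + q * suc (b + a)     ≡⟨ *-distribʳ-+ (suc (b + a)) p q ⟨
    (p + q) * suc (b + a)                 ∎
    where open ≤-Reasoning

  branch-boundˡ : ∀ p q a → 2 + p * suc a ≤ (2 + (p + q)) * suc a
  branch-boundˡ p q a = begin
    2 + p * suc a                ≤⟨ +-mono-≤ (m≤m*n 2 (suc a)) (*-monoˡ-≤ (suc a) (m≤m+n p q)) ⟩
    2 * suc a + (p + q) * suc a  ≡⟨ *-distribʳ-+ (suc a) 2 (p + q) ⟨
    (2 + (p + q)) * suc a        ∎
    where open ≤-Reasoning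

  branch-boundʳ : ∀ p q a → 2 + q * suc a ≤ (2 + (p + q)) * suc a
  branch-boundʳ p q a = subst (λ z → 2 + q * suc a ≤ (2 + z) * suc a) (+-comm q p) (branch-boundˡ q p a)

  loop-bound : ∀ p a b → suc ((p * suc a + 1) + suc ((2 + p) * b)) ≤ suc ((2 + p) * (b + suc a))
  loop-bound p a b = ≤-trans (≤-reflexive (lemma₁ p a b)) (≤-trans (m≤m+n _ (2 * a)) (≤-reflexive (lemma₂ p a b)))
    where
    lemma₁ : ∀ p a b → suc ((p * suc a + 1) + suc ((2 + p) * b)) ≡ suc (p * suc a + 2 + (2 + p) * b)
    lemma₁ = solve 3 (λ p a b → con 1 :+ ((p :* (con 1 :+ a) :+ con 1) :+ (con 1 :+ (con 2 :+ p) :* b))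
                             := con 1 :+ (p :* (con 1 :+ a) :+ con 2 :+ (con 2 :+ p) :* b)) refl
    lemma₂ : ∀ p a b → suc (p * suc a + 2 + (2 + p) * b) + 2 * a ≡ suc ((2 + p) * (b + suc a))
    lemma₂ = solve 3 (λ p a b → con 1 :+ (p :* (con 1 :+ a) :+ con 2 :+ (con 2 :+ p) :* b) :+ con 2 :* a
                             := con 1 :+ (con 2 :+ p) :* (b :+ (con 1 :+ a))) refl

  whole-loop : ∀ p a → 1 + suc ((2 + p) * a) ≤ (2 + p) * suc a
  whole-loop p a = ≤-trans (m≤m+n _ p) (≤-reflexive (lemma p a))
    where
    lemma : ∀ p a → 1 + suc ((2 + p) * a) + p ≡ (2 + p) * suc a
    lemma = solve 2 (λ p a → con 1 :+ (con 1 :+ (con 2 :+ p) :* a) :+ p := (con 2 :+ p) :* (con 1 :+ a)) refl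

  mutual
    simulate : ∀ {P s s′} → Exec P s s′ → ∀ {σ} → σ ≈ s → Run (compile P) (cost P) σ s s′
    simulate (fma {x} {a} {b} {c} {s} safe) {σ} σ≈s =
      _ , _ , 0 , instr arith ⨾ instr arith ,
      set≈ x (eval≈ add (trans (cong toℕ (lookup∘update scratch (regs σ) _))
                               (eval≈ mul (value≈ σ≈s a) (value≈ σ≈s b) (≤-<-trans (m≤m+n _ _) bound)))
                        (value≈ ≈₁ c) bound) ≈₁ , refl , ≤-refl
      where
      bound : s ⟦ a ⟧ * s ⟦ b ⟧ + s ⟦ c ⟧ < 2 ^ w
      bound = <-≤-trans safe N≤
      ≈₁ = scratch≈ (eval w mul (value (opd a) σ) (value (opd b) σ)) σ≈s
    simulate (eqT {x} {a} {b}) σ≈s =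
      _ , _ , 0 , instr arith ,
      set≈ x (eval≈ eq (value≈ σ≈s a) (value≈ σ≈s b) (<-≤-trans (toBit<2 _) 1<2^w)) σ≈s , refl , ≤-refl
    simulate (ld {x} {f} {a} safe) σ≈s =
      let σ₁ , e , ≈₁ , addr = address-correct σ≈s f a safe
          p , p≡ = cell f safe
      in _ , _ , 0 , e ⨾ instr (load p (trans p≡ (sym addr))) ,
         set≈ x (arrs≈ ≈₁ f safe p p≡) ≈₁ , refl , ≤-refl
    simulate (st {f} {a} {b} safe) σ≈s =
      let σ₁ , e , ≈₁ , addr = address-correct σ≈s f a safe
          p , p≡ = cell f safe
      in _ , _ , 0 , e ⨾ instr (store p (trans p≡ (sym addr))) ,
         store≈ ≈₁ f safe p p≡ (value≈ ≈₁ b) , refl , ≤-refl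
    simulate (inp {x} {a} safe) σ≈s =
      let b = <-≤-trans safe (≤-trans (m≤m+n I _) fits)
          p = fromℕ< b
      in _ , _ , 0 , instr (load p (trans (toℕ-fromℕ< b) (sym (value≈ σ≈s a)))) ,
         set≈ x (input≈ σ≈s safe p (toℕ-fromℕ< b)) σ≈s , refl , ≤-refl
    simulate (out {a}) {σ} σ≈s =
      _ , _ , 0 , instr emit ,
      record { regs≈ = regs≈ σ≈s ; base≈ = base≈ σ≈s ; arrs≈ = arrs≈ σ≈s ; input≈ = input≈ σ≈s
             ; out≈ = trans (map-++ toℕ (output σ) _) (cong₂ (λ x y → x ++ [ y ]) (out≈ σ≈s) (value≈ σ≈s a)) } ,
      refl , ≤-refl
    simulate skip σ≈s = _ , _ , 0 , skip , σ≈s , refl , ≤-refl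
    simulate {P = P ⨾ Q} {s = s} (e ⨾ e′) σ≈s =
      let _ , t₁ , δ₁ , r₁ , ≈₁ , d₁ , b₁ = simulate e σ≈s
          _ , t₂ , δ₂ , r₂ , ≈₂ , d₂ , b₂ = simulate e′ ≈₁
      in _ , _ , δ₂ + δ₁ , r₁ ⨾ r₂ , ≈₂ ,
         trans d₂ (trans (cong (δ₂ +_) d₁) (sym (+-assoc δ₂ δ₁ (ticks s)))) ,
         ≤-trans (+-mono-≤ b₁ b₂) (seq-bound (cost P) (cost Q) δ₁ δ₂)
    simulate (ifT {a} {b} {P} {Q} a<b e) σ≈s =
      let σ₀ , r₀ , ≈₀ , c = test-correct σ≈s a b
          _ , t , δ , r , ≈₁ , d , bnd = simulate e ≈₀
      in _ , _ , δ , r₀ ⨾ ifTrue (true≢0 σ₀ c a<b) r , ≈₁ , d ,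
         ≤-trans (s≤s (s≤s bnd)) (branch-boundˡ (cost P) (cost Q) δ)
    simulate (ifF {a} {b} {P} {Q} a≮b e) σ≈s =
      let σ₀ , r₀ , ≈₀ , c = test-correct σ≈s a b
          _ , t , δ , r , ≈₁ , d , bnd = simulate e ≈₀
      in _ , _ , δ , r₀ ⨾ ifFalse (false≡0 σ₀ c a≮b) r , ≈₁ , d ,
         ≤-trans (s≤s (s≤s bnd)) (branch-boundʳ (cost P) (cost Q) δ)
    simulate (call e) σ≈s = simulate e σ≈s
    simulate e@(wT {a} {b} {P} _ _ _) = simulate-loop e
    simulate e@(wF {a} {b} {P} _) = simulate-loop e

    simulate-loop : ∀ {a b P s s′} → Exec (whileLt a b P) s s′ → ∀ {σ} → σ ≈ s →
                    Run (compile (whileLt a b P)) (2 + cost P) σ s s′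
    simulate-loop {a} {b} {P} e σ≈s =
      let σ₀ , r₀ , ≈₀ , c = test-correct σ≈s a b
          _ , t , δ , r , ≈₁ , d , bnd = iterate e ≈₀ c
      in _ , _ , δ , r₀ ⨾ r , ≈₁ , d , ≤-trans (s≤s bnd) (whole-loop (cost P) δ)

    -- The bound has the form 1 + factor * δ, sharper than that of `Run`: the tick of each iteration
    -- pays for the extra `suc` in the bound of the body, so no overhead accumulates over the
    -- iterations.
    iterate : ∀ {a b P s s′} → Exec (whileLt a b P) s s′ → ∀ {σ} → σ ≈ s →
              toℕ (lookup (regs σ) scratch) ≡ toBit (s ⟦ a ⟧ <ᵇ s ⟦ b ⟧) →
              ∃[ σ′ ] ∃[ t ] ∃[ δ ]
              ⟨ while (reg scratch) (compile P ⨾ test a b) , σ ⟩⇓[ t ] σ′ × σ′ ≈ s′ ×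
              ticks s′ ≡ δ + ticks s × t ≤ suc ((2 + cost P) * δ)
    iterate (wF a≮b) {σ} σ≈s c = _ , _ , 0 , whileFalse (false≡0 σ c a≮b) , σ≈s , refl , s≤s z≤n
    iterate {a} {b} {P} {s} (wT a<b e e′) {σ} σ≈s c =
      let _ , t₁ , δ₁ , r₁ , ≈₁ , d₁ , b₁ = simulate e (tick≈ σ≈s)
          _ , r₂ , ≈₂ , c₂ = test-correct ≈₁ a b
          _ , t₃ , δ₃ , r₃ , ≈₃ , d₃ , b₃ = iterate e′ ≈₂ c₂
      in _ , _ , δ₃ + suc δ₁ , whileTrue (true≢0 σ c a<b) (r₁ ⨾ r₂) r₃ , ≈₃ ,
         trans d₃ (trans (cong (δ₃ +_) (trans d₁ (+-suc δ₁ (ticks s)))) (sym (+-assoc δ₃ (suc δ₁) (ticks s)))) ,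
         ≤-trans (s≤s (+-mono-≤ (+-monoˡ-≤ 1 b₁) b₃)) (loop-bound (cost P) δ₁ δ₃)

-- Paths in trees

Unique-++⁻ : ∀ {A : Set} (xs : List A) {ys} → Unique (xs ++ ys) → Unique xs × (∀ {x} → x ∈ xs → x ∉ ys)
Unique-++⁻ []       u = [] , λ ()
Unique-++⁻ (x ∷ xs) u@(_ ∷ u′) with Unique-++⁻ xs u′
... | uxs , disj = ¬Any⇒All¬ xs (x∉ ∘ ∈-++⁺ˡ) ∷ uxs , λ where
    (here refl) → x∉ ∘ ∈-++⁺ʳ xs
    (there i)   → disj i
  where x∉ = Unique[x∷xs]⇒x∉xs u

Unique-∷ : ∀ {A : Set} {x : A} {xs} → x ∉ xs → Unique xs → Unique (x ∷ xs)
Unique-∷ {xs = xs} x∉xs u = ¬Any⇒All¬ xs x∉xs ∷ u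

Unique-∷ʳ : ∀ {A : Set} {x : A} {xs} → x ∉ xs → Unique xs → Unique (xs ∷ʳ x)
Unique-∷ʳ x∉xs u = Unique-++⁺ u ([] ∷ []) λ where (i , here refl) → x∉xs i

Unique-reverse : ∀ {A : Set} {xs : List A} → Unique xs → Unique (reverse xs)
Unique-reverse {xs = []} _ = []
Unique-reverse {xs = x ∷ xs} u@(_ ∷ u′) =
  subst Unique (sym (unfold-reverse x xs)) (Unique-∷ʳ (Unique[x∷xs]⇒x∉xs u ∘ reverse⁻) (Unique-reverse u′))

AllPairs-lookup : ∀ {A : Set} {R : A → A → Set} {xs x y} → AllPairs R xs →
                  x ∈ xs → y ∈ xs → x ≡ y ⊎ (R x y ⊎ R y x)
AllPairs-lookup (_ ∷ _)  (here refl) (here refl) = inj₁ refl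
AllPairs-lookup (r ∷ _)  (here refl) (there j)   = inj₂ (inj₁ (All.lookup r j))
AllPairs-lookup (r ∷ _)  (there i)   (here refl) = inj₂ (inj₂ (All.lookup r i))
AllPairs-lookup (_ ∷ rs) (there i)   (there j)   = AllPairs-lookup rs i j

AllPairs-index : ∀ {A : Set} {R : A → A → Set} {xs} → AllPairs R xs → ∀ i j →
                 i ≡ j ⊎ (R (List.lookup xs i) (List.lookup xs j) ⊎ R (List.lookup xs j) (List.lookup xs i))
AllPairs-index (_ ∷ _)  zero    zero    = inj₁ refl
AllPairs-index (r ∷ _)  zero    (suc j) = inj₂ (inj₁ (All.lookup r (∈-lookup j)))
AllPairs-index (r ∷ _)  (suc i) zero    = inj₂ (inj₂ (All.lookup r (∈-lookup i)))
AllPairs-index (_ ∷ rs) (suc i) (suc j) with AllPairs-index rs i j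
... | inj₁ i≡j = inj₁ (cong suc i≡j)
... | inj₂ r   = inj₂ r

module _ {n σ : ℕ} {G : Graph n σ} where

  end∈ : ∀ {u v vs x} → Walk G u v vs x → v ∈ vs
  end∈ stop       = here refl
  end∈ (step _ w) = there (end∈ w)

  snoc : ∀ {u v z vs x a} → Walk G u v vs x → G ⊢ v —[ a ]— z → Walk G u z (vs ∷ʳ z) (x ∷ʳ a)
  snoc stop       e = step e stop
  snoc (step f w) e = step f (snoc w e)

  reverse-walk : ∀ {u v vs x} → Walk G u v vs x → Walk G v u (reverse vs) (reverse x)
  reverse-walk stop = stop
  reverse-walk (step {u = u} {vs = vs} {a} {x} e w)
    rewrite unfold-reverse u vs | unfold-reverse a x = snoc (reverse-walk w) (swap e)

  join : ∀ {u v z vs vs′ x y} → Walk G u v vs x → Walk G v z vs′ y →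
         ∃[ ws ] Walk G u z ws (x ++ y) × (∀ {p} → p ∈ ws → p ∈ vs ⊎ p ∈ vs′)
  join stop w = _ , w , inj₂
  join (step e w) w′ with join w w′
  ... | ws , w″ , inc = _ , step e w″ , λ where
    (here refl) → inj₁ (here refl)
    (there i)   → [ inj₁ ∘ there , inj₂ ]′ (inc i)

  drop-to : ∀ {u v vs x p} → Walk G u v vs x → Unique vs → p ∈ vs →
            ∃[ ws ] ∃[ y ] Walk G p v ws y × Unique ws × (∀ {q} → q ∈ ws → q ∈ vs)
  drop-to stop       u       (here refl) = _ , _ , stop , u , λ i → i
  drop-to (step e w) u       (here refl) = _ , _ , step e w , u , λ i → i
  drop-to (step e w) (_ ∷ u) (there i) with drop-to w u i
  ... | ws , y , w′ , u′ , inc = ws , y , w′ , u′ , there ∘ inc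

  take-to : ∀ {u v vs x p} → Walk G u v vs x → p ∈ vs →
            ∃[ ws ] ∃[ rest ] ∃[ y ] Walk G u p ws y × vs ≡ ws ++ rest × (p ≢ v → v ∈ rest)
  take-to stop (here refl) = _ , [] , _ , stop , refl , λ p≢v → contradiction refl p≢v
  take-to (step {vs = vs} e w) (here refl) = _ , vs , _ , stop , refl , λ _ → end∈ w
  take-to (step {u = u} e w) (there i) with take-to w i
  ... | ws , rest , y , w′ , refl , last = u ∷ ws , rest , _ , step e w′ , refl , last

  end-unique : ∀ {u v v′ vs x x′} → Walk G u v vs x → Walk G u v′ vs x′ → v ≡ v′
  end-unique stop       stop              = refl
  end-unique (step _ w) (step _ w′) with start∈-head w w′
    where
    start∈-head : ∀ {p q v v′ vs x x′} → Walk G p v vs x → Walk G q v′ vs x′ → p ≡ q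
    start∈-head stop       stop       = refl
    start∈-head (step _ _) (step _ _) = refl
  ... | refl = end-unique w w′

  open import Data.List.Membership.DecPropositional (_≟ᶠ_ {n}) using (_∈?_)

  simplify : ∀ {u v vs x} → Walk G u v vs x →
             ∃[ ws ] ∃[ y ] Walk G u v ws y × Unique ws × (∀ {q} → q ∈ ws → q ∈ vs)
  simplify stop = _ , _ , stop , [] ∷ [] , λ i → i
  simplify (step {u = u} e w) with simplify w
  ... | ws , y , w′ , u′ , inc with u ∈? ws
  ...   | no u∉ws = _ , _ , step e w′ , Unique-∷ u∉ws u′ , λ where
            (here refl) → here refl
            (there i)   → there (inc i)
  ...   | yes u∈ws with drop-to w′ u′ u∈ws
  ...     | ws′ , y′ , w″ , u″ , inc′ = ws′ , y′ , w″ , u″ , there ∘ inc ∘ inc′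

module TreeTheory {n σ : ℕ} (T : Tree n σ) where

  G : Graph n σ
  G = edges T

  open IsTree (isTree T)
  open import Data.List.Membership.DecPropositional (_≟ᶠ_ {n}) using (_∈?_)

  Parallel-sym : ∀ {e f : Edge n σ} → Parallel e f → Parallel f e
  Parallel-sym (inj₁ (refl , refl)) = inj₁ (refl , refl)
  Parallel-sym (inj₂ (refl , refl)) = inj₂ (refl , refl)

  parallel⇒≡ : ∀ {e f} → e ∈ G → f ∈ G → Parallel e f → e ≡ f
  parallel⇒≡ {e} {f} i j p with AllPairs-lookup noParallel i j
  ... | inj₁ e≡f = e≡f
  ... | inj₂ (inj₁ ¬p) = contradiction p ¬p
  ... | inj₂ (inj₂ ¬p) = contradiction (Parallel-sym {e} {f} p) ¬p

  label-unique : ∀ {u v a b} → G ⊢ u —[ a ]— v → G ⊢ u —[ b ]— v → a ≡ b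
  label-unique (inj₁ i) (inj₁ j) with parallel⇒≡ i j (inj₁ (refl , refl))
  ... | refl = refl
  label-unique (inj₁ i) (inj₂ j) with parallel⇒≡ i j (inj₂ (refl , refl))
  ... | refl = refl
  label-unique (inj₂ i) (inj₁ j) with parallel⇒≡ i j (inj₂ (refl , refl))
  ... | refl = refl
  label-unique (inj₂ i) (inj₂ j) with parallel⇒≡ i j (inj₁ (refl , refl))
  ... | refl = refl

  adjacent⇒≢ : ∀ {u v a} → G ⊢ u —[ a ]— v → u ≢ v
  adjacent⇒≢ (inj₁ i) u≡v = All.lookup loopless i u≡v
  adjacent⇒≢ (inj₂ i) u≡v = All.lookup loopless i (sym u≡v)

  -- Two simple paths leaving u through different neighbours and meeting again
  -- would give a simple path between these neighbours avoiding u, hence a cycle.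
  path-unique : ∀ {u v vs vs′ x x′} → Walk G u v vs x → Unique vs →
                Walk G u v vs′ x′ → Unique vs′ → vs ≡ vs′ × x ≡ x′
  path-unique stop _ stop _ = refl , refl
  path-unique stop _ (step _ w) u = contradiction (end∈ w) (Unique[x∷xs]⇒x∉xs u)
  path-unique (step _ w) u stop _ = contradiction (end∈ w) (Unique[x∷xs]⇒x∉xs u)
  path-unique {u} (step {v = y₁} e w) p@(_ ∷ u₁) (step {v = y₂} e′ w′) p′@(_ ∷ u₂) with y₁ ≟ᶠ y₂
  ... | yes refl with label-unique e e′ | path-unique w u₁ w′ u₂
  ...   | refl | refl , refl = refl , refl
  path-unique {u} (step {v = y₁} e w) p@(_ ∷ u₁) (step {v = y₂} e′ w′) p′@(_ ∷ u₂) | no y₁≢y₂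
    with join w (reverse-walk w′)
  ... | _ , w₃ , inc₃ with simplify w₃
  ...   | ws , y , w₄ , u₄ , inc₄ =
    contradiction (swap e′) (acyclic (_ , step e w₄ , Unique-∷ u∉ws u₄) (s≤s (nonempty-word w₄)))
    where
    u∉ws : u ∉ ws
    u∉ws i = [ Unique[x∷xs]⇒x∉xs p , (λ j → Unique[x∷xs]⇒x∉xs p′ (reverse⁻ j)) ]′ (inc₃ (inc₄ i))
    nonempty-word : ∀ {vs x} → Walk G y₁ y₂ vs x → 1 ≤ length x
    nonempty-word stop       = contradiction refl y₁≢y₂
    nonempty-word (step _ _) = s≤s z≤n

  abstract
    -- By `path-unique` the vertices and the word do not depend on the walk that connectedness
    -- supplies. Abstraction keeps `Vs` and `W` from unfolding to that walk.
    geodesic : ∀ u v → ∃[ ws ] ∃[ y ] Walk G u v ws y × Unique ws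
    geodesic u v with connected u v
    ... | _ , _ , w with simplify w
    ...   | ws , y , w′ , u′ , _ = ws , y , w′ , u′

  Vs : Fin n → Fin n → List (Fin n)
  Vs u v = proj₁ (geodesic u v)

  W : Fin n → Fin n → Word σ
  W u v = proj₁ (proj₂ (geodesic u v))

  walk : ∀ u v → Walk G u v (Vs u v) (W u v)
  walk u v = proj₁ (proj₂ (proj₂ (geodesic u v)))

  Vs-unique : ∀ u v → Unique (Vs u v)
  Vs-unique u v = proj₂ (proj₂ (proj₂ (geodesic u v)))

  W-path : ∀ u v → SimplePath G u v (W u v)
  W-path u v = Vs u v , walk u v , Vs-unique u v

  path⇒W : ∀ {u v x} → SimplePath G u v x → x ≡ W u v
  path⇒W {u} {v} (_ , w , un) = proj₂ (path-unique w un (walk u v) (Vs-unique u v))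

  L-W : ∀ u v → L T (W u v)
  L-W u v = u , v , W-path u v

  W-refl : ∀ v → W v v ≡ []
  W-refl v = sym (path⇒W ([ v ] , stop , [] ∷ []))

  Vs-refl : ∀ v → Vs v v ≡ [ v ]
  Vs-refl v = proj₁ (path-unique (walk v v) (Vs-unique v v) stop ([] ∷ []))

  W-reverse : ∀ u v → W v u ≡ reverse (W u v)
  W-reverse u v = sym (path⇒W (_ , reverse-walk (walk u v) , Unique-reverse (Vs-unique u v)))

  extend : ∀ {v x y a} → G ⊢ x —[ a ]— y → y ∉ Vs v x →
           Vs v y ≡ Vs v x ∷ʳ y × W v y ≡ W v x ∷ʳ a
  extend {v} {x} {y} e y∉ = path-unique (walk v y) (Vs-unique v y)
                              (snoc (walk v x) e) (Unique-∷ʳ y∉ (Vs-unique v x))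

  -- Cut the path from `v` to `x` at `y`: by uniqueness the initial part is the path from `v` to
  -- `y`, while `x` lies in the disjoint remainder.
  turn-back : ∀ {v x y a} → G ⊢ x —[ a ]— y → y ∈ Vs v x → x ∉ Vs v y
  turn-back {v} {x} {y} e y∈ x∈ with take-to (walk v x) y∈
  ... | ws , rest , z , w , vs≡ , last with Unique-++⁻ ws (subst Unique vs≡ (Vs-unique v x))
  ...   | u , disj = disj (subst (x ∈_) (proj₁ (path-unique (walk v y) (Vs-unique v y) w u)) x∈)
                          (last (adjacent⇒≢ (swap e)))

  Child : Fin n → Edge n σ → Fin n → Set
  Child r (u , v , a) y = ∃[ x ] Vs r y ≡ Vs r x ∷ʳ y × ((u ≡ x × v ≡ y) ⊎ (u ≡ y × v ≡ x))

  child : ∀ r {e} → e ∈ G → ∃[ y ] Child r e y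
  child r {u , v , a} i with v ∈? Vs r u
  ... | no v∉  = v , u , proj₁ (extend (inj₁ i) v∉) , inj₁ (refl , refl)
  ... | yes v∈ = u , v , proj₁ (extend (inj₂ i) (turn-back (inj₁ i) v∈)) , inj₂ (refl , refl)

  -- The path from `r` to `y` has a single last but one vertex, and both edges join it to `y`.
  Child⇒Parallel : ∀ {r e f y} → Child r e y → Child r f y → Parallel e f
  Child⇒Parallel {r} (x , p , d) (x′ , p′ , d′)
    with end-unique (walk r x) (subst (λ vs → Walk G r x′ vs (W r x′))
                                 (∷ʳ-injectiveˡ _ _ (trans (sym p′) p)) (walk r x′))
  Child⇒Parallel (x , p , inj₁ (refl , refl)) (_ , p′ , inj₁ (refl , refl)) | refl = inj₁ (refl , refl)
  Child⇒Parallel (x , p , inj₁ (refl , refl)) (_ , p′ , inj₂ (refl , refl)) | refl = inj₂ (refl , refl)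
  Child⇒Parallel (x , p , inj₂ (refl , refl)) (_ , p′ , inj₁ (refl , refl)) | refl = inj₂ (refl , refl)
  Child⇒Parallel (x , p , inj₂ (refl , refl)) (_ , p′ , inj₂ (refl , refl)) | refl = inj₁ (refl , refl)

  -- Assigning to each edge its endpoint farther from a fixed root is injective.
  edge-count : length G ≤ n
  edge-count = injective⇒≤ {f = λ i → proj₁ (child root (∈-lookup {xs = G} i))} injective
    where
    root : Fin n
    root = fromℕ< nonempty
    injective : ∀ {i j} → proj₁ (child root (∈-lookup i)) ≡ proj₁ (child root (∈-lookup j)) → i ≡ j
    injective {i} {j} y≡ with AllPairs-index noParallel i j
    ... | inj₁ i≡j = i≡j
    ... | inj₂ r   = contradiction
      (Child⇒Parallel {e = List.lookup G i} {List.lookup G j} (proj₂ (child root (∈-lookup i)))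
        (subst (Child root (List.lookup G j)) (sym y≡) (proj₂ (child root (∈-lookup j)))))
      ([ (λ ¬p → ¬p) , (λ ¬p → ¬p ∘ Parallel-sym {List.lookup G i} {List.lookup G j}) ]′ r)

-- Linked lists, sums and ranks of letters

-- A linked list in an array, with null pointer 0. Cells are allocated in
-- increasing order, so pointers decrease along a list.
data Chain (nx : ℕ → ℕ) : ℕ → List ℕ → Set where
  []  : Chain nx 0 []
  _∷_ : ∀ {p ps} → nx (suc p) ≤ p → Chain nx (nx (suc p)) ps → Chain nx (suc p) (suc p ∷ ps)

chain-≤ : ∀ {nx p ps q} → Chain nx p ps → q ∈ ps → q ≤ p
chain-≤ (_ ∷ _) (here refl) = ≤-refl
chain-≤ (d ∷ c) (there i)   = m≤n⇒m≤1+n (≤-trans (chain-≤ c i) d)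

chain-positive : ∀ {nx p ps q} → Chain nx p ps → q ∈ ps → 1 ≤ q
chain-positive (_ ∷ _) (here refl) = s≤s z≤n
chain-positive (_ ∷ c) (there i)   = chain-positive c i

-- Pointers decrease along the chain, so a cell beyond its head is not on it.
chain-put : ∀ {nx p ps e x} → p < e → Chain nx p ps → Chain (put e x nx) p ps
chain-put _ [] = []
chain-put {nx} {suc p} {e = e} {x} p<e (d ∷ c) with put e x nx (suc p) in eq₁ | put-other {i = e} {suc p} x nx (<⇒≢ p<e)
... | _ | refl = subst (_≤ p) (sym eq₁) d ∷
                 subst (λ z → Chain (put e x nx) z _) (sym eq₁) (chain-put (≤-<-trans d (<-trans ≤-refl p<e)) c)

chain-push : ∀ {nx p ps e} → p ≤ e → Chain nx p ps → Chain (put (suc e) p nx) (suc e) (suc e ∷ ps)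
chain-push {nx} {p} {ps} {e} p≤e c =
  subst (_≤ e) (sym same) p≤e ∷ subst (λ z → Chain (put (suc e) p nx) z ps) (sym same) (chain-put (s≤s p≤e) c)
  where same = put-same (suc e) p nx

sum⟨_⟩ : ∀ {A : Set} → List A → (A → ℕ) → ℕ
sum⟨ xs ⟩ f = sum (map f xs)

Σ-cong : ∀ {A : Set} {xs : List A} {f g : A → ℕ} → (∀ {x} → x ∈ xs → f x ≡ g x) → sum⟨ xs ⟩ f ≡ sum⟨ xs ⟩ g
Σ-cong {xs = []}     _ = refl
Σ-cong {xs = x ∷ xs} e = cong₂ _+_ (e (here refl)) (Σ-cong (e ∘ there))

Σ-++ : ∀ {A : Set} (xs ys : List A) f → sum⟨ xs ++ ys ⟩ f ≡ sum⟨ xs ⟩ f + sum⟨ ys ⟩ f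
Σ-++ []       ys f = refl
Σ-++ (x ∷ xs) ys f = trans (cong (f x +_) (Σ-++ xs ys f)) (sym (+-assoc (f x) _ _))

-- The principle behind the amortised time bounds: work charged to distinct items is at most the sum
-- over all items.
Σ-⊆ : ∀ {A : Set} {xs ys : List A} f → Unique xs → (∀ {x} → x ∈ xs → x ∈ ys) → sum⟨ xs ⟩ f ≤ sum⟨ ys ⟩ f
Σ-⊆ {xs = []} f _ _ = z≤n
Σ-⊆ {xs = x ∷ xs} {ys} f u@(_ ∷ u′) inc with ∈-∃++ (inc (here refl))
... | ys₁ , ys₂ , refl = begin
  f x + sum⟨ xs ⟩ f                     ≤⟨ +-monoʳ-≤ (f x) (Σ-⊆ f u′ inc′) ⟩
  f x + sum⟨ ys₁ ++ ys₂ ⟩ f             ≡⟨ cong (f x +_) (Σ-++ ys₁ ys₂ f) ⟩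
  f x + (sum⟨ ys₁ ⟩ f + sum⟨ ys₂ ⟩ f)     ≡⟨ x∙yz≈y∙xz (f x) (sum⟨ ys₁ ⟩ f) (sum⟨ ys₂ ⟩ f) ⟩
  sum⟨ ys₁ ⟩ f + (f x + sum⟨ ys₂ ⟩ f)     ≡⟨ Σ-++ ys₁ (x ∷ ys₂) f ⟨
  sum⟨ ys₁ ++ x ∷ ys₂ ⟩ f               ∎
  where
  open ≤-Reasoning
  inc′ : ∀ {y} → y ∈ xs → y ∈ ys₁ ++ ys₂
  inc′ i with ∈-++⁻ ys₁ (inc (there i))
  ... | inj₁ j           = ∈-++⁺ˡ j
  ... | inj₂ (here refl) = contradiction i (Unique[x∷xs]⇒x∉xs u)
  ... | inj₂ (there j)   = ∈-++⁺ʳ ys₁ j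

Σ-const : ∀ {A : Set} (xs : List A) k → sum⟨ xs ⟩ (λ _ → k) ≡ length xs * k
Σ-const []       k = refl
Σ-const (_ ∷ xs) k = cong (k +_) (Σ-const xs k)

length-⊆ : ∀ {A : Set} {xs ys : List A} → Unique xs → (∀ {x} → x ∈ xs → x ∈ ys) → length xs ≤ length ys
length-⊆ {xs = xs} {ys} u inc = begin
  length xs           ≡⟨ trans (Σ-const xs 1) (*-identityʳ _) ⟨
  sum⟨ xs ⟩ (λ _ → 1)   ≤⟨ Σ-⊆ _ u inc ⟩
  sum⟨ ys ⟩ (λ _ → 1)   ≡⟨ trans (Σ-const ys 1) (*-identityʳ _) ⟩
  length ys           ∎
  where open ≤-Reasoning

Σ-product : ∀ {A B : Set} (xs : List A) (ys : List B) (f : B → ℕ) →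
            sum⟨ cartesianProduct xs ys ⟩ (f ∘ proj₂) ≡ length xs * sum⟨ ys ⟩ f
Σ-product []       ys f = refl
Σ-product (x ∷ xs) ys f =
  trans (Σ-++ (map (x ,_) ys) (cartesianProduct xs ys) (f ∘ proj₂))
        (cong₂ _+_ (cong sum (sym (map-∘ ys))) (Σ-product xs ys f))

assign-same : ∀ {A : Set} {m} (i : Fin m) (x : A) f → assign i x f i ≡ x
assign-same i x f rewrite ≡ᶠ-refl i = refl

assign-other : ∀ {A : Set} {m} {i j : Fin m} (x : A) f → j ≢ i → assign i x f j ≡ f j
assign-other x f j≢i rewrite ≢⇒≡ᶠ j≢i = refl

-- Uniqueness prevents the increment from being counted twice. It is only an inequality because `i`
-- may be absent from `is`.
Σ-assign : ∀ {A : Set} {m} {is : List (Fin m)} i (x : A) (g : Fin m → A) (f : A → ℕ) → Unique is →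
           f x ≡ suc (f (g i)) → sum⟨ is ⟩ (f ∘ assign i x g) ≤ suc (sum⟨ is ⟩ (f ∘ g))
Σ-assign {is = []} i x g f _ _ = z≤n
Σ-assign {is = j ∷ is} i x g f u@(_ ∷ u′) e with j ≟ᶠ i
... | yes refl = ≤-reflexive (cong₂ _+_ (trans (cong f (assign-same j x g)) e)
                   (Σ-cong {xs = is} (λ k∈ → cong f (assign-other x g λ where refl → Unique[x∷xs]⇒x∉xs u k∈))))
... | no j≢i = ≤-trans (+-mono-≤ (≤-reflexive (cong f (assign-other x g j≢i))) (Σ-assign i x g f u′ e))
                       (≤-reflexive (+-suc (f (g j)) _))

-- The value is j + k if f misses a at j , … , j + k - 1.
first : (ℕ → ℕ) → ℕ → ℕ → ℕ → ℕ
first f a zero    j = j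
first f a (suc k) j with f j ≟ a
... | yes _ = j
... | no  _ = first f a k (suc j)

Hit : (ℕ → ℕ) → ℕ → ℕ → ℕ → Set
Hit f a k j = ∃[ i ] j ≤ i × i < j + k × f i ≡ a

Hit-step : ∀ {f a k j} → Hit f a (suc k) j → f j ≢ a → Hit f a k (suc j)
Hit-step {k = k} {j} (i , j≤i , i< , fi) fj = i , ≤∧≢⇒< j≤i (λ where refl → fj fi) , subst (i <_) (+-suc j k) i< , fi

Hit-zero : ∀ {f a j} → ¬ Hit f a 0 j
Hit-zero {j = j} (i , j≤i , i< , _) = <⇒≱ (subst (i <_) (+-identityʳ j) i<) j≤i

first-hit : ∀ f a k j → Hit f a k j → first f a k j < j + k × f (first f a k j) ≡ a
first-hit f a zero    j h = contradiction h Hit-zero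
first-hit f a (suc k) j h with f j ≟ a
... | yes fj = m<m+n j (s≤s z≤n) , fj
... | no ¬fj = subst (first f a k (suc j) <_) (sym (+-suc j k)) (proj₁ ih) , proj₂ ih
  where ih = first-hit f a k (suc j) (Hit-step h ¬fj)

first-found : ∀ {f a} k {j} → f j ≡ a → first f a k j ≡ j
first-found zero _ = refl
first-found {f} {a} (suc k) {j} e with f j ≟ a
... | yes _ = refl
... | no ¬e = contradiction e ¬e

first-skip : ∀ {f a} k {j} → f j ≢ a → first f a (suc k) j ≡ first f a k (suc j)
first-skip {f} {a} k {j} ¬e with f j ≟ a
... | yes e = contradiction e ¬e
... | no _  = refl

toBit-≡ : ∀ {x y} → toBit (x ≡ᵇ y) < 1 → x ≢ y
toBit-≡ {x} {y} lt1 x≡y with x ≡ᵇ y | ≡⇒≡ᵇ x y x≡y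
toBit-≡ {x} {y} (s≤s ()) _ | true | _

toBit-≢ : ∀ {x y} → ¬ toBit (x ≡ᵇ y) < 1 → x ≡ y
toBit-≢ {x} {y} ¬lt with x ≡ᵇ y in e
... | true  = ≡ᵇ⇒≡ x y (subst T (sym e) tt)
... | false = contradiction (s≤s z≤n) ¬lt

-- Layout of the input and ranks of letters

module Encoding {n σ : ℕ} where

  encodeEdges : Graph n σ → List ℕ
  encodeEdges = List.concatMap λ (u , v , a) → toℕ u ∷ toℕ v ∷ toℕ a ∷ []

  nth-edge : ∀ (G : Graph n σ) i {j} → j ≡ 3 * toℕ i → let (u , v , a) = List.lookup G i in
    nth (encodeEdges G) j ≡ toℕ u ×
    nth (encodeEdges G) (suc j) ≡ toℕ v ×
    nth (encodeEdges G) (2 + j) ≡ toℕ a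
  nth-edge (e ∷ G) zero refl = refl , refl , refl
  nth-edge (e ∷ G) (suc i) j≡ with trans j≡ (*-suc 3 (toℕ i))
  ... | refl = nth-edge G i refl

module Rank {n σ : ℕ} (T : Tree n σ) where

  open TreeTheory T
  open Encoding {n} {σ}

  m : ℕ
  m = length G

  input : ℕ → ℕ
  input = nth (encodeTree T)

  -- The two numbers `n` and `m` come first and each edge takes three cells with its label last, so
  -- the label of edge `j` is in cell 2 + 3 * j + 2.
  letterAt : ℕ → ℕ
  letterAt j = input (3 * j + 4)

  input-edge : ∀ i → let (u , v , a) = List.lookup G i in
    input (3 * toℕ i + 2) ≡ toℕ u × input (3 * toℕ i + 3) ≡ toℕ v × letterAt (toℕ i) ≡ toℕ a
  input-edge i with nth-edge G i refl
  ... | e₁ , e₂ , e₃ rewrite +-comm (3 * toℕ i) 2 | +-comm (3 * toℕ i) 3 | +-comm (3 * toℕ i) 4 = e₁ , e₂ , e₃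

  -- Letters can be as large as a polynomial in `n` and would not do as array indices in quadratic
  -- space; ranks of occurring letters are below `m`, and the letter is recovered by reading the
  -- input. A letter that does not occur has rank `m`, whence the hypotheses `Occurs`.
  rank : Fin σ → ℕ
  rank a = first letterAt (toℕ a) m 0

  Occurs : Fin σ → Set
  Occurs a = Hit letterAt (toℕ a) m 0

  edge-occurs : ∀ {u v a} → G ⊢ u —[ a ]— v → Occurs a
  edge-occurs (inj₁ i) = toℕ (Any.index i) , z≤n , toℕ<n (Any.index i) ,
    trans (proj₂ (proj₂ (input-edge (Any.index i)))) (cong (λ e → toℕ (proj₂ (proj₂ e))) (sym (lookup-index i)))
  edge-occurs (inj₂ i) = edge-occurs (inj₁ i)

  rank-< : ∀ {a} → Occurs a → rank a < m
  rank-< {a} h = proj₁ (first-hit letterAt (toℕ a) m 0 h)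

  letterAt-rank : ∀ {a} → Occurs a → letterAt (rank a) ≡ toℕ a
  letterAt-rank {a} h = proj₂ (first-hit letterAt (toℕ a) m 0 h)

  rank-injective : ∀ {a b} → Occurs a → Occurs b → rank a ≡ rank b → a ≡ b
  rank-injective h h′ e = toℕ-injective (trans (sym (letterAt-rank h)) (trans (cong letterAt e) (letterAt-rank h′)))

-- The program and its adjacency lists

fin : ∀ {k} m → Fin (m + suc k)
fin zero    = zero
fin (suc m) = suc (fin m)

R K : ℕ
R = 33
K = 15

open Lang R K public

rN rM rI rA rIdx rB rF rJ rU rV rL rQ rE rC rT rC₀ rP rX rArc rY rR rK rCl rJe rS rS′ rPP rP₂ rX₂ rV₂ rLen rMk rTt : Fin R
rN   = fin 0
rM   = fin 1
rI   = fin 2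
rA   = fin 3
rIdx = fin 4
rB   = fin 5
rF   = fin 6
rJ   = fin 7
rU   = fin 8
rV   = fin 9
rL   = fin 10
rQ   = fin 11
rE   = fin 12
rC   = fin 13
rT   = fin 14
rC₀  = fin 15
rP   = fin 16
rX   = fin 17
rArc = fin 18
rY   = fin 19
rR   = fin 20
rK   = fin 21
rCl  = fin 22
rJe  = fin 23
rS   = fin 24
rS′  = fin 25
rPP  = fin 26
rP₂  = fin 27
rX₂  = fin 28
rV₂  = fin 29
rLen = fin 30
rMk  = fin 31
rTt  = fin 32

-- Adjacency lists: head per vertex; next arc, target and rank of the letter per arc.
aHead aNext aTarget aRank : Fin K
aHead   = fin 0
aNext   = fin 1
aTarget = fin 2
aRank   = fin 3

-- Member lists of the classes: head per class; next entry, start and end vertex per entry.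
cHead eNext eFrom eTo : Fin K
cHead = fin 4
eNext = fin 5
eFrom = fin 6
eTo   = fin 7

-- The class of a pair of vertices, and the latest class created for a letter.
pClass lChild : Fin K
pClass = fin 8
lChild = fin 9

-- Rank of the last letter, parent, word length and first child per class.
cLetter cParent cLength cFirst : Fin K
cLetter = fin 10
cParent = fin 11
cLength = fin 12
cFirst  = fin 13

lMark : Fin K
lMark = fin 14

#0 #1 #2 #3 #4 : Opd
#0 = lit (fin 0)
#1 = lit (fin 1)
#2 = lit (fin 2)
#3 = lit (fin 3)
#4 = lit (fin 4)

_≔_ : Fin R → Opd → Cmd
x ≔ a = fma x #0 #0 a

inc : Fin R → Cmd
inc x = fma x #1 #1 (var x)

infix 6 _≔_

readEdge searchStep search addArc₁ addArc₂ addArcs adjacencyBody adjacency : Cmd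
readEdge =
  fma rIdx #3 (var rI) #2 ⨾ inp rU (var rIdx) ⨾
  fma rIdx #3 (var rI) #3 ⨾ inp rV (var rIdx) ⨾
  fma rIdx #3 (var rI) #4 ⨾ inp rL (var rIdx)
searchStep =
  inc rJ ⨾ fma rIdx #3 (var rJ) #4 ⨾ inp rB (var rIdx) ⨾ eqT rF (var rB) (var rL)
search =
  rJ ≔ #0 ⨾ inp rB #4 ⨾ eqT rF (var rB) (var rL) ⨾
  whileLt (var rF) #1 searchStep
addArc₁ =
  inc rA ⨾ st aTarget (var rA) (var rV) ⨾ st aRank (var rA) (var rJ) ⨾
  ld rQ aHead (var rU) ⨾ st aNext (var rA) (var rQ) ⨾ st aHead (var rU) (var rA)
addArc₂ =
  inc rA ⨾ st aTarget (var rA) (var rU) ⨾ st aRank (var rA) (var rJ) ⨾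
  ld rQ aHead (var rV) ⨾ st aNext (var rA) (var rQ) ⨾ st aHead (var rV) (var rA)
addArcs = addArc₁ ⨾ addArc₂ ⨾ inc rI
adjacencyBody = readEdge ⨾ search ⨾ addArcs
adjacency =
  inp rN #0 ⨾ inp rM #1 ⨾ rI ≔ #0 ⨾ rA ≔ #0 ⨾
  whileLt (var rI) (var rM) adjacencyBody

-- `rT` is the class being processed, `rC` the next free class number and `rC₀` the value of `rC`
-- when the processing of `rT` began; an entry of `lChild` below `rC₀` is stale. Class 0 stands for
-- unvisited pairs and class 1 for the empty word. The test of `pClass` in `arcStep` skips the
-- neighbour that leads back towards the start of the path.
addEntry initEntry newClass pushEntry visit arcStep entryStep classStep buildTrie : Cmd
addEntry =
  ld rQ cHead (var rCl) ⨾ st eNext (var rE) (var rQ) ⨾ st cHead (var rCl) (var rE) ⨾ st pClass (var rK) (var rCl)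
initEntry =
  inc rE ⨾ st eFrom (var rE) (var rX) ⨾ st eTo (var rE) (var rX) ⨾
  fma rK (var rN) (var rX) (var rX) ⨾ addEntry ⨾ inc rX
newClass =
  st lChild (var rR) (var rC) ⨾ st cLetter (var rC) (var rR) ⨾ st cParent (var rC) (var rT) ⨾
  ld rLen cLength (var rT) ⨾ inc rLen ⨾ st cLength (var rC) (var rLen) ⨾
  st cHead (var rC) #0 ⨾ inc rC
pushEntry =
  ld rCl lChild (var rR) ⨾ inc rE ⨾ st eFrom (var rE) (var rV) ⨾ st eTo (var rE) (var rY) ⨾ addEntry
visit =
  ld rCl lChild (var rR) ⨾ ifLt (var rCl) (var rC₀) (call newClass) skip ⨾ call pushEntry
arcStep =
  ld rY aTarget (var rArc) ⨾ ld rR aRank (var rArc) ⨾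
  fma rK (var rN) (var rV) (var rY) ⨾ ld rQ pClass (var rK) ⨾
  ifLt #0 (var rQ) skip (call visit) ⨾ ld rArc aNext (var rArc)
entryStep =
  ld rV eFrom (var rP) ⨾ ld rX eTo (var rP) ⨾ ld rArc aHead (var rX) ⨾
  whileLt #0 (var rArc) arcStep ⨾ ld rP eNext (var rP)
classStep =
  rC₀ ≔ var rC ⨾ ld rP cHead (var rT) ⨾
  whileLt #0 (var rP) entryStep ⨾ inc rT ⨾ st cFirst (var rT) (var rC)
buildTrie =
  rE ≔ #0 ⨾ rX ≔ #0 ⨾ rCl ≔ #1 ⨾ st cHead #1 #0 ⨾
  whileLt (var rX) (var rN) initEntry ⨾
  rC ≔ #2 ⨾ rT ≔ #1 ⨾ st cFirst #1 #2 ⨾ st cLength #1 #0 ⨾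
  whileLt (var rT) (var rC) classStep

-- `rS` runs through the classes of the words a u, and a mark smaller than `rS` stems from an
-- earlier class. `rS′` is the class of the reverse of a u, `rPP` its parent and `rTt` the class of
-- u. The endpoints `rX₂` and `rV₂` are emitted in exchanged order because the stored path spells
-- the reverse of u.
markStep markPhase findReverse findSuffix locate emitWord emitStep emitPhase outStep report-all : Cmd
markStep = ld rR cLetter (var rJ) ⨾ st lMark (var rR) (var rS) ⨾ inc rJ
markPhase =
  ld rJ cFirst (var rS) ⨾ fma rIdx #1 #1 (var rS) ⨾ ld rJe cFirst (var rIdx) ⨾
  whileLt (var rJ) (var rJe) markStep
findReverse =
  ld rP cHead (var rS) ⨾ ld rV eFrom (var rP) ⨾ ld rX eTo (var rP) ⨾
  fma rK (var rN) (var rX) (var rV) ⨾ ld rS′ pClass (var rK)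
findSuffix =
  ld rP₂ cHead (var rPP) ⨾ ld rV₂ eFrom (var rP₂) ⨾ ld rX₂ eTo (var rP₂) ⨾
  fma rK (var rN) (var rX₂) (var rV₂) ⨾ ld rTt pClass (var rK)
locate =
  call findReverse ⨾ ld rPP cParent (var rS′) ⨾ call findSuffix ⨾
  ld rB cLetter (var rS′) ⨾ fma rIdx #3 (var rB) #4 ⨾ inp rL (var rIdx) ⨾ ld rLen cLength (var rPP)
emitWord =
  fma rIdx #3 (var rR) #4 ⨾ inp rQ (var rIdx) ⨾
  out (var rL) ⨾ out (var rX₂) ⨾ out (var rV₂) ⨾ out (var rLen) ⨾ out (var rQ)
emitStep =
  ld rR cLetter (var rJ) ⨾ ld rMk lMark (var rR) ⨾
  ifLt (var rMk) (var rS) emitWord skip ⨾ inc rJ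
emitPhase =
  ld rJ cFirst (var rTt) ⨾ fma rIdx #1 #1 (var rTt) ⨾ ld rJe cFirst (var rIdx) ⨾
  whileLt (var rJ) (var rJe) emitStep
outStep = call markPhase ⨾ call locate ⨾ call emitPhase ⨾ inc rS
report-all = rS ≔ #2 ⨾ whileLt (var rS) (var rC) outStep

-- Correctness of the adjacency lists

module Adjacency {n σ : ℕ} (T : Tree n σ) where

  open TreeTheory T public
  open Rank T public
  open IsTree (isTree T) public using (nonempty; connected)

  -- Since `m ≤ n`, the 2 + 3 * m cells of the input fit into 5 * n. The bound `N` leaves room for
  -- the two kinds of numbers that occur: input addresses, at most 7 * n, and numbers of pairs,
  -- entries and classes, at most 4 + n * n.
  I N : ℕ
  I = 5 * n
  N = 8 * (n * n)

  open Sem input I N public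

  n≤nn : n ≤ n * n
  n≤nn = m≤m*n n n {{>-nonZero nonempty}}

  small : ∀ {z} → z ≤ 7 * n → z < N
  small {z} z≤ = begin-strict
    z        ≤⟨ z≤ ⟩
    7 * n    <⟨ *-monoˡ-< n {{>-nonZero nonempty}} {7} {8} ≤-refl ⟩
    8 * n    ≤⟨ *-monoʳ-≤ 8 n≤nn ⟩
    N        ∎
    where open ≤-Reasoning

  const≤ : ∀ k → k ≤ k * n
  const≤ k = m≤m*n k n {{>-nonZero nonempty}}

  affine : ∀ {z} a b → a + b ≤ 7 → z ≤ n → a * z + b < N
  affine {z} a b a+b≤7 z≤ = small (begin
    a * z + b       ≤⟨ +-mono-≤ (*-monoʳ-≤ a z≤) (const≤ b) ⟩
    a * n + b * n   ≡⟨ *-distribʳ-+ n a b ⟨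
    (a + b) * n     ≤⟨ *-monoˡ-≤ n a+b≤7 ⟩
    7 * n           ∎)
    where open ≤-Reasoning

  cell< : ∀ {i} b → b ≤ 4 → i < m → 3 * i + b < I
  cell< {i} b b≤4 i<m = begin-strict
    3 * i + b           ≤⟨ +-monoʳ-≤ (3 * i) b≤4 ⟩
    3 * i + 4           ≡⟨ trans (+-comm (3 * i) 4) (cong suc (sym (*-suc 3 i))) ⟩
    1 + 3 * suc i       ≤⟨ +-mono-≤ (const≤ 1) (*-monoʳ-≤ 3 (≤-trans i<m edge-count)) ⟩
    1 * n + 3 * n       ≡⟨ *-distribʳ-+ n 1 3 ⟨
    4 * n               <⟨ *-monoˡ-< n {{>-nonZero nonempty}} {4} {5} ≤-refl ⟩
    I                   ∎
    where open ≤-Reasoning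

  -- The lists `adj` exist only in the proof. Completeness is no field, because during the
  -- construction it holds only for the edges already read; it is expressed by `Reach`.
  record Adj (hd nx tg rk : ℕ → ℕ) (A : ℕ) (adj : Fin n → List ℕ) : Set where
    field
      chain : ∀ x → Chain nx (hd (toℕ x)) (adj x)
      bound : ∀ (x : Fin n) → hd (toℕ x) ≤ A
      sound : ∀ x {e} → e ∈ adj x → ∃[ y ] ∃[ a ] G ⊢ x —[ a ]— y × tg e ≡ toℕ y × rk e ≡ rank a
      total : sum⟨ allFin n ⟩ (λ x → length (adj x)) ≤ A

  open Adj public

  Reach : (ℕ → ℕ) → (Fin n → List ℕ) → Fin n → Fin n → Set
  Reach tg adj x y = ∃[ e ] e ∈ adj x × tg e ≡ toℕ y

  put-vertex-other : ∀ {x y : Fin n} {c : ℕ} {f} → y ≢ x → put (toℕ x) c f (toℕ y) ≡ f (toℕ y)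
  put-vertex-other y≢x = put-other _ _ (y≢x ∘ toℕ-injective)

  push : ℕ → Fin n → (Fin n → List ℕ) → Fin n → List ℕ
  push e x adj = assign x (e ∷ adj x) adj

  push-∈ : ∀ {e x adj} → e ∈ push e x adj x
  push-∈ {e} {x} {adj} = subst (e ∈_) (sym (assign-same x (e ∷ adj x) adj)) (here refl)

  ∈-push : ∀ {e e′ x z adj} → e′ ∈ adj z → e′ ∈ push e x adj z
  ∈-push {x = x} {z} i with z ≟ᶠ x
  ... | yes refl rewrite ≡ᶠ-refl x = there i
  ... | no z≢x rewrite ≢⇒≡ᶠ z≢x = i

  arc≤ : ∀ {hd nx tg rk A adj x e} → Adj hd nx tg rk A adj → e ∈ adj x → e ≤ A
  arc≤ {x = x} d i = ≤-trans (chain-≤ (chain d x) i) (bound d x)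

  Adj-push : ∀ {hd nx tg rk A adj x y a u v r} → Adj hd nx tg rk A adj →
             G ⊢ x —[ a ]— y → u ≡ toℕ x → v ≡ toℕ y → r ≡ rank a →
             Adj (put u (suc A) hd) (put (suc A) (hd u) nx) (put (suc A) v tg) (put (suc A) r rk)
                 (suc A) (push (suc A) x adj)
  Adj-push {hd} {nx} {tg} {rk} {A} {adj} {x} {y} {a} d xy refl refl refl = record
    { chain = chain′ ; bound = bound′ ; sound = sound′ ; total = total′ }
    where
    chain′ : ∀ z → Chain (put (suc A) (hd (toℕ x)) nx) (put (toℕ x) (suc A) hd (toℕ z)) (push (suc A) x adj z)
    chain′ z with z ≟ᶠ x
    ... | yes refl rewrite ≡ᶠ-refl x | put-same (toℕ x) (suc A) hd = chain-push (bound d x) (chain d x)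
    ... | no z≢x rewrite ≢⇒≡ᶠ z≢x | put-vertex-other {x} {z} {suc A} {hd} z≢x = chain-put (s≤s (bound d z)) (chain d z)
    bound′ : ∀ (z : Fin n) → put (toℕ x) (suc A) hd (toℕ z) ≤ suc A
    bound′ z with z ≟ᶠ x
    ... | yes refl rewrite put-same (toℕ x) (suc A) hd = ≤-refl
    ... | no z≢x rewrite put-vertex-other {x} {z} {suc A} {hd} z≢x = m≤n⇒m≤1+n (bound d z)
    old : ∀ z {e} → e ∈ adj z → ∃[ p ] ∃[ b ] G ⊢ z —[ b ]— p ×
          put (suc A) (toℕ y) tg e ≡ toℕ p × put (suc A) (rank a) rk e ≡ rank b
    old z {e} i with sound d z i
    ... | p , b , zp , te , re = p , b , zp , trans (put-other _ tg e≢) te , trans (put-other _ rk e≢) re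
      where
      e≢ : e ≢ suc A
      e≢ = <⇒≢ (s≤s (arc≤ d i))
    sound′ : ∀ z {e} → e ∈ push (suc A) x adj z → ∃[ p ] ∃[ b ] G ⊢ z —[ b ]— p ×
             put (suc A) (toℕ y) tg e ≡ toℕ p × put (suc A) (rank a) rk e ≡ rank b
    sound′ z i with z ≟ᶠ x
    sound′ z i | no z≢x rewrite ≢⇒≡ᶠ z≢x = old z i
    sound′ z i | yes refl rewrite ≡ᶠ-refl x with i
    ... | here refl = y , a , xy , put-same (suc A) _ tg , put-same (suc A) _ rk
    ... | there j   = old x j
    total′ : sum⟨ allFin n ⟩ (λ z → length (push (suc A) x adj z)) ≤ suc A
    total′ = ≤-trans (Σ-assign x (suc A ∷ adj x) adj length (allFin⁺ n) refl) (s≤s (total d))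

  Reach-push : ∀ {hd nx tg rk A adj x p q v} → Adj hd nx tg rk A adj → Reach tg adj p q →
               Reach (put (suc A) v tg) (push (suc A) x adj) p q
  Reach-push {tg = tg} {adj = adj} {x} {p} d (e , i , te) = e , ∈-push {x = x} {p} {adj} i , trans (put-other _ tg (<⇒≢ (s≤s (arc≤ d i)))) te

  Reach-new : ∀ {tg A adj x y v} → v ≡ toℕ y → Reach (put (suc A) v tg) (push (suc A) x adj) x y
  Reach-new {tg} {A} {adj} {x} refl = suc A , push-∈ {x = x} {adj} , put-same (suc A) _ tg

  record Clear (s : St) : Set where
    field
      pClass-0 : ∀ k → arrs s pClass k ≡ 0
      lChild-0 : ∀ k → arrs s lChild k ≡ 0
      lMark-0  : ∀ k → arrs s lMark k ≡ 0
      out-[]   : outᴴ s ≡ []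

  open Clear public

  -- Each edge costs one tick and at most `m` more for ranking its letter by linear search, which is
  -- affordable because `m * suc m` is still quadratic.
  record InvA (i : ℕ) (s : St) : Set where
    field
      n≡      : regsᴴ s rN ≡ n
      m≡      : regsᴴ s rM ≡ m
      i≡      : regsᴴ s rI ≡ i
      A≡      : regsᴴ s rA ≡ 2 * i
      adj     : Fin n → List ℕ
      isAdj   : Adj (arrs s aHead) (arrs s aNext) (arrs s aTarget) (arrs s aRank) (regsᴴ s rA) adj
      reach   : ∀ j → toℕ j < i → let (u , v , _) = List.lookup G j in
                Reach (arrs s aTarget) adj u v × Reach (arrs s aTarget) adj v u
      clear   : Clear s
      ticks≤  : ticks s ≤ i * suc m

  JA : ℕ → St → Set
  JA k s = ∃[ i ] i + k ≡ m × InvA i s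

  -- The state s once an edge (x , y , a) has been read and its letter ranked.
  record Ready (i : ℕ) (s s₀ : St) (x y : Fin n) (a : Fin σ) : Set where
    field
      n≡    : regsᴴ s rN ≡ n
      m≡    : regsᴴ s rM ≡ m
      i≡    : regsᴴ s rI ≡ i
      A≡    : regsᴴ s rA ≡ regsᴴ s₀ rA
      u≡    : regsᴴ s rU ≡ toℕ x
      v≡    : regsᴴ s rV ≡ toℕ y
      a≡    : regsᴴ s rL ≡ toℕ a
      arrs≡ : arrs s ≡ arrs s₀
      outᴴ≡ : outᴴ s ≡ outᴴ s₀

  -- The letter at position `rJ` has already been compared, with the result in `rF`. Hence the
  -- window still has `suc k` positions when at most `k` iterations remain.
  record Search (i τ : ℕ) (s₀ : St) (x y : Fin n) (a : Fin σ) (k : ℕ) (s : St) : Set where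
    field
      ready  : Ready i s s₀ x y a
      f≡     : regsᴴ s rF ≡ toBit (letterAt (regsᴴ s rJ) ≡ᵇ toℕ a)
      hit    : Hit letterAt (toℕ a) (suc k) (regsᴴ s rJ)
      rank≡  : first letterAt (toℕ a) (suc k) (regsᴴ s rJ) ≡ rank a
      total≡ : suc k + regsᴴ s rJ ≡ m
      ticks≤ : ticks s + k ≤ τ + m

  addArcs-correct : ∀ {i k s s₀ x y a} (i<m : i < m) → suc i + k ≡ m →
    (List.lookup G (fromℕ< i<m) ≡ (x , y , a)) → InvA i s₀ → Ready i s s₀ x y a →
    regsᴴ s rJ ≡ rank a → ticks s ≤ suc i * suc m → wp addArcs (JA k) s
  addArcs-correct {i} {k} {s} {s₀} {x} {y} {a} i<m i+k lk inv rdy r≡ t≤ with Ready.arrs≡ rdy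
  ... | refl =
    sA<N , sA<N , sA<N , u<N , sA<N , u<N ,
    ssA<N , ssA<N , ssA<N , v<N , ssA<N , v<N , small si≤ ,
    suc i , i+k , record
      { n≡ = Ready.n≡ rdy
      ; m≡ = Ready.m≡ rdy
      ; i≡ = cong suc (Ready.i≡ rdy)
      ; A≡ = trans (cong (λ z → suc (suc z)) A≡2i) (sym (*-suc 2 i))
      ; adj = adj₂
      ; isAdj = isAdj₂
      ; reach = reach′
      ; clear = record { pClass-0 = pClass-0 (InvA.clear inv) ; lChild-0 = lChild-0 (InvA.clear inv)
                       ; lMark-0 = lMark-0 (InvA.clear inv)
                       ; out-[] = trans (Ready.outᴴ≡ rdy) (out-[] (InvA.clear inv)) }
      ; ticks≤ = t≤
      }
    where
    A = regsᴴ s rA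
    A≡2i : A ≡ 2 * i
    A≡2i = trans (Ready.A≡ rdy) (InvA.A≡ inv)
    i<n : suc i ≤ n
    i<n = ≤-trans i<m edge-count
    ssA≤ : suc (suc A) ≤ 7 * n
    ssA≤ = ≤-trans (≤-reflexive (trans (cong (λ z → suc (suc z)) A≡2i) (sym (*-suc 2 i))))
                   (*-mono-≤ {2} {7} (s≤s (s≤s z≤n)) i<n)
    ssA<N : suc (suc A) < N
    ssA<N = small ssA≤
    sA<N : suc A < N
    sA<N = small (≤-trans (n≤1+n _) ssA≤)
    vertex<N : ∀ {z} (p : Fin n) → z ≡ toℕ p → z < N
    vertex<N p refl = small (≤-trans (<⇒≤ (toℕ<n p)) (m≤n*m n 7))
    u<N = vertex<N x (Ready.u≡ rdy)
    v<N = vertex<N y (Ready.v≡ rdy)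
    si≤ : suc (regsᴴ s rI) ≤ 7 * n
    si≤ = ≤-trans (≤-reflexive (cong suc (Ready.i≡ rdy))) (≤-trans i<n (m≤n*m n 7))
    edge : (x , y , a) ∈ G
    edge = subst (_∈ G) lk (∈-lookup (fromℕ< i<m))
    adj₀ = InvA.adj inv
    adj₁ = push (suc A) x adj₀
    adj₂ = push (suc (suc A)) y adj₁
    isAdj₀ : Adj (arrs s aHead) (arrs s aNext) (arrs s aTarget) (arrs s aRank) A adj₀
    isAdj₀ = subst (λ z → Adj _ _ _ _ z adj₀) (sym (Ready.A≡ rdy)) (InvA.isAdj inv)
    isAdj₁ : Adj _ _ _ _ (suc A) adj₁
    isAdj₁ = Adj-push isAdj₀ (inj₁ edge) (Ready.u≡ rdy) (Ready.v≡ rdy) r≡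
    isAdj₂ : Adj _ _ _ _ (suc (suc A)) adj₂
    isAdj₂ = Adj-push isAdj₁ (inj₂ edge) (Ready.v≡ rdy) (Ready.u≡ rdy) r≡
    keep : ∀ {p q} → Reach (arrs s aTarget) adj₀ p q → Reach _ adj₂ p q
    keep {p} {q} r = Reach-push {p = p} {q} isAdj₁ (Reach-push {p = p} {q} isAdj₀ r)
    reach′ : ∀ j → toℕ j < suc i → let (u , v , _) = List.lookup G j in Reach _ adj₂ u v × Reach _ adj₂ v u
    reach′ j j≤i with toℕ j ≟ i
    ... | no j≢i with InvA.reach inv j (≤∧≢⇒< (≤-pred j≤i) j≢i)
    ...   | r₁ , r₂ = keep r₁ , keep r₂
    reach′ j j≤i | yes j≡i with toℕ-injective (trans j≡i (sym (toℕ-fromℕ< i<m)))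
    ... | refl = subst (λ (u , v , _) → Reach _ adj₂ u v × Reach _ adj₂ v u) (sym lk)
                   (Reach-push {p = x} {y} isAdj₁ (Reach-new {adj = adj₀} {x} {y} (Ready.v≡ rdy)) , Reach-new {adj = adj₁} {y} {x} (Ready.u≡ rdy))

  m≤n′ : ∀ {j} → j < m → j ≤ n
  m≤n′ j<m = ≤-trans (<⇒≤ j<m) edge-count

  search-loop : ∀ {i τ s₀ x y a} k s → Search i τ s₀ x y a k s →
    WP (whileLt (var rF) #1 searchStep)
       (λ s′ → Ready i s′ s₀ x y a × regsᴴ s′ rJ ≡ rank a × ticks s′ ≤ τ + m) s
  search-loop {i} {τ} {s₀} {x} {y} {a} k s js =
    WP-mono finish (while-rule (Search i τ s₀ x y a) stepJ stopJ k s js)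
    where
    open Search
    finish : ∀ s′ → _ → _
    finish s′ (k′ , j′ , ¬lt) = ready j′ ,
      trans (sym (first-found {letterAt} {toℕ a} (suc k′) (toBit-≢ (subst (λ z → ¬ z < 1) (f≡ j′) ¬lt)))) (rank≡ j′) ,
      ≤-trans (m≤m+n _ k′) (ticks≤ j′)
    stopJ : ∀ s′ → Search i τ s₀ x y a 0 s′ → ¬ regsᴴ s′ rF < 1
    stopJ s′ j′ lt1 = Hit-zero (Hit-step (hit j′) (toBit-≡ (subst (_< 1) (f≡ j′) lt1)))
    stepJ : ∀ k s′ → Search i τ s₀ x y a (suc k) s′ → regsᴴ s′ rF < 1 → wp searchStep (Search i τ s₀ x y a k) (tick s′)
    stepJ k s′ j′ lt1 =
      small (≤-trans (m≤n′ sj<m) (m≤n*m n 7)) ,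
      affine 3 4 ≤-refl (m≤n′ sj<m) ,
      cell< 4 ≤-refl sj<m ,
      record
        { ready = record { n≡ = Ready.n≡ r ; m≡ = Ready.m≡ r ; i≡ = Ready.i≡ r ; A≡ = Ready.A≡ r
                         ; u≡ = Ready.u≡ r ; v≡ = Ready.v≡ r ; a≡ = Ready.a≡ r
                         ; arrs≡ = Ready.arrs≡ r ; outᴴ≡ = Ready.outᴴ≡ r }
        ; f≡ = cong (λ z → toBit (letterAt (suc (regsᴴ s′ rJ)) ≡ᵇ z)) (Ready.a≡ r)
        ; hit = Hit-step (hit j′) miss
        ; rank≡ = trans (sym (first-skip {letterAt} {toℕ a} (suc k) {regsᴴ s′ rJ} miss)) (rank≡ j′)
        ; total≡ = trans (+-suc (suc k) _) (total≡ j′)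
        ; ticks≤ = ≤-trans (≤-reflexive (sym (+-suc (ticks s′) k))) (ticks≤ j′)
        }
      where
      r = ready j′
      miss = toBit-≡ (subst (_< 1) (f≡ j′) lt1)
      sj<m : suc (regsᴴ s′ rJ) < m
      sj<m = subst (suc (suc (regsᴴ s′ rJ)) ≤_) (total≡ j′) (s≤s (s≤s (m≤n+m _ k)))

  adjacencyBody-correct : ∀ k s → JA (suc k) s → regsᴴ s rI < regsᴴ s rM → wp adjacencyBody (JA k) (tick s)
  adjacencyBody-correct k s (i , i+k , inv) _ =
    rng 2 (s≤s (s≤s z≤n)) , cl 2 (s≤s (s≤s z≤n)) ,
    rng 3 (s≤s (s≤s (s≤s z≤n))) , cl 3 (s≤s (s≤s (s≤s z≤n))) ,
    rng 4 ≤-refl , cl 4 ≤-refl ,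
    small z≤n , cell< {0} 4 ≤-refl (≤-trans (s≤s z≤n) i<m) ,
    WP-mono (λ s′ (rdy , r≡ , t≤) → addArcs-correct i<m i+k′ refl inv rdy r≡
        (≤-trans t≤ (≤-trans (≤-reflexive (+-comm (suc (ticks s)) m)) (≤-trans (≤-reflexive (+-suc m _)) (+-monoʳ-≤ (suc m) (InvA.ticks≤ inv))))))
      -- The first comparison precedes the loop, so `m ∸ 1` positions remain; `m` is positive
      -- because edge `i` exists.
      (search-loop (m ∸ 1) _ record
        { ready = record { n≡ = InvA.n≡ inv ; m≡ = InvA.m≡ inv ; i≡ = InvA.i≡ inv ; A≡ = refl
                         ; u≡ = trans (at 2) (proj₁ ie)
                         ; v≡ = trans (at 3) (proj₁ (proj₂ ie)) ; a≡ = a≡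
                         ; arrs≡ = refl ; outᴴ≡ = refl }
        ; f≡ = cong (λ z → toBit (letterAt 0 ≡ᵇ z)) a≡
        ; hit = subst (λ z → Hit letterAt (toℕ a) z 0) (sym m-1) (edge-occurs (inj₁ (∈-lookup {xs = G} (fromℕ< i<m))))
        ; rank≡ = cong (λ z → first letterAt (toℕ a) z 0) m-1
        ; total≡ = trans (+-identityʳ _) m-1
        ; ticks≤ = +-monoʳ-≤ (suc (ticks s)) (m∸n≤m m 1)
        })
    where
    i+k′ : suc i + k ≡ m
    i+k′ = trans (sym (+-suc i k)) i+k
    i<m : i < m
    i<m = subst (i <_) i+k′ (s≤s (m≤m+n i k))
    m-1 : suc (m ∸ 1) ≡ m
    m-1 = m+[n∸m]≡n {1} (≤-trans (s≤s z≤n) i<m)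
    at : ∀ b → input (3 * regsᴴ s rI + b) ≡ input (3 * toℕ (fromℕ< i<m) + b)
    at b = cong (λ z → input (3 * z + b)) (trans (InvA.i≡ inv) (sym (toℕ-fromℕ< i<m)))
    a = proj₂ (proj₂ (List.lookup G (fromℕ< i<m)))
    ie = input-edge (fromℕ< i<m)
    a≡ = trans (at 4) (proj₂ (proj₂ ie))
    rng : ∀ b → b ≤ 4 → 3 * regsᴴ s rI + b < N
    rng b b≤4 = affine 3 b (+-monoʳ-≤ 3 b≤4) (subst (_≤ n) (sym (InvA.i≡ inv)) (m≤n′ i<m))
    cl : ∀ b → b ≤ 4 → 3 * regsᴴ s rI + b < I
    cl b b≤4 = cell< b b≤4 (subst (_< m) (sym (InvA.i≡ inv)) i<m)

  start : St
  start = ⟪ (λ _ → 0) , (λ _ _ → 0) , [] , 0 ⟫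

  0<I : ∀ {z} → z ≤ 4 → z < I
  0<I z≤ = <-≤-trans (s≤s z≤) (const≤ 5)

  adjacency-correct : WP adjacency (InvA m) start
  adjacency-correct = run adjacency
    (0<I z≤n , 0<I (s≤s z≤n) , small z≤n , small z≤n ,
     WP-mono finish (while-rule JA adjacencyBody-correct stopJ m _
       (0 , refl , record
         { n≡ = refl ; m≡ = refl ; i≡ = refl ; A≡ = refl ; adj = λ _ → []
         ; isAdj = record { chain = λ _ → [] ; bound = λ _ → z≤n ; sound = λ _ ()
                          ; total = ≤-reflexive (trans (Σ-const (allFin n) 0) (*-zeroʳ (length (allFin n)))) }
         ; reach = λ _ ()
         ; clear = record { pClass-0 = λ _ → refl ; lChild-0 = λ _ → refl ; lMark-0 = λ _ → refl ; out-[] = refl }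
         ; ticks≤ = z≤n })))
    where
    stopJ : ∀ s → JA 0 s → ¬ regsᴴ s rI < regsᴴ s rM
    stopJ s (i , i+0 , inv) i<m = <-irrefl (trans (InvA.i≡ inv) (trans (trans (sym (+-identityʳ i)) i+0) (sym (InvA.m≡ inv)))) i<m
    finish : ∀ s → _ → InvA m s
    finish s (k , (i , i+k , inv) , i≮m) = subst (λ z → InvA z s) i≡m inv
      where
      i≡m : i ≡ m
      i≡m = ≤-antisym (m+n≤o⇒m≤o i (≤-reflexive i+k))
              (subst (m ≤_) (InvA.i≡ inv) (subst (_≤ regsᴴ s rI) (InvA.m≡ inv) (≮⇒≥ i≮m)))

-- Building the trie

module Naming {n σ : ℕ} (T : Tree n σ) where

  open Adjacency T public

  pr : Fin n → Fin n → ℕ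
  pr v x = n * toℕ v + toℕ x

  pr-injective : ∀ {v x v′ x′} → pr v x ≡ pr v′ x′ → v ≡ v′ × x ≡ x′
  pr-injective {v} {x} {v′} {x′} e with pair-injective n {toℕ v} {toℕ v′} (toℕ<n x) (toℕ<n x′) e
  ... | e₁ , e₂ = toℕ-injective e₁ , toℕ-injective e₂

  pr< : ∀ v x → pr v x < n * n
  pr< v x = pair-bound {k = n} (toℕ<n v) (toℕ<n x)

  record At (from to : ℕ → ℕ) (q : ℕ) (v x : Fin n) : Set where
    constructor at
    field
      from≡ : from q ≡ toℕ v
      to≡   : to q ≡ toℕ x

  open At public

  At-functional : ∀ {from to q v x v′ x′} → At from to q v x → At from to q v′ x′ → v ≡ v′ × x ≡ x′
  At-functional (at e₁ e₂) (at e₁′ e₂′) = toℕ-injective (trans (sym e₁) e₁′) , toℕ-injective (trans (sym e₂) e₂′)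

  record Members (from to next cl : ℕ → ℕ) (c h : ℕ) : Set where
    constructor members
    field
      list     : List ℕ
      chained  : Chain next h list
      sound    : ∀ {q} → q ∈ list → ∃[ v ] ∃[ x ] At from to q v x × cl (pr v x) ≡ c
      complete : ∀ v x → cl (pr v x) ≡ c → ∃[ q ] q ∈ list × At from to q v x

  -- Entries 1 … E are pairs of vertices; pairs with the same word W v x have
  -- the same class, which is 0 for the pairs not yet visited.
  record Entries (from to next head cl : ℕ → ℕ) (E C : ℕ) (wd : ℕ → Word σ) : Set where
    field
      entry       : ∀ {q} → 1 ≤ q → q ≤ E → ∃[ v ] ∃[ x ] At from to q v x × cl (pr v x) ≢ 0
      entry-inj   : ∀ {q q′ v x} → 1 ≤ q → q ≤ E → 1 ≤ q′ → q′ ≤ E → At from to q v x → At from to q′ v x → q ≡ q′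
      member      : ∀ {c} → 1 ≤ c → c < C → Members from to next cl c (head c)
      head≤       : ∀ {c} → 1 ≤ c → c < C → head c ≤ E
      class<      : ∀ {v x} → cl (pr v x) ≢ 0 → cl (pr v x) < C
      class-word  : ∀ {v x} → cl (pr v x) ≢ 0 → wd (cl (pr v x)) ≡ W v x
      prefix      : ∀ {v x z} → cl (pr v x) ≢ 0 → z ∈ Vs v x → cl (pr v z) ≢ 0

  -- Class c has the word wd c; the classes are numbered from 1. Those with
  -- parent c < t form the interval [ first c , first (suc c) ), those with
  -- parent t are c₀ , … , C - 1.
  record Classes (letter parent len first child : ℕ → ℕ) (C t c₀ : ℕ) (wd : ℕ → Word σ) : Set where
    field
      1≤t        : 1 ≤ t
      2≤c₀       : 2 ≤ c₀
      c₀≤C       : c₀ ≤ C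
      wd-1       : wd 1 ≡ []
      wd-inj     : ∀ {c c′} → 1 ≤ c → c < C → 1 ≤ c′ → c′ < C → wd c ≡ wd c′ → c ≡ c′
      parent-ok  : ∀ {c} → 2 ≤ c → c < C → 1 ≤ parent c × parent c < C ×
                   (∃[ a ] Occurs a × wd c ≡ wd (parent c) ∷ʳ a × letter c ≡ rank a)
      len≡       : ∀ {c} → 1 ≤ c → c < C → len c ≡ length (wd c)
      first-t    : first t ≡ c₀
      first-mono : ∀ {c} → 1 ≤ c → c < t → 2 ≤ first c × first c ≤ first (suc c) × first (suc c) ≤ c₀
      current    : ∀ {c} → c₀ ≤ c → c < C → parent c ≡ t
      older      : ∀ {c} → 2 ≤ c → c < c₀ → parent c < t × first (parent c) ≤ c × c < first (suc (parent c))
      interval   : ∀ {c j} → 1 ≤ c → c < t → first c ≤ j → j < first (suc c) → parent j ≡ c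
      child<     : ∀ r → child r < C
      child-back : ∀ {r} → c₀ ≤ child r → letter (child r) ≡ r
      child-let  : ∀ {c} → c₀ ≤ c → c < C → child (letter c) ≡ c

  ∷ʳ≢[] : ∀ {A : Set} (xs : List A) {x} → xs ∷ʳ x ≢ []
  ∷ʳ≢[] []      ()
  ∷ʳ≢[] (_ ∷ _) ()

  module _ {letter parent len first child : ℕ → ℕ} {C t c₀ : ℕ} {wd : ℕ → Word σ}
           (d : Classes letter parent len first child C t c₀ wd) where

    open Classes d

    child-word : ∀ {a} → Occurs a → c₀ ≤ child (rank a) → wd (child (rank a)) ≡ wd t ∷ʳ a
    child-word {a} occ c₀≤ with parent-ok (≤-trans 2≤c₀ c₀≤) (child< (rank a))
    ... | _ , _ , b , occ′ , w≡ , l≡ =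
      trans w≡ (cong₂ (λ p b → wd p ∷ʳ b) (current c₀≤ (child< _))
        (rank-injective occ′ occ (trans (sym l≡) (child-back c₀≤))))

    -- A class with the word `wd t ∷ʳ a` would have parent `t` by injectivity of `wd`. Classes
    -- before `c₀` have a smaller parent, and those from `c₀` on are registered in `child`, so a
    -- stale entry certifies that the word is new.
    fresh-word : ∀ {a} → Occurs a → t < C → ¬ c₀ ≤ child (rank a) → ∀ {c} → 1 ≤ c → c < C → wd c ≢ wd t ∷ʳ a
    fresh-word {a} occ t<C c₀≰ {c} 1≤c c<C w≡ with c ≟ 1
    ... | yes refl = ∷ʳ≢[] (wd t) (trans (sym w≡) wd-1)
    ... | no c≢1 with parent-ok (≤∧≢⇒< 1≤c (c≢1 ∘ sym)) c<C
    ...   | 1≤p , p<C , b , occ′ , w≡′ , l≡ with ∷ʳ-injective _ _ (trans (sym w≡′) w≡)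
    ...     | wp≡ , refl with wd-inj 1≤p p<C 1≤t t<C wp≡
    ...       | p≡t with c <? c₀
    ...         | yes c<c₀ = <-irrefl p≡t (proj₁ (older (≤∧≢⇒< 1≤c (c≢1 ∘ sym)) c<c₀))
    ...         | no c≮c₀ = c₀≰ (subst (c₀ ≤_) (sym (trans (cong child (sym l≡)) (child-let (≮⇒≥ c≮c₀) c<C))) (≮⇒≥ c≮c₀))

    new-class : ∀ {a} → Occurs a → t < C → ¬ c₀ ≤ child (rank a) →
      Classes (put C (rank a) letter) (put C t parent) (put C (suc (len t)) len) first (put (rank a) C child)
              (suc C) t c₀ (put C (wd t ∷ʳ a) wd)
    new-class {a} occ t<C c₀≰ = record
      { 1≤t = 1≤t ; 2≤c₀ = 2≤c₀ ; c₀≤C = m≤n⇒m≤1+n c₀≤C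
      ; wd-1 = trans (old (<⇒≢ (≤-trans 2≤c₀ c₀≤C))) wd-1
      ; wd-inj = inj′ ; parent-ok = parent′ ; len≡ = len′
      ; first-t = first-t ; first-mono = first-mono
      ; current = current′ ; older = older′ ; interval = interval′
      ; child< = child′ ; child-back = back′ ; child-let = let′
      }
      where
      old : ∀ {A : Set} {f : ℕ → A} {y c} → c ≢ C → put C y f c ≡ f c
      old = put-other _ _
      new : ∀ {A : Set} {f : ℕ → A} {y} → put C y f C ≡ y
      new = put-same C _ _
      inj′ : ∀ {c c′} → 1 ≤ c → c < suc C → 1 ≤ c′ → c′ < suc C →
             put C (wd t ∷ʳ a) wd c ≡ put C (wd t ∷ʳ a) wd c′ → c ≡ c′
      inj′ {c} {c′} 1≤c c< 1≤c′ c′< e with c ≟ C | c′ ≟ C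
      ... | yes refl | yes refl = refl
      ... | yes refl | no c′≢ = contradiction (sym e) (fresh-word occ t<C c₀≰ 1≤c′ (≤∧≢⇒< (≤-pred c′<) c′≢))
      ... | no c≢ | yes refl = contradiction e (fresh-word occ t<C c₀≰ 1≤c (≤∧≢⇒< (≤-pred c<) c≢))
      ... | no c≢ | no c′≢ = wd-inj 1≤c (≤∧≢⇒< (≤-pred c<) c≢) 1≤c′ (≤∧≢⇒< (≤-pred c′<) c′≢) e
      parent′ : ∀ {c} → 2 ≤ c → c < suc C → 1 ≤ put C t parent c × put C t parent c < suc C ×
        (∃[ b ] Occurs b × put C (wd t ∷ʳ a) wd c ≡ put C (wd t ∷ʳ a) wd (put C t parent c) ∷ʳ b ×
                put C (rank a) letter c ≡ rank b)
      parent′ {c} 2≤c c< with c ≟ C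
      ... | yes refl = 1≤t , m≤n⇒m≤1+n t<C , a , occ , cong (_∷ʳ a) (sym (old (<⇒≢ t<C))) , refl
      ... | no c≢ with parent-ok 2≤c (≤∧≢⇒< (≤-pred c<) c≢)
      ...   | 1≤p , p<C , b , occ′ , w≡ , l≡ =
        1≤p , m≤n⇒m≤1+n p<C , b , occ′ , trans w≡ (cong (_∷ʳ b) (sym (old (<⇒≢ p<C)))) , l≡
      len′ : ∀ {c} → 1 ≤ c → c < suc C → put C (suc (len t)) len c ≡ length (put C (wd t ∷ʳ a) wd c)
      len′ {c} 1≤c c< with c ≟ C
      ... | yes refl = trans (cong suc (len≡ 1≤t t<C)) (sym (trans (length-++ (wd t)) (+-comm _ 1)))
      ... | no c≢ = len≡ 1≤c (≤∧≢⇒< (≤-pred c<) c≢)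
      current′ : ∀ {c} → c₀ ≤ c → c < suc C → put C t parent c ≡ t
      current′ {c} c₀≤ c< with c ≟ C
      ... | yes refl = refl
      ... | no c≢ = current c₀≤ (≤∧≢⇒< (≤-pred c<) c≢)
      older′ : ∀ {c} → 2 ≤ c → c < c₀ → put C t parent c < t ×
               first (put C t parent c) ≤ c × c < first (suc (put C t parent c))
      older′ {c} 2≤c c< with c ≟ C
      ... | yes refl = contradiction c< (≤⇒≯ c₀≤C)
      ... | no c≢ = older 2≤c c<
      interval′ : ∀ {c j} → 1 ≤ c → c < t → first c ≤ j → j < first (suc c) → put C t parent j ≡ c
      interval′ {c} {j} 1≤c c<t ≤j j< with j ≟ C
      ... | yes refl = contradiction (<-≤-trans j< (proj₂ (proj₂ (first-mono 1≤c c<t)))) (≤⇒≯ c₀≤C)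
      ... | no _ = interval 1≤c c<t ≤j j<
      child′ : ∀ r → put (rank a) C child r < suc C
      child′ r with r ≟ rank a
      ... | yes refl = ≤-refl
      ... | no _ = m≤n⇒m≤1+n (child< r)
      back′ : ∀ {r} → c₀ ≤ put (rank a) C child r → put C (rank a) letter (put (rank a) C child r) ≡ r
      back′ {r} c₀≤ with r ≟ rank a
      ... | yes refl = new
      ... | no _ = trans (old (<⇒≢ (child< r))) (child-back c₀≤)
      let′ : ∀ {c} → c₀ ≤ c → c < suc C → put (rank a) C child (put C (rank a) letter c) ≡ c
      let′ {c} c₀≤ c< with c ≟ C
      ... | yes refl = put-same (rank a) C child
      ... | no c≢ with letter c ≟ rank a
      ...   | no _ = child-let c₀≤ (≤∧≢⇒< (≤-pred c<) c≢)
      ...   | yes l≡ = contradiction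
        (subst (c₀ ≤_) (sym (trans (cong child (sym l≡)) (child-let c₀≤ (≤∧≢⇒< (≤-pred c<) c≢)))) c₀≤) c₀≰

    -- With `c₀` raised to `C` every entry of `child` becomes stale at once: the conditions on it
    -- turn vacuous and nothing has to be cleared.
    next-class : t < C → Classes letter parent len (put (suc t) C first) child C (suc t) C wd
    next-class t<C = record
      { 1≤t = s≤s z≤n ; 2≤c₀ = ≤-trans 2≤c₀ c₀≤C ; c₀≤C = ≤-refl
      ; wd-1 = wd-1 ; wd-inj = wd-inj ; parent-ok = parent-ok ; len≡ = len≡
      ; first-t = new ; first-mono = mono′
      ; current = λ ≤c c< → contradiction c< (≤⇒≯ ≤c)
      ; older = older′ ; interval = interval′
      ; child< = child<
      ; child-back = λ {r} ≤ch → contradiction (child< r) (≤⇒≯ ≤ch)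
      ; child-let = λ ≤c c< → contradiction c< (≤⇒≯ ≤c)
      }
      where
      first′ = put (suc t) C first
      new : first′ (suc t) ≡ C
      new = put-same (suc t) C first
      old : ∀ {c} → c ≤ t → first′ c ≡ first c
      old c≤t = put-other C first (<⇒≢ (s≤s c≤t))
      mono′ : ∀ {c} → 1 ≤ c → c < suc t → 2 ≤ first′ c × first′ c ≤ first′ (suc c) × first′ (suc c) ≤ C
      mono′ {c} 1≤c c≤t with m≤n⇒m<n∨m≡n (≤-pred c≤t)
      ... | inj₁ c<t rewrite old (<⇒≤ c<t) | old c<t with first-mono 1≤c c<t
      ...   | l , l′ , l″ = l , l′ , ≤-trans l″ c₀≤C
      mono′ {c} 1≤c c≤t | inj₂ refl rewrite old (≤-refl {t}) | new | first-t = 2≤c₀ , c₀≤C , ≤-refl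
      older′ : ∀ {c} → 2 ≤ c → c < C → parent c < suc t × first′ (parent c) ≤ c × c < first′ (suc (parent c))
      older′ {c} 2≤c c<C with c <? c₀
      ... | yes c<c₀ with older 2≤c c<c₀
      ...   | p<t , l , l′ rewrite old (<⇒≤ p<t) | old p<t = m≤n⇒m≤1+n p<t , l , l′
      older′ {c} 2≤c c<C | no c≮c₀ rewrite current (≮⇒≥ c≮c₀) c<C | old (≤-refl {t}) | new | first-t = ≤-refl , ≮⇒≥ c≮c₀ , c<C
      interval′ : ∀ {c j} → 1 ≤ c → c < suc t → first′ c ≤ j → j < first′ (suc c) → parent j ≡ c
      interval′ {c} 1≤c c≤t ≤j j< with m≤n⇒m<n∨m≡n (≤-pred c≤t)
      ... | inj₁ c<t rewrite old (<⇒≤ c<t) | old c<t = interval 1≤c c<t ≤j j<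
      ... | inj₂ refl rewrite old (≤-refl {t}) | new | first-t = current ≤j j<

  module _ {from to next head cl : ℕ → ℕ} {E C : ℕ} {wd : ℕ → Word σ}
           (d : Entries from to next head cl E C wd) where

    open Entries d

    add-class : ∀ {w} → 1 ≤ C → Entries from to next (put C 0 head) cl E (suc C) (put C w wd)
    add-class {w} 1≤C = record
      { entry = entry ; entry-inj = entry-inj ; member = member′ ; head≤ = head′
      ; class< = m≤n⇒m≤1+n ∘ class<
      ; class-word = λ v → trans (put-other w wd (<⇒≢ (class< v))) (class-word v)
      ; prefix = prefix }
      where
      member′ : ∀ {c} → 1 ≤ c → c < suc C → Members from to next cl c (put C 0 head c)
      member′ {c} 1≤c c< with c ≟ C
      ... | no c≢ = member 1≤c (≤∧≢⇒< (≤-pred c<) c≢)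
      ... | yes refl = members [] [] (λ ()) λ v x e →
              contradiction e (<⇒≢ (class< λ z → <⇒≢ 1≤C (trans (sym z) e)))
      head′ : ∀ {c} → 1 ≤ c → c < suc C → put C 0 head c ≤ E
      head′ {c} 1≤c c< with c ≟ C
      ... | no c≢ = head≤ 1≤c (≤∧≢⇒< (≤-pred c<) c≢)
      ... | yes refl = z≤n

    at-old : ∀ {q a b v x} → q ≤ E → At from to q v x → At (put (suc E) a from) (put (suc E) b to) q v x
    at-old q≤E (at e₁ e₂) = at (trans (put-other _ from (<⇒≢ (s≤s q≤E))) e₁) (trans (put-other _ to (<⇒≢ (s≤s q≤E))) e₂)

    at-old⁻ : ∀ {q a b v x} → q ≤ E → At (put (suc E) a from) (put (suc E) b to) q v x → At from to q v x
    at-old⁻ q≤E (at e₁ e₂) = at (trans (sym (put-other _ from (<⇒≢ (s≤s q≤E)))) e₁) (trans (sym (put-other _ to (<⇒≢ (s≤s q≤E)))) e₂)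

    at-new : ∀ {v x} → At (put (suc E) (toℕ v) from) (put (suc E) (toℕ x) to) (suc E) v x
    at-new = at (put-same (suc E) _ from) (put-same (suc E) _ to)

    class-old : ∀ {v y v′ x c} → cl (pr v y) ≡ 0 → cl (pr v′ x) ≢ 0 → put (pr v y) c cl (pr v′ x) ≡ cl (pr v′ x)
    class-old e ne = put-other _ cl λ p → ne (trans (cong cl p) e)

    class-visited : ∀ {v y v′ x c} → 1 ≤ c → cl (pr v′ x) ≢ 0 → put (pr v y) c cl (pr v′ x) ≢ 0
    class-visited {v} {y} {v′} {x} 1≤c ne with pr v′ x ≟ pr v y
    ... | yes _ = λ c≡0 → <⇒≢ 1≤c (sym c≡0)
    ... | no _  = ne

    -- The last hypothesis preserves `prefix`, the closure of the visited pairs under initial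
    -- segments of paths: every vertex of the new path except its end must have been visited.
    push-entry : ∀ {c v y a b k} → a ≡ toℕ v → b ≡ toℕ y → k ≡ pr v y →
      1 ≤ c → c < C → wd c ≡ W v y → cl (pr v y) ≡ 0 →
      (∀ {z} → z ∈ Vs v y → z ≡ y ⊎ cl (pr v z) ≢ 0) →
      Entries (put (suc E) a from) (put (suc E) b to) (put (suc E) (head c) next)
              (put c (suc E) head) (put k c cl) (suc E) C wd
    push-entry {c} {v} {y} refl refl refl 1≤c c<C w≡ unvisited pre = record
      { entry = entry′ ; entry-inj = inj′ ; member = member′ ; head≤ = head′
      ; class< = class<′ ; class-word = word′ ; prefix = prefix′ }
      where
      from′ = put (suc E) (toℕ v) from
      to′   = put (suc E) (toℕ y) to
      next′ = put (suc E) (head c) next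
      head″ = put c (suc E) head
      cl′   = put (pr v y) c cl
      entry′ : ∀ {q} → 1 ≤ q → q ≤ suc E → ∃[ p ] ∃[ x ] At from′ to′ q p x × cl′ (pr p x) ≢ 0
      entry′ {q} 1≤q q≤ with m≤n⇒m<n∨m≡n q≤
      ... | inj₁ q≤E with entry 1≤q (≤-pred q≤E)
      ...   | p , x , a , ne = p , x , at-old (≤-pred q≤E) a , class-visited 1≤c ne
      entry′ {q} 1≤q q≤ | inj₂ refl = v , y , at-new , λ e → <⇒≢ 1≤c (sym (trans (sym (put-same (pr v y) c cl)) e))
      -- Old entries are visited pairs, the new one was not.
      clash : ∀ {q} {p x : Fin n} → 1 ≤ q → q ≤ E → At from′ to′ q p x → At from′ to′ (suc E) p x → ⊥
      clash 1≤q q≤E a a′ with entry 1≤q q≤E | At-functional a′ at-new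
      ... | p′ , x′ , a″ , ne | refl , refl with At-functional (at-old⁻ q≤E a) a″
      ...   | refl , refl = ne unvisited
      inj′ : ∀ {q q′ p x} → 1 ≤ q → q ≤ suc E → 1 ≤ q′ → q′ ≤ suc E → At from′ to′ q p x → At from′ to′ q′ p x → q ≡ q′
      inj′ 1≤q q≤ 1≤q′ q′≤ a a′ with m≤n⇒m<n∨m≡n q≤ | m≤n⇒m<n∨m≡n q′≤
      ... | inj₁ q≤E | inj₁ q′≤E = entry-inj 1≤q (≤-pred q≤E) 1≤q′ (≤-pred q′≤E) (at-old⁻ (≤-pred q≤E) a) (at-old⁻ (≤-pred q′≤E) a′)
      ... | inj₁ q≤E | inj₂ refl = ⊥-elim (clash 1≤q (≤-pred q≤E) a a′)
      ... | inj₂ refl | inj₁ q′≤E = ⊥-elim (clash 1≤q′ (≤-pred q′≤E) a′ a)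
      ... | inj₂ refl | inj₂ refl = refl
      keep : ∀ {ps h z} → h ≤ E → Chain next h ps → (∀ {q} → q ∈ ps → ∃[ p ] ∃[ x ] At from to q p x × cl (pr p x) ≡ z) →
             1 ≤ z → ∀ {q} → q ∈ ps → ∃[ p ] ∃[ x ] At from′ to′ q p x × cl′ (pr p x) ≡ z
      keep h≤ ch s 1≤z i with s i
      ... | p , x , a , e = p , x , at-old (≤-trans (chain-≤ ch i) h≤) a ,
                            trans (class-old unvisited λ z → <⇒≢ 1≤z (sym (trans (sym e) z))) e
      member′ : ∀ {z} → 1 ≤ z → z < C → Members from′ to′ next′ cl′ z (head″ z)
      member′ {z} 1≤z z<C with z ≟ c | member 1≤z z<C | head≤ 1≤z z<C
      ... | no z≢c | members ps ch s k | h≤ = members ps (chain-put (s≤s h≤) ch) (keep h≤ ch s 1≤z) complete′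
        where
        complete′ : ∀ p x → cl′ (pr p x) ≡ z → ∃[ q ] q ∈ ps × At from′ to′ q p x
        complete′ p x e with pr p x ≟ pr v y
        ... | yes _ = contradiction (sym e) z≢c
        ... | no _ with k p x e
        ...   | q , i , a = q , i , at-old (≤-trans (chain-≤ ch i) h≤) a
      ... | yes refl | members ps ch s k | h≤ = members (suc E ∷ ps) (chain-push h≤ ch) sound′ complete′
        where
        sound′ : ∀ {q} → q ∈ suc E ∷ ps → ∃[ p ] ∃[ x ] At from′ to′ q p x × cl′ (pr p x) ≡ z
        sound′ (here refl) = v , y , at-new , put-same (pr v y) c cl
        sound′ (there i)   = keep h≤ ch s 1≤z i
        complete′ : ∀ p x → cl′ (pr p x) ≡ z → ∃[ q ] q ∈ suc E ∷ ps × At from′ to′ q p x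
        complete′ p x e with pr p x ≟ pr v y
        ... | yes pr≡ with pr-injective {p} {x} {v} {y} pr≡
        ...   | refl , refl = suc E , here refl , at-new
        complete′ p x e | no _ with k p x e
        ...   | q , i , a = q , there i , at-old (≤-trans (chain-≤ ch i) h≤) a
      head′ : ∀ {z} → 1 ≤ z → z < C → head″ z ≤ suc E
      head′ {z} 1≤z z<C with z ≟ c
      ... | yes _ = ≤-refl
      ... | no _ = m≤n⇒m≤1+n (head≤ 1≤z z<C)
      class<′ : ∀ {p x} → cl′ (pr p x) ≢ 0 → cl′ (pr p x) < C
      class<′ {p} {x} ne with pr p x ≟ pr v y
      ... | yes _ = c<C
      ... | no _  = class< ne
      word′ : ∀ {p x} → cl′ (pr p x) ≢ 0 → wd (cl′ (pr p x)) ≡ W p x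
      word′ {p} {x} ne with pr p x ≟ pr v y
      ... | no _  = class-word ne
      ... | yes e with pr-injective {p} {x} {v} {y} e
      ...   | refl , refl = w≡
      prefix′ : ∀ {p x z} → cl′ (pr p x) ≢ 0 → z ∈ Vs p x → cl′ (pr p z) ≢ 0
      prefix′ {p} {x} {z} ne i with pr p x ≟ pr v y
      ... | no _  = class-visited 1≤c (prefix ne i)
      ... | yes e with pr-injective {p} {x} {v} {y} e
      ...   | refl , refl with pre i
      ...     | inj₁ refl = λ e → <⇒≢ 1≤c (sym (trans (sym (put-same (pr v y) c cl)) e))
      ...     | inj₂ vis  = class-visited 1≤c vis

    -- Entries denote distinct pairs of vertices, so they embed into `Fin (n * n)`. All bounds on
    -- entry and class numbers derive from this.
    E≤nn : E ≤ n * n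
    E≤nn = injective⇒≤ {f = f} f-injective
      where
      ent : (i : Fin E) → ∃[ v ] ∃[ x ] At from to (suc (toℕ i)) v x × cl (pr v x) ≢ 0
      ent i = entry (s≤s z≤n) (toℕ<n i)
      f : Fin E → Fin (n * n)
      f i = combine (proj₁ (ent i)) (proj₁ (proj₂ (ent i)))
      f-injective : ∀ {i j} → f i ≡ f j → i ≡ j
      f-injective {i} {j} e = toℕ-injective (suc-injective (entry-inj (s≤s z≤n) (toℕ<n i) (s≤s z≤n) (toℕ<n j)
        (proj₁ (proj₂ (proj₂ (ent i))))
        (subst (λ (v , x) → At from to (suc (toℕ j)) v x) (sym both) (proj₁ (proj₂ (proj₂ (ent j)))))))
        where
        both : (proj₁ (ent i) , proj₁ (proj₂ (ent i))) ≡ (proj₁ (ent j) , proj₁ (proj₂ (ent j)))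
        both = cong₂ _,_ (combine-injectiveˡ (proj₁ (ent i)) _ _ _ e) (combine-injectiveʳ (proj₁ (ent i)) (proj₁ (proj₂ (ent i))) _ _ e)

word-length : ∀ {n σ} {G : Graph n σ} {u v vs x} → Walk G u v vs x → length vs ≡ suc (length x)
word-length stop       = refl
word-length (step _ w) = cong suc (word-length w)

-- Visiting one pair of vertices

module TrieStage {n σ : ℕ} (T : Tree n σ) where

  open Naming T public

  W-length : ∀ u v → length (W u v) < n
  W-length u v = begin
    suc (length (W u v))  ≡⟨ word-length (walk u v) ⟨
    length (Vs u v)       ≤⟨ length-⊆ (Vs-unique u v) (λ {x} _ → ∈-allFin x) ⟩
    length (allFin n)     ≡⟨ length-tabulate (λ (i : Fin n) → i) ⟩
    n                     ∎
    where open ≤-Reasoning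

  near : ∀ {z} → z ≤ 4 + n * n → z < N
  near {z} z≤ = begin-strict
    z                      ≤⟨ z≤ ⟩
    4 + n * n              ≤⟨ +-monoˡ-≤ (n * n) (m≤m*n 4 (n * n) {{>-nonZero 1≤nn}}) ⟩
    4 * (n * n) + n * n    ≡⟨ +-comm (4 * (n * n)) (n * n) ⟩
    5 * (n * n)            <⟨ *-monoˡ-< (n * n) {{>-nonZero 1≤nn}} {5} {8} (s≤s (s≤s (s≤s (s≤s (s≤s (s≤s z≤n)))))) ⟩
    N                      ∎
    where
    open ≤-Reasoning
    1≤nn : 1 ≤ n * n
    1≤nn = ≤-trans nonempty n≤nn

  vertex< : ∀ {z} (x : Fin n) → z ≡ toℕ x → z < N
  vertex< x refl = small (≤-trans (<⇒≤ (toℕ<n x)) (m≤n*m n 7))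

  Arrays : Set
  Arrays = Fin K → ℕ → ℕ

  -- The parameters are the components of the state that matter, not the state itself: assignments
  -- to other registers and arrays then preserve the record by computation. `Entries`, `Classes` and
  -- `Facts` take the same form.
  record Base (adj : Fin n → List ℕ) (n′ : ℕ) (hd nx tg rk mk : ℕ → ℕ) (o : List ℕ) : Set where
    field
      n≡    : n′ ≡ n
      arcs  : Adj hd nx tg rk (2 * m) adj
      reach : ∀ {x y a} → G ⊢ x —[ a ]— y → Reach tg adj x y
      mark0 : ∀ k → mk k ≡ 0
      out[] : o ≡ []

  BaseOf : (Fin n → List ℕ) → St → Set
  BaseOf adj s = Base adj (regsᴴ s rN) (arrs s aHead) (arrs s aNext) (arrs s aTarget) (arrs s aRank) (arrs s lMark) (outᴴ s)

  arc< : ∀ {z} → z ≤ 2 * m → z < N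
  arc< z≤ = small (≤-trans z≤ (*-mono-≤ {2} {7} (s≤s (s≤s z≤n)) edge-count))

  EntriesOf : Arrays → ℕ → ℕ → (ℕ → Word σ) → Set
  EntriesOf α = Entries (α eFrom) (α eTo) (α eNext) (α cHead) (α pClass)

  ClassesOf : Arrays → ℕ → ℕ → ℕ → (ℕ → Word σ) → Set
  ClassesOf α = Classes (α cLetter) (α cParent) (α cLength) (α cFirst) (α lChild)

  AtOf : Arrays → ℕ → Fin n → Fin n → Set
  AtOf α = At (α eFrom) (α eTo)

  cls : Arrays → Fin n → Fin n → ℕ
  cls α v x = α pClass (pr v x)

  Closed : Arrays → Fin n → Fin n → Set
  Closed α v x = ∀ {y a} → G ⊢ x —[ a ]— y → cls α v y ≢ 0

  NonEmpty : Arrays → ℕ → Set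
  NonEmpty α C = ∀ {c} → 1 ≤ c → c < C → 1 ≤ α cHead c

  -- While class t is processed: ps is the member list from p on, and the pairs
  -- of class t with a possibly unvisited neighbour are in qs or pending.
  record Core (α : Arrays) (E C t c₀ p : ℕ) (ps qs : List ℕ) (Pending : Fin n → Fin n → Set)
              (done : List (Fin n × Fin n)) (wd : ℕ → Word σ) : Set where
    field
      entries     : EntriesOf α E C wd
      classes     : ClassesOf α C t c₀ wd
      t<c₀        : t < c₀
      trivial     : ∀ v → cls α v v ≢ 0
      chained     : Chain (α eNext) p ps
      p≤E         : p ≤ E
      qs⊆ps       : ∀ {q} → q ∈ qs → q ∈ ps
      closed      : ∀ {v x} → cls α v x ≢ 0 → cls α v x < t → Closed α v x
      frontier    : ∀ {v x} → cls α v x ≡ t → Closed α v x ⊎ ((∃[ q ] q ∈ qs × AtOf α q v x) ⊎ Pending v x)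
      unprocessed : ∀ {q} → q ∈ qs → ∃[ v ] ∃[ x ] AtOf α q v x × cls α v x ≡ t
      done-unique : Unique done
      done-ok     : ∀ {v x} → (v , x) ∈ done →
                    cls α v x ≢ 0 × (cls α v x < t ⊎ (cls α v x ≡ t × (∀ {q} → q ∈ qs → ¬ AtOf α q v x)))

  -- Kept apart from `Core` because within a visit both fields may fail: a new class has no member
  -- until its first entry is added. In between, `Mid` carries weaker versions, with an exception
  -- for the new class and `2 + E` in place of `suc E`.
  record Full (α : Arrays) (E C : ℕ) : Set where
    constructor full
    field
      nonEmpty : NonEmpty α C
      C≤       : C ≤ suc E

  -- A state about to add the pair (v , y) to the class found at lChild (rank a).
  record Pre (adj : Fin n → List ℕ) (t c₀ p : ℕ) (ps qs : List ℕ) (Pending : Fin n → Fin n → Set)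
             (done : List (Fin n × Fin n)) (wd : ℕ → Word σ) (v x y : Fin n) (a : Fin σ) (s : St) : Set where
    field
      common    : BaseOf adj s
      core     : Core (arrs s) (regsᴴ s rE) (regsᴴ s rC) t c₀ p ps qs Pending done wd
      arc      : G ⊢ x —[ a ]— y
      v≡       : regsᴴ s rV ≡ toℕ v
      y≡       : regsᴴ s rY ≡ toℕ y
      r≡       : regsᴴ s rR ≡ rank a
      k≡       : regsᴴ s rK ≡ pr v y
      t≡       : regsᴴ s rT ≡ t
      c₀≡      : regsᴴ s rC₀ ≡ c₀
      vx-class : cls (arrs s) v x ≡ t
      vy-new   : cls (arrs s) v y ≡ 0

  record Post (adj : Fin n → List ℕ) (t c₀ p : ℕ) (ps qs : List ℕ) (Pending : Fin n → Fin n → Set)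
              (done : List (Fin n × Fin n)) (v x y : Fin n) (s s′ : St) : Set where
    field
      common    : BaseOf adj s′
      wd       : ℕ → Word σ
      core     : Core (arrs s′) (regsᴴ s′ rE) (regsᴴ s′ rC) t c₀ p ps qs Pending done wd
      filled   : Full (arrs s′) (regsᴴ s′ rE) (regsᴴ s′ rC)
      vx-class : cls (arrs s′) v x ≡ t
      visited  : cls (arrs s′) v y ≢ 0
      persist  : ∀ {v x} → cls (arrs s) v x ≢ 0 → cls (arrs s′) v x ≢ 0
      next≡    : arrs s′ aNext ≡ arrs s aNext
      target≡  : arrs s′ aTarget ≡ arrs s aTarget
      arc≡     : regsᴴ s′ rArc ≡ regsᴴ s rArc
      p≡       : regsᴴ s′ rP ≡ regsᴴ s rP
      t≡       : regsᴴ s′ rT ≡ t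
      c₀≡      : regsᴴ s′ rC₀ ≡ c₀
      v≡       : regsᴴ s′ rV ≡ toℕ v
      ticks≡   : ticks s′ ≡ ticks s

  module _ {adj : Fin n → List ℕ} {t c₀ p : ℕ} {ps qs : List ℕ} {Pending : Fin n → Fin n → Set}
           {done : List (Fin n × Fin n)} {v x y : Fin n} {a : Fin σ} where

    -- By `prefix` all vertices on the path from `v` to `x` are visited together with `v`. The
    -- unvisited `y` is therefore off this path and extends it to a simple path.
    visited-word : ∀ {wd s} → Pre adj t c₀ p ps qs Pending done wd v x y a s →
                   Vs v y ≡ Vs v x ∷ʳ y × W v y ≡ wd t ∷ʳ a
    visited-word {wd} {s} pre = proj₁ ext , trans (proj₂ ext) (cong (_∷ʳ a) (sym wt≡))
      where
      open Pre pre
      open Core core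
      vx≢0 : cls (arrs s) v x ≢ 0
      vx≢0 e = <⇒≢ (Classes.1≤t classes) (sym (trans (sym vx-class) e))
      ext = extend arc (λ i → Entries.prefix entries vx≢0 i vy-new)
      wt≡ : wd t ≡ W v x
      wt≡ = trans (cong wd (sym vx-class)) (Entries.class-word entries vx≢0)

    rank<N : ∀ {u w b z} → G ⊢ u —[ b ]— w → z ≡ rank b → z < N
    rank<N {b = b} e refl = small (≤-trans (<⇒≤ (rank-< {b} (edge-occurs e))) (≤-trans edge-count (m≤n*m n 7)))

    -- Relative to the state s₀ in which the visit started.
    record Mid (s₀ s : St) : Set where
      field
        wd      : ℕ → Word σ
        pre     : Pre adj t c₀ p ps qs Pending done wd v x y a s
        c₀≤c    : c₀ ≤ arrs s lChild (rank a)
        ne      : ∀ {c} → 1 ≤ c → c < regsᴴ s rC → 1 ≤ arrs s cHead c ⊎ c ≡ arrs s lChild (rank a)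
        C≤      : regsᴴ s rC ≤ 2 + regsᴴ s rE
        keep    : ∀ {v x} → cls (arrs s₀) v x ≢ 0 → cls (arrs s) v x ≢ 0
        next≡   : arrs s aNext ≡ arrs s₀ aNext
        target≡ : arrs s aTarget ≡ arrs s₀ aTarget
        arc≡    : regsᴴ s rArc ≡ regsᴴ s₀ rArc
        p≡      : regsᴴ s rP ≡ regsᴴ s₀ rP
        ticks≡  : ticks s ≡ ticks s₀

    pushEntry-correct : ∀ {s₀ s} → Mid s₀ s →
      WP pushEntry (Post adj t c₀ p ps qs Pending done v x y s₀) s
    pushEntry-correct {s₀} {s} mid = run pushEntry
      (rank<N arc r≡ , sE<N , sE<N , sE<N , c<N , sE<N , c<N , k<N ,
       record
        { common = common ; wd = wd ; core = core′ ; filled = filled′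
        ; vx-class = trans (class-old′ vx≢0) vx-class
        ; visited = λ e → <⇒≢ 1≤c (sym (trans (sym here-c) e))
        ; persist = λ v → visit-mono (keep v)
        ; next≡ = next≡ ; target≡ = target≡ ; arc≡ = arc≡ ; p≡ = p≡ ; t≡ = t≡ ; c₀≡ = c₀≡ ; v≡ = v≡ ; ticks≡ = ticks≡ })
      where
      open Mid mid
      open Pre pre
      open Core core
      d = entries
      α = arrs s
      E = regsᴴ s rE
      C = regsᴴ s rC
      c = α lChild (regsᴴ s rR)
      c≡ : c ≡ α lChild (rank a)
      c≡ = cong (α lChild) r≡
      c₀≤ : c₀ ≤ c
      c₀≤ = subst (c₀ ≤_) (sym c≡) c₀≤c
      t<c : t < c
      t<c = <-≤-trans t<c₀ c₀≤
      1≤c : 1 ≤ c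
      1≤c = ≤-trans (s≤s z≤n) t<c
      c<C : c < C
      c<C = Classes.child< classes (regsᴴ s rR)
      w≡ : wd c ≡ W v y
      w≡ = trans (cong wd c≡) (trans (child-word classes (edge-occurs arc) c₀≤c) (sym (proj₂ (visited-word pre))))
      vx≢0 : cls α v x ≢ 0
      vx≢0 e = <⇒≢ (Classes.1≤t classes) (sym (trans (sym vx-class) e))
      sE<N : suc E < N
      sE<N = near (s≤s (≤-trans (E≤nn d) (m≤n+m _ 3)))
      c<N : c < N
      c<N = near (≤-trans (<⇒≤ c<C) (≤-trans C≤ (+-mono-≤ (s≤s (s≤s z≤n)) (E≤nn d))))
      k<N : regsᴴ s rK < N
      k<N = near (subst (_≤ 4 + n * n) (sym k≡) (≤-trans (<⇒≤ (pr< v y)) (m≤n+m _ 4)))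
      pre-z : ∀ {z} → z ∈ Vs v y → z ≡ y ⊎ cls α v z ≢ 0
      pre-z {z} i with ∈-++⁻ (Vs v x) (subst (z ∈_) (proj₁ (visited-word pre)) i)
      ... | inj₁ j           = inj₂ (Entries.prefix d vx≢0 j)
      ... | inj₂ (here refl) = inj₁ refl
      α′ : Arrays
      α′ = assign pClass (put (regsᴴ s rK) c (α pClass)) (assign cHead (put c (suc E) (α cHead))
           (assign eNext (put (suc E) (α cHead c) (α eNext)) (assign eTo (put (suc E) (regsᴴ s rY) (α eTo))
           (assign eFrom (put (suc E) (regsᴴ s rV) (α eFrom)) α))))
      cl≡ : ∀ {v′ x′} → cls α′ v′ x′ ≡ put (pr v y) c (α pClass) (pr v′ x′)
      cl≡ {v′} {x′} = cong (λ k → put k c (α pClass) (pr v′ x′)) k≡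
      here-c : cls α′ v y ≡ c
      here-c = trans cl≡ (put-same (pr v y) c (α pClass))
      class-old′ : ∀ {v′ x′} → cls α v′ x′ ≢ 0 → cls α′ v′ x′ ≡ cls α v′ x′
      class-old′ {v′} {x′} ne = trans (cl≡ {v′} {x′}) (class-old d {v} {y} {v′} {x′} vy-new ne)
      visit-mono : ∀ {v′ x′} → cls α v′ x′ ≢ 0 → cls α′ v′ x′ ≢ 0
      visit-mono ne e = ne (trans (sym (class-old′ ne)) e)
      closed-mono : ∀ {v′ x′} → Closed α v′ x′ → Closed α′ v′ x′
      closed-mono cl e = visit-mono (cl e)
      -- The new pair has a class beyond `t`, so pairs of class at most `t` were visited before.
      back : ∀ {v′ x′} → cls α′ v′ x′ ≢ 0 → cls α′ v′ x′ ≤ t → cls α v′ x′ ≢ 0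
      back {v′} {x′} ne ≤t e with pr v′ x′ ≟ regsᴴ s rK
      ... | yes _ = <⇒≱ t<c ≤t
      ... | no _  = ne e
      at-mono : ∀ {q v′ x′} → q ∈ qs → AtOf α q v′ x′ → AtOf α′ q v′ x′
      at-mono i = at-old d (≤-trans (chain-≤ chained (qs⊆ps i)) p≤E)
      frontier′ : ∀ {v′ x′} → cls α′ v′ x′ ≡ t → Closed α′ v′ x′ ⊎ ((∃[ q ] q ∈ qs × AtOf α′ q v′ x′) ⊎ Pending v′ x′)
      frontier′ {v′} {x′} e with back {v′} {x′} (λ z → <⇒≢ (Classes.1≤t classes) (sym (trans (sym e) z))) (≤-reflexive e)
      ... | ne with frontier (trans (sym (class-old′ ne)) e)
      ...   | inj₁ cl = inj₁ (closed-mono cl)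
      ...   | inj₂ (inj₁ (q , i , a′)) = inj₂ (inj₁ (q , i , at-mono i a′))
      ...   | inj₂ (inj₂ pend) = inj₂ (inj₂ pend)
      closed′ : ∀ {v′ x′} → cls α′ v′ x′ ≢ 0 → cls α′ v′ x′ < t → Closed α′ v′ x′
      closed′ {v′} {x′} ne <t with back {v′} {x′} ne (<⇒≤ <t)
      ... | ne₀ = closed-mono (closed ne₀ (subst (_< t) (class-old′ ne₀) <t))
      done′ : ∀ {v′ x′} → (v′ , x′) ∈ done →
              cls α′ v′ x′ ≢ 0 × (cls α′ v′ x′ < t ⊎ (cls α′ v′ x′ ≡ t × (∀ {q} → q ∈ qs → ¬ AtOf α′ q v′ x′)))
      done′ i with done-ok i
      ... | ne , inj₁ <t = visit-mono ne , inj₁ (subst (_< t) (sym (class-old′ ne)) <t)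
      ... | ne , inj₂ (≡t , ¬at) = visit-mono ne , inj₂ (trans (class-old′ ne) ≡t ,
              λ j a′ → ¬at j (at-old⁻ d (≤-trans (chain-≤ chained (qs⊆ps j)) p≤E) a′))
      unprocessed′ : ∀ {q} → q ∈ qs → ∃[ v′ ] ∃[ x′ ] AtOf α′ q v′ x′ × cls α′ v′ x′ ≡ t
      unprocessed′ i with unprocessed i
      ... | v′ , x′ , a′ , e = v′ , x′ , at-mono i a′ ,
        trans (class-old′ λ z → <⇒≢ (Classes.1≤t classes) (sym (trans (sym e) z))) e
      core′ : Core α′ (suc E) C t c₀ p ps qs Pending done wd
      core′ = record
        { entries = push-entry d v≡ y≡ k≡ 1≤c c<C w≡ vy-new pre-z
        ; classes = classes ; t<c₀ = t<c₀
        ; trivial = λ u → visit-mono (trivial u)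
        ; chained = chain-put (s≤s p≤E) chained
        ; p≤E = m≤n⇒m≤1+n p≤E ; qs⊆ps = qs⊆ps
        ; closed = closed′ ; frontier = frontier′ ; unprocessed = unprocessed′ ; done-unique = done-unique ; done-ok = done′ }
      filled′ : Full α′ (suc E) C
      filled′ = full nonEmpty′ C≤
        where
        nonEmpty′ : NonEmpty α′ C
        nonEmpty′ {z} 1≤z z<C with z ≟ c
        ... | yes _ = s≤s z≤n
        ... | no z≢c with ne 1≤z z<C
        ...   | inj₁ h = h
        ...   | inj₂ e = contradiction (trans e (sym c≡)) z≢c

    newClass-correct : ∀ {wd s} → Pre adj t c₀ p ps qs Pending done wd v x y a s →
      Full (arrs s) (regsᴴ s rE) (regsᴴ s rC) → ¬ c₀ ≤ arrs s lChild (rank a) → WP newClass (Mid s) s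
    newClass-correct {wd} {s} pre (full ne C≤) stale = run newClass
      (rank<N arc r≡ , C<N , C<N , t<N , len< , C<N , C<N , sC<N ,
       record
         { wd = put C (wd t ∷ʳ a) wd
         ; pre = record { common = common ; arc = arc ; v≡ = v≡ ; y≡ = y≡ ; r≡ = r≡ ; k≡ = k≡ ; t≡ = t≡ ; c₀≡ = c₀≡
                        ; vx-class = vx-class ; vy-new = vy-new
                        ; core = record
                            { entries = add-class entries (≤-trans (s≤s z≤n) t<C)
                            ; classes = classes₁ ; t<c₀ = t<c₀ ; trivial = trivial ; chained = chained ; p≤E = p≤E
                            ; qs⊆ps = qs⊆ps ; closed = closed ; frontier = frontier ; unprocessed = unprocessed
                            ; done-unique = done-unique ; done-ok = done-ok } }
         ; c₀≤c = subst (c₀ ≤_) (sym child≡) (Classes.c₀≤C classes)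
         ; ne = ne₁ ; C≤ = s≤s C≤ ; keep = λ v → v
         ; next≡ = refl ; target≡ = refl ; arc≡ = refl ; p≡ = refl ; ticks≡ = refl })
      where
      open Pre pre
      open Core core
      α = arrs s
      E = regsᴴ s rE
      C = regsᴴ s rC
      t<C : t < C
      t<C = <-≤-trans t<c₀ (Classes.c₀≤C classes)
      C<N : C < N
      C<N = near (≤-trans C≤ (s≤s (≤-trans (E≤nn entries) (m≤n+m _ 3))))
      sC<N : suc C < N
      sC<N = near (s≤s (≤-trans C≤ (s≤s (≤-trans (E≤nn entries) (m≤n+m _ 2)))))
      t<N : regsᴴ s rT < N
      t<N = subst (_< N) (sym t≡) (<-trans t<C C<N)
      vx≢0 : cls α v x ≢ 0
      vx≢0 e = <⇒≢ (Classes.1≤t classes) (sym (trans (sym vx-class) e))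
      len< : suc (α cLength (regsᴴ s rT)) < N
      len< = small (≤-trans (≤-trans (≤-reflexive (cong suc (trans (cong (α cLength) t≡)
               (trans (Classes.len≡ classes (Classes.1≤t classes) t<C)
                      (cong length (trans (cong wd (sym vx-class)) (Entries.class-word entries vx≢0)))))))
               (W-length v x)) (m≤n*m n 7))
      child≡ : put (regsᴴ s rR) C (α lChild) (rank a) ≡ C
      child≡ = trans (cong (λ z → put z C (α lChild) (rank a)) r≡) (put-same (rank a) C (α lChild))
      classes₁ : Classes (put C (regsᴴ s rR) (α cLetter)) (put C (regsᴴ s rT) (α cParent))
                   (put C (suc (α cLength (regsᴴ s rT))) (α cLength)) (α cFirst) (put (regsᴴ s rR) C (α lChild))
                   (suc C) t c₀ (put C (wd t ∷ʳ a) wd)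
      classes₁ = subst₂ (λ r t′ → Classes (put C r (α cLetter)) (put C t′ (α cParent))
                   (put C (suc (α cLength t′)) (α cLength)) (α cFirst) (put r C (α lChild))
                   (suc C) t c₀ (put C (wd t ∷ʳ a) wd)) (sym r≡) (sym t≡)
                   (new-class classes (edge-occurs arc) t<C stale)
      ne₁ : ∀ {c} → 1 ≤ c → c < suc C → 1 ≤ put C 0 (α cHead) c ⊎ c ≡ put (regsᴴ s rR) C (α lChild) (rank a)
      ne₁ {c} 1≤c c< with c ≟ C
      ... | yes refl = inj₂ (sym child≡)
      ... | no c≢ = inj₁ (ne 1≤c (≤∧≢⇒< (≤-pred c<) c≢))

    visit-correct : ∀ {wd s} → Pre adj t c₀ p ps qs Pending done wd v x y a s →
      Full (arrs s) (regsᴴ s rE) (regsᴴ s rC) → WP visit (Post adj t c₀ p ps qs Pending done v x y s) s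
    visit-correct {wd} {s} pre filled@(full ne C≤) = run visit
      (rank<N arc r≡ ,
       (λ fresh → WP-mono (λ s′ mid → pushEntry-correct (record
           { wd = Mid.wd mid ; pre = Mid.pre mid ; c₀≤c = Mid.c₀≤c mid ; ne = Mid.ne mid ; C≤ = Mid.C≤ mid
           ; keep = λ v → Mid.keep mid v ; next≡ = Mid.next≡ mid ; target≡ = Mid.target≡ mid
           ; arc≡ = Mid.arc≡ mid ; p≡ = Mid.p≡ mid ; ticks≡ = Mid.ticks≡ mid }))
         (newClass-correct loaded filled
           λ c₀≤ → <⇒≱ fresh (subst₂ _≤_ (sym c₀≡) (cong (arrs s lChild) (sym r≡)) c₀≤))) ,
       (λ stale → pushEntry-correct (record
           { wd = wd ; pre = loaded
           ; c₀≤c = subst (λ r → c₀ ≤ arrs s lChild r) r≡ (subst (_≤ arrs s lChild (regsᴴ s rR)) c₀≡ (≮⇒≥ stale))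
           ; ne = λ 1≤c c<C → inj₁ (ne 1≤c c<C) ; C≤ = m≤n⇒m≤1+n C≤ ; keep = λ v → v
           ; next≡ = refl ; target≡ = refl ; arc≡ = refl ; p≡ = refl ; ticks≡ = refl })))
      where
      open Pre pre
      loaded : Pre adj t c₀ p ps qs Pending done wd v x y a (setᴿ rCl (arrs s lChild (regsᴴ s rR)) s)
      loaded = record { common = common ; core = core ; arc = arc ; v≡ = v≡ ; y≡ = y≡ ; r≡ = r≡ ; k≡ = k≡ ; t≡ = t≡ ; c₀≡ = c₀≡
                      ; vx-class = vx-class ; vy-new = vy-new }

chain-uncons : ∀ {nx h es k} → Chain nx h es → length es ≡ suc k →
               ∃[ es′ ] es ≡ h ∷ es′ × nx h < h × Chain nx (nx h) es′ × length es′ ≡ k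
chain-uncons (d ∷ c) refl = _ , refl , s≤s d , c , refl

chain-end : ∀ {nx h es} → Chain nx h es → ¬ 0 < h → es ≡ []
chain-end []      _   = refl
chain-end (_ ∷ _) 0≮h = contradiction (s≤s z≤n) 0≮h

chain-zero : ∀ {nx h es} → Chain nx h es → length es ≡ 0 → ¬ 0 < h
chain-zero [] _ ()

only-one : ∀ {P : ℕ → Set} → P 1 → ∀ {c} → 1 ≤ c → c < 2 → P c
only-one p {suc zero}    _ _              = p
only-one p {suc (suc _)} _ (s≤s (s≤s ()))

-- The loops of the breadth-first construction

module TrieLoops {n σ : ℕ} (T : Tree n σ) where

  open TrieStage T public

  record ArcInv (adj : Fin n → List ℕ) (t c₀ p : ℕ) (ps qs : List ℕ) (done : List (Fin n × Fin n))
                (v x : Fin n) (τ k : ℕ) (s : St) : Set where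
    field
      common   : BaseOf adj s
      wd       : ℕ → Word σ
      core     : Core (arrs s) (regsᴴ s rE) (regsᴴ s rC) t c₀ p ps qs (λ v′ x′ → v′ ≡ v × x′ ≡ x) done wd
      filled   : Full (arrs s) (regsᴴ s rE) (regsᴴ s rC)
      vx-class : cls (arrs s) v x ≡ t
      t≡       : regsᴴ s rT ≡ t
      c₀≡      : regsᴴ s rC₀ ≡ c₀
      v≡       : regsᴴ s rV ≡ toℕ v
      p≡       : regsᴴ s rP ≡ p
      es       : List ℕ
      arcChain : Chain (arrs s aNext) (regsᴴ s rArc) es
      es⊆adj   : ∀ {e} → e ∈ es → e ∈ adj x
      length≡  : length es ≡ k
      todo     : ∀ {y a} → G ⊢ x —[ a ]— y → cls (arrs s) v y ≢ 0 ⊎ (∃[ e ] e ∈ es × arrs s aTarget e ≡ toℕ y)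
      ticks≤   : ticks s + k ≤ τ

  module _ {adj : Fin n → List ℕ} {t c₀ p : ℕ} {ps qs : List ℕ} {done : List (Fin n × Fin n)} {v x : Fin n} {τ : ℕ} where

    arcStep-correct : ∀ k s → ArcInv adj t c₀ p ps qs done v x τ (suc k) s → 0 < regsᴴ s rArc →
                      wp arcStep (ArcInv adj t c₀ p ps qs done v x τ k) (tick s)
    arcStep-correct k s inv _ with chain-uncons (ArcInv.arcChain inv) (ArcInv.length≡ inv)
    ... | es′ , refl , _ , chain′ , length′ with Adj.sound (Base.arcs (ArcInv.common inv)) x (ArcInv.es⊆adj inv (here refl))
    ... | y , a , xy , te , re =
      e<N , e<N , k<N , k<N , already , λ 0≮ → WP-mono advance (visit-correct (pre 0≮) filled)
      where
      open ArcInv inv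
      e = regsᴴ s rArc
      e<N : e < N
      e<N = arc< (arc≤ (Base.arcs common) (es⊆adj (here refl)))
      k≡ : regsᴴ s rN * regsᴴ s rV + arrs s aTarget e ≡ pr v y
      k≡ = cong₂ _+_ (cong₂ _*_ (Base.n≡ common) v≡) te
      k<N : regsᴴ s rN * regsᴴ s rV + arrs s aTarget e < N
      k<N = near (subst (_≤ 4 + n * n) (sym k≡) (≤-trans (<⇒≤ (pr< v y)) (m≤n+m _ 4)))
      ticks′ : suc (ticks s) + k ≤ τ
      ticks′ = ≤-trans (≤-reflexive (sym (+-suc (ticks s) k))) ticks≤
      todo′ : ∀ {α : Arrays} → cls α v y ≢ 0 → (∀ {v x} → cls (arrs s) v x ≢ 0 → cls α v x ≢ 0) →
              α aTarget ≡ arrs s aTarget →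
              ∀ {z b} → G ⊢ x —[ b ]— z → cls α v z ≢ 0 ⊎ (∃[ e′ ] e′ ∈ es′ × α aTarget e′ ≡ toℕ z)
      todo′ vis per tg≡ xz with todo xz
      ... | inj₁ ne = inj₁ (per ne)
      ... | inj₂ (e′ , there i , te′) = inj₂ (e′ , i , trans (cong (λ f → f e′) tg≡) te′)
      ... | inj₂ (e′ , here refl , te′) with toℕ-injective (trans (sym te′) te)
      ...   | refl = inj₁ vis
      κ : ℕ
      κ = regsᴴ s rN * regsᴴ s rV + arrs s aTarget e
      s₁ : St
      s₁ = setᴿ rQ (arrs s pClass κ) (setᴿ rK κ (setᴿ rR (arrs s aRank e) (setᴿ rY (arrs s aTarget e) (tick s))))
      already : 0 < arrs s pClass κ → wp (ld rArc aNext (var rArc)) (ArcInv adj t c₀ p ps qs done v x τ k) s₁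
      already 0<cl = e<N , record
        { common = common ; wd = wd ; core = core ; filled = filled ; vx-class = vx-class
        ; t≡ = t≡ ; c₀≡ = c₀≡ ; v≡ = v≡ ; p≡ = p≡
        ; es = es′ ; arcChain = chain′ ; es⊆adj = es⊆adj ∘ there ; length≡ = length′
        ; todo = todo′ {arrs s} (λ e₀ → <⇒≢ 0<cl (sym (trans (cong (arrs s pClass) k≡) e₀))) (λ ne → ne) refl
        ; ticks≤ = ticks′ }
      pre : ¬ 0 < arrs s pClass (regsᴴ s rN * regsᴴ s rV + arrs s aTarget e) →
            Pre adj t c₀ p ps qs (λ v′ x′ → v′ ≡ v × x′ ≡ x) done wd v x y a s₁
      pre 0≮ = record
        { common = common ; core = core ; arc = xy ; v≡ = v≡ ; y≡ = te ; r≡ = re ; k≡ = k≡ ; t≡ = t≡ ; c₀≡ = c₀≡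
        ; vx-class = vx-class ; vy-new = trans (cong (arrs s pClass) (sym k≡)) (n≤0⇒n≡0 (≮⇒≥ 0≮)) }
      advance : ∀ s′ → Post adj t c₀ p ps qs (λ v′ x′ → v′ ≡ v × x′ ≡ x) done v x y s₁ s′ →
                wp (ld rArc aNext (var rArc)) (ArcInv adj t c₀ p ps qs done v x τ k) s′
      advance s′ post = subst (_< N) (sym (Post.arc≡ post)) e<N , record
        { common = Post.common post ; wd = Post.wd post ; core = Post.core post ; filled = Post.filled post
        ; vx-class = Post.vx-class post ; t≡ = Post.t≡ post ; c₀≡ = Post.c₀≡ post ; v≡ = Post.v≡ post
        ; p≡ = trans (Post.p≡ post) p≡
        ; es = es′
        ; arcChain = subst₂ (λ nx h → Chain nx (nx h) es′) (sym (Post.next≡ post)) (sym (Post.arc≡ post)) chain′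
        ; es⊆adj = es⊆adj ∘ there ; length≡ = length′
        ; todo = todo′ {arrs s′} (Post.visited post) (Post.persist post) (Post.target≡ post)
        ; ticks≤ = subst (λ τ′ → τ′ + k ≤ τ) (sym (Post.ticks≡ post)) ticks′ }

  -- One tick for the entry itself and one for each arc leaving `x`.
  weight : (Fin n → List ℕ) → Fin n × Fin n → ℕ
  weight adj (v , x) = suc (length (adj x))

  -- `done` lists the pairs handled so far, over all classes, and exists only in the proof. Being
  -- free of repetitions, its weights are bounded by the sum over all pairs, however the pairs are
  -- distributed among the classes.
  record EntInv (adj : Fin n → List ℕ) (t c₀ τ k : ℕ) (s : St) : Set where
    field
      common  : BaseOf adj s
      wd      : ℕ → Word σ
      qs      : List ℕ
      done    : List (Fin n × Fin n)
      core    : Core (arrs s) (regsᴴ s rE) (regsᴴ s rC) t c₀ (regsᴴ s rP) qs qs (λ _ _ → ⊥) done wd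
      filled  : Full (arrs s) (regsᴴ s rE) (regsᴴ s rC)
      t≡      : regsᴴ s rT ≡ t
      c₀≡     : regsᴴ s rC₀ ≡ c₀
      length≡ : length qs ≡ k
      ticks≤  : ticks s ≤ τ + sum⟨ done ⟩ (weight adj)

  entry< : ∀ {α E C wd q} → EntriesOf α E C wd → q ≤ E → q < N
  entry< d q≤E = near (≤-trans q≤E (≤-trans (E≤nn d) (m≤n+m _ 4)))

  module _ {adj : Fin n → List ℕ} {t c₀ τ : ℕ} where

    entryStep-correct : ∀ k s → EntInv adj t c₀ τ (suc k) s → 0 < regsᴴ s rP →
                        wp entryStep (EntInv adj t c₀ τ k) (tick s)
    entryStep-correct k s inv 0<p with chain-uncons (Core.chained (EntInv.core inv)) (EntInv.length≡ inv)
    ... | qs′ , refl , next< , chain′ , length′ with Core.unprocessed (EntInv.core inv) (here refl)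
    ... | v , x , at-p , vx-class =
      p<N , p<N , vertex< x (to≡ at-p) ,
      WP-mono finish (while-rule Arcs arcStep-correct stopJ (length (adj x)) s₁ arcs₀)
      where
      open EntInv inv
      open Core core
      p = regsᴴ s rP
      α = arrs s
      p<N : p < N
      p<N = entry< {α} entries p≤E
      done′ = (v , x) ∷ done
      Arcs : ℕ → St → Set
      Arcs = ArcInv adj t c₀ p (p ∷ qs′) qs′ done′ v x (τ + sum⟨ done′ ⟩ (weight adj))
      s₁ : St
      s₁ = setᴿ rArc (α aHead (α eTo p)) (setᴿ rX (α eTo p) (setᴿ rV (α eFrom p) (tick s)))
      stopJ : ∀ s′ → Arcs 0 s′ → ¬ 0 < regsᴴ s′ rArc
      stopJ s′ j = chain-zero (ArcInv.arcChain j) (ArcInv.length≡ j)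
      frontier′ : ∀ {v′ x′} → cls α v′ x′ ≡ t →
                  Closed α v′ x′ ⊎ ((∃[ q ] q ∈ qs′ × AtOf α q v′ x′) ⊎ (v′ ≡ v × x′ ≡ x))
      frontier′ e with frontier e
      ... | inj₁ cl = inj₁ cl
      ... | inj₂ (inj₁ (_ , here refl , a)) = inj₂ (inj₂ (At-functional a at-p))
      ... | inj₂ (inj₁ (q , there i , a))   = inj₂ (inj₁ (q , i , a))
      new : (v , x) ∉ done
      new i with done-ok i
      ... | _ , inj₁ <t       = <-irrefl vx-class <t
      ... | _ , inj₂ (_ , ¬at) = ¬at (here refl) at-p
      done-ok′ : ∀ {v′ x′} → (v′ , x′) ∈ done′ →
                 cls α v′ x′ ≢ 0 × (cls α v′ x′ < t ⊎ (cls α v′ x′ ≡ t × (∀ {q} → q ∈ qs′ → ¬ AtOf α q v′ x′)))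
      done-ok′ (here refl) = (λ e → <⇒≢ (Classes.1≤t classes) (sym (trans (sym vx-class) e))) ,
        -- The entries after `p` in the list are strictly smaller than `p`, and distinct entries
        -- denote distinct pairs, so `(v , x)` does not return in `qs′`.
        inj₂ (vx-class , λ {q} i a → <-irrefl
          (entry-inj (chain-positive chain′ i) (≤-trans (≤-trans (chain-≤ chain′ i) (<⇒≤ next<)) p≤E) 0<p p≤E a at-p)
          (≤-<-trans (chain-≤ chain′ i) next<))
        where open Entries entries
      done-ok′ (there i) with done-ok i
      ... | ne , inj₁ <t = ne , inj₁ <t
      ... | ne , inj₂ (e , ¬at) = ne , inj₂ (e , λ j → ¬at (there j))
      arcs₀ : Arcs (length (adj x)) s₁
      arcs₀ = record
        { common = common ; wd = wd ; filled = filled ; vx-class = vx-class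
        ; t≡ = t≡ ; c₀≡ = c₀≡ ; v≡ = from≡ at-p ; p≡ = refl
        ; core = record
            { entries = entries ; classes = classes ; t<c₀ = t<c₀ ; trivial = trivial ; chained = chained ; p≤E = p≤E
            ; qs⊆ps = there ; closed = closed ; frontier = frontier′ ; unprocessed = unprocessed ∘ there
            ; done-unique = Unique-∷ new done-unique ; done-ok = done-ok′ }
        ; es = adj x
        ; arcChain = subst (λ z → Chain (α aNext) (α aHead z) (adj x)) (sym (to≡ at-p)) (Adj.chain (Base.arcs common) x)
        ; es⊆adj = λ i → i ; length≡ = refl
        ; todo = λ xy → inj₂ (Base.reach common xy)
        ; ticks≤ = ≤-trans (s≤s (+-monoˡ-≤ (length (adj x)) ticks≤)) (≤-reflexive (rearrange τ (sum⟨ done ⟩ (weight adj)) (length (adj x))))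
        }
        where
        rearrange : ∀ a b c → suc (a + b + c) ≡ a + (suc c + b)
        rearrange = solve 3 (λ a b c → con 1 :+ (a :+ b :+ c) := a :+ ((con 1 :+ c) :+ b)) refl
      finish : ∀ s′ → ∃[ k′ ] Arcs k′ s′ × ¬ 0 < regsᴴ s′ rArc → wp (ld rP eNext (var rP)) (EntInv adj t c₀ τ k) s′
      finish s′ (k′ , j , 0≮) = subst (_< N) (sym (ArcInv.p≡ j)) (entry< {arrs s′} (Core.entries c′) (Core.p≤E c′)) , record
        { common = ArcInv.common j ; wd = ArcInv.wd j ; qs = qs′ ; done = done′
        ; core = record
            { entries = Core.entries c′ ; classes = Core.classes c′ ; t<c₀ = t<c₀ ; trivial = Core.trivial c′
            ; chained = subst (λ z → Chain _ (arrs s′ eNext z) qs′) (sym (ArcInv.p≡ j)) (proj₁ tail)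
            ; p≤E = subst (λ z → arrs s′ eNext z ≤ _) (sym (ArcInv.p≡ j)) (proj₂ tail)
            ; qs⊆ps = λ i → i ; closed = Core.closed c′ ; frontier = frontier″ ; unprocessed = Core.unprocessed c′
            ; done-unique = Core.done-unique c′ ; done-ok = Core.done-ok c′ }
        ; filled = ArcInv.filled j ; t≡ = ArcInv.t≡ j ; c₀≡ = ArcInv.c₀≡ j ; length≡ = length′
        ; ticks≤ = ≤-trans (m≤m+n _ k′) (ArcInv.ticks≤ j) }
        where
        c′ = ArcInv.core j
        tail : Chain (arrs s′ eNext) (arrs s′ eNext p) qs′ × arrs s′ eNext p ≤ regsᴴ s′ rE
        tail with chain-uncons (Core.chained c′) refl
        ... | _ , refl , n< , ch , _ = ch , ≤-trans (<⇒≤ n<) (Core.p≤E c′)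
        finished : Closed (arrs s′) v x
        finished xy with ArcInv.todo j xy
        ... | inj₁ ne = ne
        ... | inj₂ (e , i , _) with subst (e ∈_) (chain-end (ArcInv.arcChain j) 0≮) i
        ...   | ()
        frontier″ : ∀ {v′ x′} → cls (arrs s′) v′ x′ ≡ t →
                    Closed (arrs s′) v′ x′ ⊎ ((∃[ q ] q ∈ qs′ × AtOf (arrs s′) q v′ x′) ⊎ ⊥)
        frontier″ e with Core.frontier c′ e
        ... | inj₁ cl = inj₁ cl
        ... | inj₂ (inj₁ a) = inj₂ (inj₁ a)
        ... | inj₂ (inj₂ (refl , refl)) = inj₁ finished

  -- The final number of classes is unknown while `C` grows, so the iterations are counted down from
  -- `2 + n * n`, which exceeds every possible `C`.
  record Outer (adj : Fin n → List ℕ) (T₀ k : ℕ) (s : St) : Set where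
    field
      t       : ℕ
      t+k     : t + k ≡ 2 + n * n
      common  : BaseOf adj s
      wd      : ℕ → Word σ
      done    : List (Fin n × Fin n)
      entries : EntriesOf (arrs s) (regsᴴ s rE) (regsᴴ s rC) wd
      classes : ClassesOf (arrs s) (regsᴴ s rC) t (regsᴴ s rC) wd
      t≤C     : t ≤ regsᴴ s rC
      trivial : ∀ v → cls (arrs s) v v ≢ 0
      filled  : Full (arrs s) (regsᴴ s rE) (regsᴴ s rC)
      closed  : ∀ {v x} → cls (arrs s) v x ≢ 0 → cls (arrs s) v x < t → Closed (arrs s) v x
      done-unique : Unique done
      done-ok : ∀ {v x} → (v , x) ∈ done → cls (arrs s) v x ≢ 0 × cls (arrs s) v x < t
      t≡      : regsᴴ s rT ≡ t
      ticks≤  : ticks s ≤ T₀ + t + sum⟨ done ⟩ (weight adj)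

  C≤nn : ∀ {α E C wd} → EntriesOf α E C wd → Full α E C → C ≤ suc (n * n)
  C≤nn d f = ≤-trans (Full.C≤ f) (s≤s (E≤nn d))

  class<N : ∀ {α E C wd c} → EntriesOf α E C wd → Full α E C → c ≤ C → c < N
  class<N d f c≤ = near (≤-trans c≤ (≤-trans (C≤nn d f) (s≤s (m≤n+m _ 3))))

  module _ {adj : Fin n → List ℕ} {T₀ : ℕ} where

    classStep-correct : ∀ k s → Outer adj T₀ (suc k) s → regsᴴ s rT < regsᴴ s rC →
                        wp classStep (Outer adj T₀ k) (tick s)
    classStep-correct k s inv rT<C with Entries.member (Outer.entries inv) {Outer.t inv}
      (Classes.1≤t (Outer.classes inv)) (subst (_< regsᴴ s rC) (Outer.t≡ inv) rT<C)
    ... | members ps chain₀ sound₀ complete₀ =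
      C<N , <-trans rT<C C<N ,
      WP-mono finish (while-rule Ents entryStep-correct stopJ (length ps) s₁ ents₀)
      where
      open Outer inv
      C = regsᴴ s rC
      α = arrs s
      C<N : C < N
      C<N = class<N entries filled ≤-refl
      t<C : t < C
      t<C = subst (_< C) t≡ rT<C
      Ents : ℕ → St → Set
      Ents = EntInv adj t C (suc (T₀ + t))
      s₁ : St
      s₁ = setᴿ rP (α cHead (regsᴴ s rT)) (setᴿ rC₀ C (tick s))
      stopJ : ∀ s′ → Ents 0 s′ → ¬ 0 < regsᴴ s′ rP
      stopJ s′ j = chain-zero (Core.chained (EntInv.core j)) (EntInv.length≡ j)
      ents₀ : Ents (length ps) s₁
      ents₀ = record
        { common = common ; wd = wd ; qs = ps ; done = done
        ; core = record
            { entries = entries ; classes = classes ; t<c₀ = t<C ; trivial = trivial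
            ; chained = subst (λ z → Chain (α eNext) (α cHead z) ps) (sym t≡) chain₀
            ; p≤E = subst (λ z → α cHead z ≤ _) (sym t≡) (Entries.head≤ entries (Classes.1≤t classes) t<C)
            ; qs⊆ps = λ i → i ; closed = closed
            ; frontier = λ {v} {x} e → inj₂ (inj₁ (complete₀ v x e))
            ; unprocessed = sound₀
            ; done-unique = done-unique
            ; done-ok = λ i → proj₁ (done-ok i) , inj₁ (proj₂ (done-ok i)) }
        ; filled = filled ; t≡ = t≡ ; c₀≡ = refl ; length≡ = refl ; ticks≤ = s≤s ticks≤ }
      finish : ∀ s′ → ∃[ k′ ] Ents k′ s′ × ¬ 0 < regsᴴ s′ rP →
               wp (inc rT ⨾ st cFirst (var rT) (var rC)) (Outer adj T₀ k) s′
      finish s′ (k′ , j , 0≮) = sT<N , sT<N , record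
        { t = suc t ; t+k = trans (sym (+-suc t k)) t+k ; common = EntInv.common j ; wd = EntInv.wd j ; done = EntInv.done j
        ; entries = Core.entries c′
        ; classes = subst (λ z → Classes _ _ _ (put (suc z) C′ (arrs s′ cFirst)) _ C′ (suc t) C′ (EntInv.wd j)) (sym (EntInv.t≡ j))
                      (next-class (Core.classes c′) t<C′)
        ; t≤C = t<C′ ; trivial = Core.trivial c′
        ; filled = full (λ {c} → Full.nonEmpty (EntInv.filled j) {c}) (Full.C≤ (EntInv.filled j))
        ; closed = closed′ ; done-unique = Core.done-unique c′ ; done-ok = done-ok′
        ; t≡ = cong suc (EntInv.t≡ j)
        ; ticks≤ = subst (λ z → ticks s′ ≤ z + sum⟨ EntInv.done j ⟩ (weight adj)) (sym (+-suc T₀ t)) (EntInv.ticks≤ j) }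
        where
        c′ = EntInv.core j
        C′ = regsᴴ s′ rC
        t<C′ : t < C′
        t<C′ = <-≤-trans (Core.t<c₀ c′) (Classes.c₀≤C (Core.classes c′))
        sT<N : suc (regsᴴ s′ rT) < N
        sT<N = class<N (Core.entries c′) (EntInv.filled j) (subst (_< C′) (sym (EntInv.t≡ j)) t<C′)
        qs≡[] : EntInv.qs j ≡ []
        qs≡[] = chain-end (Core.chained c′) 0≮
        closed′ : ∀ {v x} → cls (arrs s′) v x ≢ 0 → cls (arrs s′) v x < suc t → Closed (arrs s′) v x
        closed′ ne <st with m≤n⇒m<n∨m≡n (≤-pred <st)
        ... | inj₁ <t = Core.closed c′ ne <t
        ... | inj₂ ≡t with Core.frontier c′ ≡t
        ...   | inj₁ cl = cl
        ...   | inj₂ (inj₁ (q , i , _)) with subst (q ∈_) qs≡[] i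
        ...     | ()
        done-ok′ : ∀ {v x} → (v , x) ∈ EntInv.done j → cls (arrs s′) v x ≢ 0 × cls (arrs s′) v x < suc t
        done-ok′ i with Core.done-ok c′ i
        ... | ne , inj₁ <t       = ne , m≤n⇒m≤1+n <t
        ... | ne , inj₂ (e , _) = ne , s≤s (≤-reflexive e)

  T₁ T₀ : ℕ
  T₁ = m * suc m
  T₀ = T₁ + n

  record InitInv (adj : Fin n → List ℕ) (k : ℕ) (s : St) : Set where
    field
      i        : ℕ
      i+k      : i + k ≡ n
      common   : BaseOf adj s
      E≡       : regsᴴ s rE ≡ i
      x≡       : regsᴴ s rX ≡ i
      cl≡      : regsᴴ s rCl ≡ 1
      entries  : EntriesOf (arrs s) (regsᴴ s rE) 2 (λ _ → [])
      trivial  : ∀ v → toℕ v < i → cls (arrs s) v v ≢ 0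
      unvisited : ∀ v → i ≤ toℕ v → cls (arrs s) v v ≡ 0
      head1    : 1 ≤ i → 1 ≤ arrs s cHead 1
      child0   : ∀ r → arrs s lChild r ≡ 0
      ticks≤   : ticks s ≤ T₁ + i

  initEntry-correct : ∀ {adj} k s → InitInv adj (suc k) s → regsᴴ s rX < regsᴴ s rN →
                      wp initEntry (InitInv adj k) (tick s)
  initEntry-correct {adj} k s inv _ =
    sE<N , sE<N , sE<N , k<N , c<N , sE<N , c<N , k<N , sX<N , record
      { i = suc i ; i+k = trans (sym (+-suc i k)) i+k ; common = common
      ; E≡ = cong suc E≡ ; x≡ = cong suc x≡ ; cl≡ = cl≡
      ; entries = entries′
      ; trivial = trivial′ ; unvisited = unvisited′
      ; head1 = λ _ → head1′ ; child0 = child0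
      ; ticks≤ = ≤-trans (s≤s ticks≤) (≤-reflexive (sym (+-suc T₁ i))) }
    where
    open InitInv inv
    E = regsᴴ s rE
    c = regsᴴ s rCl
    i<n : i < n
    i<n = subst (i <_) i+k (m<m+n i (s≤s z≤n))
    v : Fin n
    v = fromℕ< i<n
    v≡i : toℕ v ≡ i
    v≡i = toℕ-fromℕ< i<n
    v≡ : regsᴴ s rX ≡ toℕ v
    v≡ = trans x≡ (sym v≡i)
    κ : ℕ
    κ = regsᴴ s rN * regsᴴ s rX + regsᴴ s rX
    k≡ : κ ≡ pr v v
    k≡ = cong₂ _+_ (cong₂ _*_ (Base.n≡ common) v≡) v≡
    1≤c : 1 ≤ c
    1≤c = ≤-reflexive (sym cl≡)
    c<2 : c < 2
    c<2 = s≤s (≤-reflexive cl≡)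
    sE<N : suc E < N
    sE<N = small (≤-trans (subst (_< n) (sym E≡) i<n) (m≤n*m n 7))
    sX<N : suc (regsᴴ s rX) < N
    sX<N = small (≤-trans (subst (_< n) (sym x≡) i<n) (m≤n*m n 7))
    c<N : c < N
    c<N = near (≤-trans (<⇒≤ c<2) (≤-trans (s≤s (s≤s z≤n)) (m≤m+n 4 _)))
    k<N : κ < N
    k<N = near (subst (_≤ 4 + n * n) (sym k≡) (≤-trans (<⇒≤ (pr< v v)) (m≤n+m _ 4)))
    only : ∀ {z} → z ∈ [ v ] → z ≡ v
    only (here refl) = refl
    entries′ : Entries (put (suc E) (regsᴴ s rX) (arrs s eFrom)) (put (suc E) (regsᴴ s rX) (arrs s eTo))
                 (put (suc E) (arrs s cHead c) (arrs s eNext)) (put c (suc E) (arrs s cHead)) (put κ c (arrs s pClass))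
                 (suc E) 2 (λ _ → [])
    entries′ = push-entry entries v≡ v≡ k≡ 1≤c c<2 (sym (W-refl v)) (unvisited v (≤-reflexive (sym v≡i)))
                 (λ {z} i → inj₁ (only (subst (z ∈_) (Vs-refl v) i)))
    diagonal : ∀ {u} → pr u u ≡ pr v v → u ≡ v
    diagonal {u} e = proj₁ (pr-injective {u} {u} {v} {v} e)
    trivial′ : ∀ u → toℕ u < suc i → put κ c (arrs s pClass) (pr u u) ≢ 0
    trivial′ u u≤i with pr u u ≟ κ
    ... | yes _ = λ c≡0 → <⇒≢ 1≤c (sym c≡0)
    ... | no u≢ = trivial u (≤∧≢⇒< (≤-pred u≤i) λ e → u≢ (trans (cong (λ z → pr z z) (toℕ-injective (trans e (sym v≡i)))) (sym k≡)))
    unvisited′ : ∀ u → suc i ≤ toℕ u → put κ c (arrs s pClass) (pr u u) ≡ 0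
    unvisited′ u i<u with pr u u ≟ κ
    ... | yes e = contradiction (trans (sym v≡i) (cong toℕ (sym (diagonal (trans e k≡))))) (<⇒≢ i<u)
    ... | no _ = unvisited u (<⇒≤ i<u)
    head1′ : 1 ≤ put c (suc E) (arrs s cHead) 1
    head1′ = subst (λ z → 1 ≤ put z (suc E) (arrs s cHead) 1) (sym cl≡) (subst (1 ≤_) (sym (put-same 1 (suc E) (arrs s cHead))) (s≤s z≤n))

  record Trie (s : St) : Set where
    field
      adj      : Fin n → List ℕ
      common   : BaseOf adj s
      wd       : ℕ → Word σ
      entries  : EntriesOf (arrs s) (regsᴴ s rE) (regsᴴ s rC) wd
      classes  : ClassesOf (arrs s) (regsᴴ s rC) (regsᴴ s rC) (regsᴴ s rC) wd
      filled   : Full (arrs s) (regsᴴ s rE) (regsᴴ s rC)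
      visited  : ∀ v x → cls (arrs s) v x ≢ 0
      ticks≤   : ticks s ≤ T₀ + suc (n * n) + n * (n + 2 * m)

  total-weight : ∀ {hd nx tg rk adj done} → Adj hd nx tg rk (2 * m) adj → Unique done →
                 sum⟨ done ⟩ (weight adj) ≤ n * (n + 2 * m)
  total-weight {adj = adj} {done} d u = begin
    sum⟨ done ⟩ (weight adj)                                      ≤⟨ Σ-⊆ {ys = cartesianProduct (allFin n) (allFin n)} (weight adj) u
                                                                    (λ {p} _ → ∈-cartesianProduct⁺ (∈-allFin (proj₁ p)) (∈-allFin (proj₂ p))) ⟩
    sum⟨ cartesianProduct (allFin n) (allFin n) ⟩ (weight adj)    ≡⟨ Σ-product (allFin n) (allFin n) (λ x → suc (length (adj x))) ⟩
    length (allFin n) * sum⟨ allFin n ⟩ (λ x → suc (length (adj x)))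
      ≡⟨ cong₂ _*_ n≡ (trans (Σ-suc (allFin n)) (cong (_+ sum⟨ allFin n ⟩ (λ x → length (adj x))) n≡)) ⟩
    n * (n + sum⟨ allFin n ⟩ (λ x → length (adj x)))              ≤⟨ *-monoʳ-≤ n (+-monoʳ-≤ n (Adj.total d)) ⟩
    n * (n + 2 * m)                                             ∎
    where
    open ≤-Reasoning
    n≡ : length (allFin n) ≡ n
    n≡ = length-tabulate (λ (i : Fin n) → i)
    Σ-suc : ∀ xs → sum⟨ xs ⟩ (λ x → suc (length (adj x))) ≡ length xs + sum⟨ xs ⟩ (λ x → length (adj x))
    Σ-suc [] = refl
    Σ-suc (x ∷ xs) = cong suc (trans (cong (length (adj x) +_) (Σ-suc xs)) (x∙yz≈y∙xz (length (adj x)) (length xs) _))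

  -- For fixed `v` the visited vertices include `v` and are closed under adjacency; along the walks
  -- given by connectedness they comprise all vertices. Simplicity of the walk is of no concern
  -- here, since visiting is a statement about pairs.
  walk-visited : ∀ {α v} → (∀ {x} → cls α v x ≢ 0 → Closed α v x) → ∀ {x y vs w} → Walk G x y vs w → cls α v x ≢ 0 → cls α v y ≢ 0
  walk-visited cl stop       ne = ne
  walk-visited {α} {v} cl (step {v = z} e w) ne = walk-visited {α} {v} (λ {x} → cl {x}) w (cl ne e)

  buildTrie-correct : ∀ s → InvA m s → WP buildTrie Trie s
  buildTrie-correct s inv = run buildTrie
    (small z≤n , small z≤n , small (const≤′ 1 (s≤s z≤n)) , small (const≤′ 1 (s≤s z≤n)) ,
     WP-mono middle (while-rule (InitInv adj) initEntry-correct stopInit n _ init₀))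
    where
    open InvA inv
    const≤′ : ∀ k → k ≤ 7 → k ≤ 7 * n
    const≤′ k k≤7 = ≤-trans k≤7 (const≤ 7)
    c≤ : ∀ k → k < 8 → k < N
    c≤ k (s≤s k≤7) = small (const≤′ k k≤7)
    reach-edge : ∀ {x y a} → (x , y , a) ∈ G → Reach (arrs s aTarget) adj x y × Reach (arrs s aTarget) adj y x
    reach-edge i = subst (λ (u , v , _) → Reach (arrs s aTarget) adj u v × Reach (arrs s aTarget) adj v u)
                     (sym (lookup-index i)) (reach (Any.index i) (toℕ<n (Any.index i)))
    base₀ : BaseOf adj s
    base₀ = record
      { n≡ = n≡ ; arcs = subst (λ A → Adj _ _ _ _ A adj) A≡ isAdj
      ; reach = λ where
          (inj₁ i) → proj₁ (reach-edge i)
          (inj₂ i) → proj₂ (reach-edge i)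
      ; mark0 = lMark-0 clear ; out[] = out-[] clear }
    init₀ : InitInv adj n _
    init₀ = record
      { i = 0 ; i+k = refl ; common = base₀ ; E≡ = refl ; x≡ = refl ; cl≡ = refl
      ; entries = record
          { entry = λ 1≤q q≤0 → contradiction (≤-trans 1≤q q≤0) λ ()
          ; entry-inj = λ 1≤q q≤0 → contradiction (≤-trans 1≤q q≤0) λ ()
          ; member = λ 1≤c c<2 → only-one
              {λ c → Members (arrs s eFrom) (arrs s eTo) (arrs s eNext) (arrs s pClass) c (put 1 0 (arrs s cHead) c)}
              (members [] [] (λ ()) λ v x e → contradiction (trans (sym (pClass-0 clear (pr v x))) e) λ ()) 1≤c c<2
          ; head≤ = λ 1≤c c<2 → only-one {λ c → put 1 0 (arrs s cHead) c ≤ 0} z≤n 1≤c c<2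
          ; class< = λ {v} {x} ne → contradiction (pClass-0 clear (pr v x)) ne
          ; class-word = λ {v} {x} ne → contradiction (pClass-0 clear (pr v x)) ne
          ; prefix = λ {v} {x} ne → contradiction (pClass-0 clear (pr v x)) ne }
      ; trivial = λ _ () ; unvisited = λ v _ → pClass-0 clear (pr v v)
      ; head1 = λ () ; child0 = lChild-0 clear
      ; ticks≤ = ≤-trans ticks≤ (m≤m+n _ 0) }
    stopInit : ∀ s′ → InitInv adj 0 s′ → ¬ regsᴴ s′ rX < regsᴴ s′ rN
    stopInit s′ j x<n = <-irrefl (trans (InitInv.x≡ j) (trans (trans (sym (+-identityʳ _)) (InitInv.i+k j))
                                  (sym (Base.n≡ (InitInv.common j))))) x<n
    stopOuter : ∀ s′ → Outer adj T₀ 0 s′ → ¬ regsᴴ s′ rT < regsᴴ s′ rC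
    stopOuter s′ j t<C = <⇒≱ (subst (_< regsᴴ s′ rC) (trans (Outer.t≡ j) (trans (sym (+-identityʳ _)) (Outer.t+k j))) t<C)
                           (m≤n⇒m≤1+n (C≤nn {arrs s′} (Outer.entries j) (Outer.filled j)))
    final : ∀ s′ → ∃[ k′ ] Outer adj T₀ k′ s′ × ¬ regsᴴ s′ rT < regsᴴ s′ rC → Trie s′
    final s′ (k′ , j , t≮C) = record
      { adj = adj ; common = common ; wd = wd ; entries = entries
      ; classes = subst (λ z → ClassesOf (arrs s′) C′ z C′ wd) t≡C classes
      ; filled = filled
      ; visited = λ v x → walk-visited {arrs s′} {v}
          (λ ne → closed ne (subst (cls (arrs s′) v _ <_) (sym t≡C) (Entries.class< entries ne)))
          (proj₂ (proj₂ (connected v x))) (Outer.trivial j v)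
      ; ticks≤ = ≤-trans ticks≤′ (+-mono-≤ (+-monoʳ-≤ T₀ (subst (_≤ suc (n * n)) (sym t≡C) (C≤nn {arrs s′} entries filled)))
                                           (total-weight (Base.arcs common) done-unique)) }
      where
      open Outer j renaming (ticks≤ to ticks≤′)
      C′ = regsᴴ s′ rC
      t≡C : t ≡ C′
      t≡C = ≤-antisym t≤C (subst (C′ ≤_) t≡ (≮⇒≥ t≮C))
    middle : ∀ s′ → ∃[ k′ ] InitInv adj k′ s′ × ¬ regsᴴ s′ rX < regsᴴ s′ rN →
      wp (rC ≔ #2 ⨾ rT ≔ #1 ⨾ st cFirst #1 #2 ⨾ st cLength #1 #0 ⨾ whileLt (var rT) (var rC) classStep) Trie s′
    middle s′ (k′ , j , x≮n) =
      c≤ 2 (s≤s (s≤s (s≤s z≤n))) , c≤ 1 (s≤s (s≤s z≤n)) , c≤ 1 (s≤s (s≤s z≤n)) , c≤ 1 (s≤s (s≤s z≤n)) ,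
      WP-mono final (while-rule (Outer adj T₀) classStep-correct stopOuter (suc (n * n)) _ outer₀)
      where
      open InitInv j renaming (ticks≤ to ticks≤′; common to common′)
      i≡n : i ≡ n
      i≡n = ≤-antisym (m+n≤o⇒m≤o i (≤-reflexive i+k))
              (subst₂ _≤_ (Base.n≡ common′) x≡ (≮⇒≥ x≮n))
      1≤i : 1 ≤ i
      1≤i = subst (1 ≤_) (sym i≡n) nonempty
      trivial′ : ∀ v → cls (arrs s′) v v ≢ 0
      trivial′ v = trivial v (subst (toℕ v <_) (sym i≡n) (toℕ<n v))
      outer₀ : Outer adj T₀ (suc (n * n)) _
      outer₀ = record
        { t = 1 ; t+k = refl ; common = common′ ; wd = λ _ → [] ; done = [] ; entries = entries
        ; classes = record
            { 1≤t = ≤-refl ; 2≤c₀ = ≤-refl ; c₀≤C = ≤-refl ; wd-1 = refl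
            ; wd-inj = λ 1≤c c<2 1≤c′ c′<2 _ → ≤-antisym (≤-trans (≤-pred c<2) 1≤c′) (≤-trans (≤-pred c′<2) 1≤c)
            ; parent-ok = λ 2≤c c<2 → contradiction c<2 (≤⇒≯ 2≤c)
            ; len≡ = λ 1≤c c<2 → only-one {λ c → put 1 0 (arrs s′ cLength) c ≡ 0} refl 1≤c c<2
            ; first-t = refl
            ; first-mono = λ 1≤c c<1 → contradiction c<1 (≤⇒≯ 1≤c)
            ; current = λ 2≤c c<2 → contradiction c<2 (≤⇒≯ 2≤c)
            ; older = λ 2≤c c<2 → contradiction c<2 (≤⇒≯ 2≤c)
            ; interval = λ 1≤c c<1 → contradiction c<1 (≤⇒≯ 1≤c)
            ; child< = λ r → subst (_< 2) (sym (child0 r)) (s≤s z≤n)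
            ; child-back = λ {r} 2≤ → contradiction (subst (2 ≤_) (child0 r) 2≤) λ ()
            ; child-let = λ 2≤c c<2 → contradiction c<2 (≤⇒≯ 2≤c) }
        ; t≤C = s≤s z≤n ; trivial = trivial′
        ; filled = full (λ 1≤c c<2 → only-one {λ c → 1 ≤ arrs s′ cHead c} (head1 1≤i) 1≤c c<2)
            (s≤s (subst (1 ≤_) (sym E≡) 1≤i))
        ; closed = λ ne <1 → contradiction (n≤0⇒n≡0 (≤-pred <1)) ne
        ; done-unique = [] ; done-ok = λ () ; t≡ = refl
        ; ticks≤ = ≤-trans ticks≤′ (≤-trans (subst (λ z → T₁ + z ≤ T₀ + 1) (sym i≡n) (m≤m+n T₀ 1)) (m≤m+n _ 0)) }

-- Enumerating the minimal absent words

module Output {n σ : ℕ} (T : Tree n σ) where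

  open TrieLoops T public

  record Facts (wd : ℕ → Word σ) (letter parent len first child from to next head cl : ℕ → ℕ) (n′ E C : ℕ) : Set where
    field
      n≡       : n′ ≡ n
      entries  : Entries from to next head cl E C wd
      classes  : Classes letter parent len first child C C C wd
      nonEmpty : ∀ {c} → 1 ≤ c → c < C → 1 ≤ head c
      visited  : ∀ v x → cl (pr v x) ≢ 0
      C≤nn+1     : C ≤ suc (n * n)

  FactsOf : (ℕ → Word σ) → St → Set
  FactsOf wd s = Facts wd (arrs s cLetter) (arrs s cParent) (arrs s cLength) (arrs s cFirst) (arrs s lChild)
                   (arrs s eFrom) (arrs s eTo) (arrs s eNext) (arrs s cHead) (arrs s pClass)
                   (regsᴴ s rN) (regsᴴ s rE) (regsᴴ s rC)

  record ChildOf (letter first : ℕ → ℕ) (c r : ℕ) : Set where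
    constructor childOf
    field
      index   : ℕ
      first≤  : first c ≤ index
      <last   : index < first (suc c)
      letter≡ : letter index ≡ r

  module _ {wd : ℕ → Word σ} {letter parent len first child from to next head cl : ℕ → ℕ} {n′ E C : ℕ}
           (facts : Facts wd letter parent len first child from to next head cl n′ E C) where

    open Facts facts
    open Entries entries
    open Classes classes

    1≤class : ∀ v x → 1 ≤ cl (pr v x)
    1≤class v x = n≢0⇒n>0 (visited v x)

    bounded : ∀ {c} → c ≤ C → c < N
    bounded c≤ = near (≤-trans c≤ (≤-trans C≤nn+1 (s≤s (m≤n+m _ 3))))

    entry-bounded : ∀ {q} → q ≤ E → q < N
    entry-bounded q≤ = near (≤-trans q≤ (≤-trans (E≤nn entries) (m≤n+m _ 4)))

    representative : ∀ {c} → 1 ≤ c → c < C → ∃[ v ] ∃[ x ] At from to (head c) v x × cl (pr v x) ≡ c × W v x ≡ wd c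
    representative {c} 1≤c c<C with member 1≤c c<C | nonEmpty 1≤c c<C
    ... | members _ ch snd _ | 1≤h with head-∈ ch 1≤h
      where
      head-∈ : ∀ {nx h ps} → Chain nx h ps → 1 ≤ h → h ∈ ps
      head-∈ (_ ∷ _) _ = here refl
    ...   | i with snd i
    ...     | v , x , a , e = v , x , a , e , trans (sym (class-word (visited v x))) (cong wd e)

    class-in-L : ∀ {c} → 1 ≤ c → c < C → L T (wd c)
    class-in-L 1≤c c<C with representative 1≤c c<C
    ... | v , x , _ , _ , e = subst (L T) e (L-W v x)

    class-of : ∀ {w} → L T w → ∃[ c ] 1 ≤ c × c < C × wd c ≡ w
    class-of (u , v , sp) = cl (pr u v) , 1≤class u v , class< (visited u v) ,
      trans (class-word (visited u v)) (sym (path⇒W sp))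

    long-class : ∀ {c w a} → 1 ≤ c → wd c ≡ w ∷ʳ a → 2 ≤ c
    long-class {c} {w} 1≤c e = ≤∧≢⇒< 1≤c λ where refl → ∷ʳ≢[] w (trans (sym e) wd-1)

    child-sound : ∀ {c j} → 1 ≤ c → c < C → first c ≤ j → j < first (suc c) →
                  j < C × (∃[ b ] Occurs b × letter j ≡ rank b × wd j ≡ wd c ∷ʳ b × L T (wd c ∷ʳ b))
    child-sound {c} {j} 1≤c c<C ≤j j< with first-mono 1≤c c<C
    ... | 2≤f , _ , ≤C with parent-ok (≤-trans 2≤f ≤j) (<-≤-trans j< ≤C)
    ...   | _ , _ , b , occ , w≡ , l≡ = j<C , b , occ , l≡ , w≡′ ,
            subst (L T) w≡′ (class-in-L (≤-trans (s≤s z≤n) (≤-trans 2≤f ≤j)) j<C)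
      where
      j<C = <-≤-trans j< ≤C
      w≡′ : wd j ≡ wd c ∷ʳ b
      w≡′ = trans w≡ (cong (λ p → wd p ∷ʳ b) (interval 1≤c c<C ≤j j<))

    -- The class of `wd c ∷ʳ b` has a parent with the word `wd c`, which is `c` by injectivity, and
    -- `older` places it in the interval of `c`.
    child-complete : ∀ {c b} → 1 ≤ c → c < C → L T (wd c ∷ʳ b) → ChildOf letter first c (rank b) × Occurs b
    child-complete {c} {b} 1≤c c<C l with class-of l
    ... | j , 1≤j , j<C , w≡ with long-class {w = wd c} 1≤j w≡
    ...   | 2≤j with parent-ok 2≤j j<C | older 2≤j j<C
    ...     | 1≤p , p<C , b′ , occ , w≡′ , l≡ | _ , f≤ , <f with ∷ʳ-injective _ _ (trans (sym w≡′) w≡)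
    ...       | wp≡ , refl with wd-inj 1≤p p<C 1≤c c<C wp≡
    ...         | refl = childOf j f≤ <f l≡ , occ

    child-unique : ∀ {c j j′} → 1 ≤ c → c < C → first c ≤ j → j < first (suc c) → first c ≤ j′ → j′ < first (suc c) →
                   letter j ≡ letter j′ → j ≡ j′
    child-unique {c} 1≤c c<C ≤j j< ≤j′ j′< e with child-sound 1≤c c<C ≤j j< | child-sound 1≤c c<C ≤j′ j′< | first-mono 1≤c c<C
    ... | j<C , b , occ , l , w , _ | j′<C , b′ , occ′ , l′ , w′ , _ | 2≤f , _
      with rank-injective occ occ′ (trans (sym l) (trans e l′))
    ...   | refl = wd-inj (≤-trans (s≤s z≤n) (≤-trans 2≤f ≤j)) j<C (≤-trans (s≤s z≤n) (≤-trans 2≤f ≤j′)) j′<C (trans w (sym w′))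

  rank<N′ : ∀ {b z} → Occurs b → z ≡ rank b → z < N
  rank<N′ {b} occ refl = small (≤-trans (<⇒≤ (rank-< {b} occ)) (≤-trans edge-count (m≤n*m n 7)))

  letter-cell<N : ∀ {b z} → Occurs b → z ≡ rank b → 3 * z + 4 < N
  letter-cell<N {b} occ refl = affine 3 4 ≤-refl (m≤n′ (rank-< {b} occ))

  letter-cell<I : ∀ {b z} → Occurs b → z ≡ rank b → 3 * z + 4 < I
  letter-cell<I {b} occ refl = cell< 4 ≤-refl (rank-< {b} occ)

  -- maws lists the minimal absent words wd c ∷ʳ b with Done c b.
  record Listed (wd : ℕ → Word σ) (Done : ℕ → Fin σ → Set) (o : List ℕ) (maws : List (Word σ)) : Set where
    field
      reps     : List (Report n σ)
      encodes  : o ≡ encodeReports reps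
      denote   : AllDenote T reps maws
      unique   : Unique maws
      ok    : ∀ {x} → x ∈ maws → MAW T x × (∃[ c ] ∃[ b ] x ≡ wd c ∷ʳ b × Done c b)
      all : ∀ {c b} → Done c b → MAW T (wd c ∷ʳ b) → (wd c ∷ʳ b) ∈ maws

  -- The second hypothesis is restricted to minimal absent words, so that a scanned letter matched
  -- by a child of a u may count as done without a report.
  Listed-map : ∀ {wd Done Done′ o maws} → (∀ {c b} → Done c b → Done′ c b) →
               (∀ {c b} → Done′ c b → MAW T (wd c ∷ʳ b) → Done c b) →
               Listed wd Done o maws → Listed wd Done′ o maws
  Listed-map f g l = record
    { reps = reps ; encodes = encodes ; denote = denote ; unique = unique
    ; ok = λ i → let μ , c , b , e , d = ok i in μ , c , b , e , f d
    ; all = λ d μ → all (g d μ) μ }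
    where open Listed l

  encodeReport : Report n σ → List ℕ
  encodeReport (report a v r ℓ b) = toℕ a ∷ toℕ v ∷ toℕ r ∷ ℓ ∷ toℕ b ∷ []

  Listed-add : ∀ {wd Done Done′ o maws ρ c b} → (∀ {c b} → Done c b → Done′ c b) → Done′ c b →
               (∀ {c′ b′} → Done′ c′ b′ → Done c′ b′ ⊎ (c′ ≡ c × b′ ≡ b)) →
               (∀ {c′ b′} → Done c′ b′ → wd c′ ∷ʳ b′ ≢ wd c ∷ʳ b) →
               MAW T (wd c ∷ʳ b) → ρ Denotes (wd c ∷ʳ b) within T →
               Listed wd Done o maws → Listed wd Done′ (o ++ encodeReport ρ) (maws ∷ʳ (wd c ∷ʳ b))
  Listed-add {wd} {Done} {Done′} {o} {maws} {ρ} {c} {b} f new split fresh μ den l = record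
    { reps = reps ∷ʳ ρ
    ; encodes = trans (cong (_++ encodeReport ρ) encodes)
                  (trans (cong (encodeReports reps ++_) (sym (++-identityʳ _))) (sym (concatMap-++ encodeReport reps [ ρ ])))
    ; denote = Pointwise-++⁺ denote (den ∷ [])
    ; unique = Unique-∷ʳ (λ i → let _ , c′ , b′ , e , d = ok i in fresh d (sym e)) unique
    ; ok = sound′ ; all = complete′ }
    where
    open Listed l
    sound′ : ∀ {x} → x ∈ maws ∷ʳ (wd c ∷ʳ b) → MAW T x × (∃[ c′ ] ∃[ b′ ] x ≡ wd c′ ∷ʳ b′ × Done′ c′ b′)
    sound′ i with ∈-++⁻ maws i
    ... | inj₂ (here refl) = μ , c , b , refl , new
    ... | inj₁ j with ok j
    ...   | μ′ , c′ , b′ , e , d = μ′ , c′ , b′ , e , f d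
    complete′ : ∀ {c′ b′} → Done′ c′ b′ → MAW T (wd c′ ∷ʳ b′) → (wd c′ ∷ʳ b′) ∈ maws ∷ʳ (wd c ∷ʳ b)
    complete′ d μ′ with split d
    ... | inj₁ d′ = ∈-++⁺ˡ (all d′ μ′)
    ... | inj₂ (refl , refl) = ∈-++⁺ʳ maws (here refl)

  snoc⁵ : ∀ {A : Set} (o : List A) {a b c d e} → ((((o ∷ʳ a) ∷ʳ b) ∷ʳ c) ∷ʳ d) ∷ʳ e ≡ o ++ (a ∷ b ∷ c ∷ d ∷ e ∷ [])
  snoc⁵ []      = refl
  snoc⁵ (x ∷ o) = cong (x ∷_) (snoc⁵ o)

-- Marking the children of a u and locating u

module Phases {n σ : ℕ} (T : Tree n σ) where

  open Output T public

  ChildAt : St → ℕ → ℕ → Set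
  ChildAt s = ChildOf (arrs s cLetter) (arrs s cFirst)

  record Marked (wd : ℕ → Word σ) (c : ℕ) (s₀ : St) (o : List ℕ) (τ : ℕ) (s : St) : Set where
    field
      facts      : FactsOf wd s
      s≡         : regsᴴ s rS ≡ c
      C≡         : regsᴴ s rC ≡ regsᴴ s₀ rC
      first≡     : arrs s cFirst ≡ arrs s₀ cFirst
      out≡       : outᴴ s ≡ o
      mark≤      : ∀ r → arrs s lMark r ≤ c
      mark-child : ∀ {r} → arrs s lMark r ≡ c → ChildAt s c r
      child-mark : ∀ {r} → ChildAt s c r → arrs s lMark r ≡ c
      ticks≤     : ticks s ≤ τ

  record MarkInv (wd : ℕ → Word σ) (c : ℕ) (s₀ : St) (k : ℕ) (s : St) : Set where
    field
      facts  : FactsOf wd s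
      s≡     : regsᴴ s rS ≡ c
      C≡     : regsᴴ s rC ≡ regsᴴ s₀ rC
      first≡ : arrs s cFirst ≡ arrs s₀ cFirst
      out≡   : outᴴ s ≡ outᴴ s₀
      je≡    : regsᴴ s rJe ≡ arrs s cFirst (suc c)
      j+k    : regsᴴ s rJ + k ≡ arrs s cFirst (suc c)
      f≤j    : arrs s cFirst c ≤ regsᴴ s rJ
      mark≤  : ∀ r → arrs s lMark r ≤ c
      mark-child : ∀ {r} → arrs s lMark r ≡ c → ChildAt s c r
      marked : ∀ {j} → arrs s cFirst c ≤ j → j < regsᴴ s rJ → arrs s lMark (arrs s cLetter j) ≡ c
      ticks≤ : ticks s + arrs s cFirst c ≤ ticks s₀ + regsᴴ s rJ

  markPhase-correct : ∀ {wd c s} → FactsOf wd s → regsᴴ s rS ≡ c → 1 ≤ c → c < regsᴴ s rC →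
                      (∀ r → arrs s lMark r < c) → WP markPhase (Marked wd c s (outᴴ s) (ticks s + (arrs s cFirst (suc c) ∸ arrs s cFirst c))) s
  markPhase-correct {wd} {c} {s} facts₀ refl 1≤c c<C below = run markPhase
    (bounded facts₀ (<⇒≤ c<C) , bounded facts₀ c<C , bounded facts₀ c<C ,
     WP-mono finish (while-rule (MarkInv wd c s) stepJ stopJ (fl ∸ ff) _ record
       { facts = facts₀ ; s≡ = refl ; C≡ = refl ; first≡ = refl ; out≡ = refl ; je≡ = refl
       ; j+k = m+[n∸m]≡n f≤l ; f≤j = ≤-refl
       ; mark≤ = λ r → <⇒≤ (below r) ; mark-child = λ {r} e → contradiction (below r) (<-irrefl e)
       ; marked = λ f≤ j< → contradiction j< (≤⇒≯ f≤)
       ; ticks≤ = ≤-refl }))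
    where
    ff = arrs s cFirst c
    fl = arrs s cFirst (suc c)
    f≤l : ff ≤ fl
    f≤l = proj₁ (proj₂ (Classes.first-mono (Facts.classes facts₀) 1≤c c<C))
    stopJ : ∀ s′ → MarkInv wd c s 0 s′ → ¬ regsᴴ s′ rJ < regsᴴ s′ rJe
    stopJ s′ j j< = <-irrefl (trans (trans (sym (+-identityʳ _)) (MarkInv.j+k j)) (sym (MarkInv.je≡ j))) j<
    finish : ∀ s′ → ∃[ k ] MarkInv wd c s k s′ × ¬ regsᴴ s′ rJ < regsᴴ s′ rJe → Marked wd c s (outᴴ s) (ticks s + (fl ∸ ff)) s′
    finish s′ (k , j , j≮) = record
      { facts = facts ; s≡ = s≡ ; C≡ = C≡ ; first≡ = first≡ ; out≡ = out≡ ; mark≤ = mark≤ ; mark-child = mark-child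
      ; child-mark = λ where (childOf i f≤ i< refl) → marked f≤ (<-≤-trans i< last≤)
      ; ticks≤ = ≤-trans (m+n≤o⇒m≤o∸n (ticks s′) (subst (λ f → ticks s′ + f c ≤ ticks s + f (suc c)) first≡
                   (≤-trans ticks≤ (+-monoʳ-≤ (ticks s) (m+n≤o⇒m≤o _ (≤-reflexive j+k))))))
                   (≤-reflexive (+-∸-assoc (ticks s) f≤l)) }
      where
      open MarkInv j
      last≤ : arrs s′ cFirst (suc c) ≤ regsᴴ s′ rJ
      last≤ = subst (_≤ regsᴴ s′ rJ) je≡ (≮⇒≥ j≮)
    stepJ : ∀ k s′ → MarkInv wd c s (suc k) s′ → regsᴴ s′ rJ < regsᴴ s′ rJe → wp markStep (MarkInv wd c s k) (tick s′)
    stepJ k s′ inv j<je with child-sound (MarkInv.facts inv) 1≤c (subst (c <_) (sym (MarkInv.C≡ inv)) c<C)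
                               (MarkInv.f≤j inv) (subst (regsᴴ s′ rJ <_) (MarkInv.je≡ inv) j<je)
    ... | j<C , b , occ , l≡ , _ =
      bounded facts (<⇒≤ j<C) , rank<N′ occ l≡ , bounded facts j<C , record
        { facts = facts ; s≡ = s≡ ; C≡ = C≡ ; first≡ = first≡ ; out≡ = out≡ ; je≡ = je≡
        ; j+k = trans (sym (+-suc _ k)) j+k ; f≤j = m≤n⇒m≤1+n f≤j
        ; mark≤ = mark≤′ ; mark-child = mark-child′ ; marked = marked′
        ; ticks≤ = ≤-trans (s≤s ticks≤) (≤-reflexive (sym (+-suc (ticks s) _))) }
      where
      open MarkInv inv
      j = regsᴴ s′ rJ
      r = arrs s′ cLetter j
      mark≤′ : ∀ r′ → put r (regsᴴ s′ rS) (arrs s′ lMark) r′ ≤ c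
      mark≤′ r′ with r′ ≟ r
      ... | yes _ = ≤-reflexive s≡
      ... | no _  = mark≤ r′
      mark-child′ : ∀ {r′} → put r (regsᴴ s′ rS) (arrs s′ lMark) r′ ≡ c → ChildAt s′ c r′
      mark-child′ {r′} e with r′ ≟ r
      ... | yes refl = childOf j f≤j (subst (j <_) je≡ j<je) refl
      ... | no _     = mark-child e
      marked′ : ∀ {i} → arrs s′ cFirst c ≤ i → i < suc j → put r (regsᴴ s′ rS) (arrs s′ lMark) (arrs s′ cLetter i) ≡ c
      marked′ {i} f≤ i≤j with arrs s′ cLetter i ≟ r
      ... | yes _ = s≡
      ... | no ≢r = marked f≤ (≤∧≢⇒< (≤-pred i≤j) λ where refl → ≢r refl)

  record Site (wd : ℕ → Word σ) (c : ℕ) (s₀ : St) (o : List ℕ) (τ : ℕ) (a : Fin σ) (u : Word σ) (d : ℕ) (v x : Fin n) (s : St) : Set where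
    field
      marks  : Marked wd c s₀ o τ s
      word≡  : wd c ≡ a ∷ u
      W≡     : W x v ≡ u
      1≤d    : 1 ≤ d
      d<C    : d < regsᴴ s rC
      wd≡    : wd d ≡ u
      a≡     : regsᴴ s rL ≡ toℕ a
      x≡     : regsᴴ s rX₂ ≡ toℕ x
      v≡     : regsᴴ s rV₂ ≡ toℕ v
      len≡   : regsᴴ s rLen ≡ length u
      d≡     : regsᴴ s rTt ≡ d

  record Reversed (wd : ℕ → Word σ) (c : ℕ) (s₀ : St) (o : List ℕ) (τ : ℕ) (s : St) : Set where
    field
      marks : Marked wd c s₀ o τ s
      v x   : Fin n
      word≡ : W v x ≡ wd c
      rev≡  : regsᴴ s rS′ ≡ cls (arrs s) x v

  pair<N : ∀ {κ} v x → κ ≡ pr v x → κ < N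
  pair<N v x refl = near (≤-trans (<⇒≤ (pr< v x)) (m≤n+m _ 4))

  findReverse-correct : ∀ {wd c s₀ o τ s} → Marked wd c s₀ o τ s → 1 ≤ c → c < regsᴴ s rC →
                        WP findReverse (Reversed wd c s₀ o τ) s
  findReverse-correct {wd} {c} {s₀} {o} {τ} {s} mk 1≤c c<C
    with Marked.s≡ mk | representative (Marked.facts mk) 1≤c c<C
  ... | refl | v , x , at′ , _ , word = run findReverse
    (bounded facts (<⇒≤ c<C) , h<N , h<N , pair<N x v κ≡ , pair<N x v κ≡ , record
       { marks = record
           { facts = facts ; s≡ = refl ; C≡ = C≡ ; first≡ = first≡ ; out≡ = out≡ ; mark≤ = mark≤
           ; mark-child = mark-child ; child-mark = child-mark ; ticks≤ = ticks≤ }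
       ; v = v ; x = x ; word≡ = word ; rev≡ = cong (arrs s pClass) κ≡ })
    where
    open Marked mk
    h<N = entry-bounded facts (Entries.head≤ (Facts.entries facts) 1≤c c<C)
    κ≡ = cong₂ _+_ (cong₂ _*_ (Facts.n≡ facts) (to≡ at′)) (from≡ at′)

  record Suffix (wd : ℕ → Word σ) (c : ℕ) (s₀ : St) (o : List ℕ) (τ : ℕ) (s s′ : St) : Set where
    field
      marks : Marked wd c s₀ o τ s′
      v x   : Fin n
      word≡ : W v x ≡ wd (regsᴴ s rPP)
      v≡    : regsᴴ s′ rV₂ ≡ toℕ v
      x≡    : regsᴴ s′ rX₂ ≡ toℕ x
      d≡    : regsᴴ s′ rTt ≡ cls (arrs s′) x v
      p≡    : regsᴴ s′ rPP ≡ regsᴴ s rPP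
      r≡    : regsᴴ s′ rS′ ≡ regsᴴ s rS′
      arrs≡ : arrs s′ ≡ arrs s
      C≡    : regsᴴ s′ rC ≡ regsᴴ s rC

  findSuffix-correct : ∀ {wd c s₀ o τ s} → Marked wd c s₀ o τ s → 1 ≤ regsᴴ s rPP → regsᴴ s rPP < regsᴴ s rC →
                       WP findSuffix (Suffix wd c s₀ o τ s) s
  findSuffix-correct {wd} {c} {s₀} {o} {τ} {s} mk 1≤p p<C with representative (Marked.facts mk) 1≤p p<C
  ... | v , x , at′ , _ , word = run findSuffix
    (bounded facts (<⇒≤ p<C) , h<N , h<N , pair<N x v κ≡ , pair<N x v κ≡ , record
       { marks = record
           { facts = facts ; s≡ = s≡ ; C≡ = C≡ ; first≡ = first≡ ; out≡ = out≡ ; mark≤ = mark≤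
           ; mark-child = mark-child ; child-mark = child-mark ; ticks≤ = ticks≤ }
       ; v = v ; x = x ; word≡ = word ; v≡ = from≡ at′ ; x≡ = to≡ at′ ; d≡ = cong (arrs s pClass) κ≡
       ; p≡ = refl ; r≡ = refl ; arrs≡ = refl ; C≡ = refl })
    where
    open Marked mk
    h<N = entry-bounded facts (Entries.head≤ (Facts.entries facts) 1≤p p<C)
    κ≡ = cong₂ _+_ (cong₂ _*_ (Facts.n≡ facts) (to≡ at′)) (from≡ at′)

  -- Reversing a ∷ u turns a into the last letter, and the parent of the reversed
  -- word spells the reverse of u; no first letters or suffix links are stored.
  locate-correct : ∀ {wd c s₀ o τ s} → Marked wd c s₀ o τ s → 2 ≤ c → c < regsᴴ s rC →
    WP locate (λ s′ → ∃[ a ] ∃[ u ] ∃[ d ] ∃[ v ] ∃[ x ] Site wd c s₀ o τ a u d v x s′) s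
  locate-correct {wd} {c} {s₀} {o} {τ} {s} mk 2≤c c<C = run locate
    (WP-mono afterReverse (findReverse-correct mk (≤-trans (s≤s z≤n) 2≤c) c<C))
    where
    rest₁ rest₂ : Cmd
    rest₂ = ld rB cLetter (var rS′) ⨾ fma rIdx #3 (var rB) #4 ⨾ inp rL (var rIdx) ⨾ ld rLen cLength (var rPP)
    rest₁ = ld rPP cParent (var rS′) ⨾ call findSuffix ⨾ rest₂
    Goal : St → Set
    Goal s′ = ∃[ a ] ∃[ u ] ∃[ d ] ∃[ v ] ∃[ x ] Site wd c s₀ o τ a u d v x s′
    C₀≡ : regsᴴ s rC ≡ regsᴴ s₀ rC
    C₀≡ = Marked.C≡ mk

    afterReverse : ∀ s₁ → Reversed wd c s₀ o τ s₁ → wp rest₁ Goal s₁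
    afterReverse s₁ rv = r<N , WP-mono afterSuffix (findSuffix-correct marks₁ 1≤p p<C)
      where
      open Reversed rv
      open Facts (Marked.facts marks) using (entries; classes)
      C = regsᴴ s₁ rC
      r = regsᴴ s₁ rS′
      c<C₁ : c < C
      c<C₁ = subst (c <_) (trans C₀≡ (sym (Marked.C≡ marks))) c<C
      r<C : r < C
      r<C = subst (_< C) (sym rev≡) (Entries.class< entries (Facts.visited (Marked.facts marks) x v))
      r<N : r < N
      r<N = bounded (Marked.facts marks) (<⇒≤ r<C)
      1≤r : 1 ≤ r
      1≤r = subst (1 ≤_) (sym rev≡) (1≤class (Marked.facts marks) x v)
      wd-r : wd r ≡ reverse (wd c)
      wd-r = trans (cong wd rev≡) (trans (Entries.class-word entries (Facts.visited (Marked.facts marks) x v))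
               (trans (W-reverse v x) (cong reverse word≡)))
      -- If `r` were class 1, the reverse of `wd c` would be empty, hence `wd c` too, and `c` would
      -- be 1.
      2≤r : 2 ≤ r
      2≤r = ≤∧≢⇒< 1≤r λ e → <⇒≢ 2≤c (Classes.wd-inj classes ≤-refl (≤-<-trans 1≤r r<C) (≤-trans (s≤s z≤n) 2≤c) c<C₁
              (trans (Classes.wd-1 classes) (reverse-injective
                (trans (sym (Classes.wd-1 classes)) (trans (cong wd e) wd-r)))))
      parent = Classes.parent-ok classes 2≤r r<C
      1≤p = proj₁ parent
      p<C = proj₁ (proj₂ parent)
      a = proj₁ (proj₂ (proj₂ parent))
      occ = proj₁ (proj₂ (proj₂ (proj₂ parent)))
      wd-r′ = proj₁ (proj₂ (proj₂ (proj₂ (proj₂ parent))))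
      letter≡ = proj₂ (proj₂ (proj₂ (proj₂ (proj₂ parent))))
      p = arrs s₁ cParent r
      marks₁ : Marked wd c s₀ o τ (setᴿ rPP p s₁)
      marks₁ = record
        { facts = Marked.facts marks ; s≡ = Marked.s≡ marks ; C≡ = Marked.C≡ marks ; first≡ = Marked.first≡ marks
        ; out≡ = Marked.out≡ marks ; mark≤ = Marked.mark≤ marks
        ; mark-child = Marked.mark-child marks ; child-mark = Marked.child-mark marks ; ticks≤ = Marked.ticks≤ marks }
      len≡ : arrs s₁ cLength p ≡ length (wd p)
      len≡ = Classes.len≡ classes 1≤p p<C
      word-c : wd c ≡ a ∷ reverse (wd p)
      word-c = trans (sym (reverse-involutive (wd c))) (trans (cong reverse (trans (sym wd-r) wd-r′)) (reverse-++ (wd p) [ a ]))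

      afterSuffix : ∀ s₂ → Suffix wd c s₀ o τ (setᴿ rPP p s₁) s₂ → wp rest₂ Goal s₂
      afterSuffix s₂ sf =
        subst (_< N) (sym (Suffix.r≡ sf)) r<N , letter-cell<N occ letter₂ , letter-cell<I occ letter₂ ,
        subst (_< N) (sym (Suffix.p≡ sf)) (bounded (Marked.facts marks) (<⇒≤ p<C)) ,
        a , W x₂ v₂ , cls (arrs s₂) x₂ v₂ , v₂ , x₂ , record
          { marks = record
              { facts = facts ; s≡ = s≡ ; C≡ = C≡ ; first≡ = first≡ ; out≡ = out≡ ; mark≤ = mark≤
              ; mark-child = mark-child ; child-mark = child-mark ; ticks≤ = ticks≤ }
          ; word≡ = trans word-c (cong (a ∷_) (sym u≡)) ; W≡ = refl
          ; 1≤d = 1≤class facts x₂ v₂ ; d<C = Entries.class< (Facts.entries facts) (Facts.visited facts x₂ v₂)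
          ; wd≡ = Entries.class-word (Facts.entries facts) (Facts.visited facts x₂ v₂)
          ; a≡ = trans (cong letterAt letter₂) (letterAt-rank occ)
          ; x≡ = Suffix.x≡ sf ; v≡ = Suffix.v≡ sf
          ; len≡ = trans (cong₂ (λ α q → α cLength q) (Suffix.arrs≡ sf) (Suffix.p≡ sf))
                     (trans len≡ (trans (sym (length-reverse (wd p))) (cong length (sym u≡))))
          ; d≡ = Suffix.d≡ sf }
        where
        open Marked (Suffix.marks sf)
        v₂ = Suffix.v sf
        x₂ = Suffix.x sf
        u≡ : W x₂ v₂ ≡ reverse (wd p)
        u≡ = trans (W-reverse v₂ x₂) (cong reverse (Suffix.word≡ sf))
        letter₂ : arrs s₂ cLetter (regsᴴ s₂ rS′) ≡ rank a
        letter₂ = trans (cong₂ (λ α q → α cLetter q) (Suffix.arrs≡ sf) (Suffix.r≡ sf)) letter≡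

-- Emitting the words and amortising the scans

module Emission {n σ : ℕ} (T : Tree n σ) where

  open Phases T public

  SeenIn : St → ℕ → ℕ → ℕ → Set
  SeenIn s d j r = ∃[ i ] arrs s cFirst d ≤ i × i < j × arrs s cLetter i ≡ r

  Before : ℕ → ℕ → Fin σ → Set
  Before c c′ _ = 2 ≤ c′ × c′ < c

  Emitted : St → ℕ → ℕ → ℕ → ℕ → Fin σ → Set
  Emitted s c d j c′ b = Before c c′ b ⊎ (c′ ≡ c × Occurs b × SeenIn s d j (rank b))

  MAW⇒∉L : ∀ {w} → MAW T w → ¬ L T w
  MAW⇒∉L (_ , _ , _ , refl , ∉L , _) = ∉L

  module _ {wd : ℕ → Word σ} {c : ℕ} {s₀ : St} {a : Fin σ} {u : Word σ} {d : ℕ} {v x : Fin n}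
           (τ : ℕ) (2≤c : 2 ≤ c) (c<C₀ : c < regsᴴ s₀ rC) where

    -- `hits` collects the ranks of the scanned children of u that are matched by a child of a u.
    -- Every iteration lengthens either `hits` or `maws`. The list `maws` includes the words of
    -- earlier classes, so the budget `τ` does not account for them.
    record EmitInv (k : ℕ) (s : St) : Set where
      field
        site        : Site wd c s₀ (outᴴ s) (ticks s) a u d v x s
        je≡         : regsᴴ s rJe ≡ arrs s cFirst (suc d)
        j+k         : regsᴴ s rJ + k ≡ arrs s cFirst (suc d)
        f≤j         : arrs s cFirst d ≤ regsᴴ s rJ
        maws        : List (Word σ)
        listed      : Listed wd (Emitted s c d (regsᴴ s rJ)) (outᴴ s) maws
        hits        : List ℕ
        hits-unique : Unique hits
        hit-child   : ∀ {r} → r ∈ hits → ChildAt s c r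
        hit-seen    : ∀ {r} → r ∈ hits → SeenIn s d (regsᴴ s rJ) r
        ticks≤      : ticks s ≤ τ + (length hits + length maws)

    1≤c : 1 ≤ c
    1≤c = ≤-trans (s≤s z≤n) 2≤c

    emitStep-correct : ∀ k s → EmitInv (suc k) s → regsᴴ s rJ < regsᴴ s rJe → wp emitStep (EmitInv k) (tick s)
    emitStep-correct k s inv j<je
      with child-sound (Marked.facts (Site.marks (EmitInv.site inv))) (Site.1≤d (EmitInv.site inv)) (Site.d<C (EmitInv.site inv))
             (EmitInv.f≤j inv) (subst (regsᴴ s rJ <_) (EmitInv.je≡ inv) j<je)
    ... | j<C , b , occ , l≡ , _ , ub∈L =
      bounded facts (<⇒≤ j<C) , rank<N′ occ l≡ ,
      (λ unmarked → letter-cell<N occ l≡ , letter-cell<I occ l≡ , bounded facts j<C , emitted unmarked) ,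
      (λ marked → bounded facts j<C , hit marked)
      where
      open EmitInv inv
      open Site site
      open Marked marks using (facts; s≡; C≡; first≡; mark≤; mark-child; child-mark)
      open Facts facts using (classes)
      j = regsᴴ s rJ
      r = arrs s cLetter j
      C = regsᴴ s rC
      c<C : c < C
      c<C = subst (c <_) (sym C≡) c<C₀
      j< : j < arrs s cFirst (suc d)
      j< = subst (j <_) je≡ j<je
      not-seen : ¬ SeenIn s d j r
      not-seen (i , f≤i , i<j , e) = <-irrefl (child-unique facts 1≤d d<C f≤i (<-trans i<j j<) f≤j j< e) i<j
      later : ∀ {c′ b′} → Emitted s c d j c′ b′ → Emitted s c d (suc j) c′ b′
      later (inj₁ p) = inj₁ p
      later (inj₂ (e , occ′ , i , f≤i , i<j , l)) = inj₂ (e , occ′ , i , f≤i , m≤n⇒m≤1+n i<j , l)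
      split : ∀ {c′ b′} → Emitted s c d (suc j) c′ b′ → Emitted s c d j c′ b′ ⊎ (c′ ≡ c × b′ ≡ b)
      split (inj₁ p) = inj₁ (inj₁ p)
      split (inj₂ (e , occ′ , i , f≤i , i≤j , l)) with i ≟ j
      ... | no i≢j = inj₁ (inj₂ (e , occ′ , i , f≤i , ≤∧≢⇒< (≤-pred i≤j) i≢j , l))
      ... | yes refl = inj₂ (e , rank-injective occ′ occ (trans (sym l) l≡))
      j+k′ : suc j + k ≡ arrs s cFirst (suc d)
      j+k′ = trans (sym (+-suc j k)) j+k
      -- `Site` depends on nine registers only, none of which the loop body assigns; in both uses
      -- all nine equations hold by computation.
      site′ : ∀ ρ o τ′ → ρ rS ≡ regsᴴ s rS → ρ rC ≡ C → ρ rE ≡ regsᴴ s rE → ρ rN ≡ regsᴴ s rN → ρ rL ≡ regsᴴ s rL →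
              ρ rX₂ ≡ regsᴴ s rX₂ → ρ rV₂ ≡ regsᴴ s rV₂ → ρ rLen ≡ regsᴴ s rLen → ρ rTt ≡ regsᴴ s rTt →
              Site wd c s₀ o τ′ a u d v x ⟪ ρ , arrs s , o , τ′ ⟫
      site′ ρ o τ′ eS eC eE eN eL eX eV eLen eT = record
        { marks = record
            { facts = subst₂ (λ n′ C′ → Facts wd (arrs s cLetter) (arrs s cParent) (arrs s cLength) (arrs s cFirst)
                        (arrs s lChild) (arrs s eFrom) (arrs s eTo) (arrs s eNext) (arrs s cHead) (arrs s pClass) n′ (ρ rE) C′)
                        (sym eN) (sym eC) (subst (λ E′ → Facts wd (arrs s cLetter) (arrs s cParent) (arrs s cLength) (arrs s cFirst)
                        (arrs s lChild) (arrs s eFrom) (arrs s eTo) (arrs s eNext) (arrs s cHead) (arrs s pClass) (regsᴴ s rN) E′ C) (sym eE) facts)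
            ; s≡ = trans eS s≡ ; C≡ = trans eC C≡ ; first≡ = first≡ ; out≡ = refl ; mark≤ = mark≤
            ; mark-child = mark-child ; child-mark = child-mark ; ticks≤ = ≤-refl }
        ; word≡ = word≡ ; W≡ = W≡ ; 1≤d = 1≤d ; d<C = subst (d <_) (sym eC) d<C ; wd≡ = wd≡
        ; a≡ = trans eL a≡ ; x≡ = trans eX x≡ ; v≡ = trans eV v≡ ; len≡ = trans eLen len≡ ; d≡ = trans eT d≡ }
      ρ : Report n σ
      ρ = report a x v (length u) b
      cb≡ : wd c ∷ʳ b ≡ a ∷ u ++ [ b ]
      cb≡ = cong (_∷ʳ b) word≡
      denotes-cb : ρ Denotes (wd c ∷ʳ b) within T
      denotes-cb = subst (λ z → ρ Denotes z within T)
        (trans (cong (λ z → a ∷ z ++ [ b ]) (trans (cong (List.take (length u)) W≡) (take-all (length u) u ≤-refl))) (sym cb≡))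
        (denotes (W-path x v) (≤-reflexive (cong length (sym W≡))))
      fresh : ∀ {c′ b′} → Emitted s c d j c′ b′ → wd c′ ∷ʳ b′ ≢ wd c ∷ʳ b
      fresh {c′} em e with ∷ʳ-injective (wd c′) (wd c) e
      fresh (inj₁ (2≤c′ , c′<c)) _ | w≡ , _ =
        <-irrefl (Classes.wd-inj classes (≤-trans (s≤s z≤n) 2≤c′) (<-trans c′<c c<C) 1≤c c<C w≡) c′<c
      fresh (inj₂ (_ , _ , i , f≤i , i<j , l)) _ | _ , refl = not-seen (i , f≤i , i<j , trans l (sym l≡))
      out≡ : ∀ {o z} → z ≡ toℕ b →
             ((((o ∷ʳ regsᴴ s rL) ∷ʳ regsᴴ s rX₂) ∷ʳ regsᴴ s rV₂) ∷ʳ regsᴴ s rLen) ∷ʳ z ≡ o ++ encodeReport ρ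
      out≡ {o} refl rewrite a≡ | x≡ | v≡ | len≡ = snoc⁵ o
      letter-b : letterAt r ≡ toℕ b
      letter-b = trans (cong letterAt l≡) (letterAt-rank occ)
      module _ (unmarked : arrs s lMark r < regsᴴ s rS) where
        no-child : ¬ ChildAt s c (rank b)
        no-child ch = <-irrefl (trans (child-mark (subst (ChildAt s c) (sym l≡) ch)) (sym s≡)) unmarked
        maw : MAW T (wd c ∷ʳ b)
        maw = a , u , b , cb≡ ,
          (λ l → no-child (proj₁ (child-complete facts 1≤c c<C (subst (L T) (sym cb≡) l)))) ,
          subst (L T) word≡ (class-in-L facts 1≤c c<C) ,
          subst (λ z → L T (z ∷ʳ b)) wd≡ ub∈L
        emitted : EmitInv k _
        emitted = record
          { site = site′ _ _ _ refl refl refl refl refl refl refl refl refl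
          ; je≡ = je≡ ; j+k = j+k′ ; f≤j = m≤n⇒m≤1+n f≤j
          ; maws = maws ∷ʳ (wd c ∷ʳ b)
          ; listed = subst (λ o → Listed wd (Emitted s c d (suc j)) o (maws ∷ʳ (wd c ∷ʳ b))) (sym (out≡ letter-b))
                       (Listed-add later (inj₂ (refl , occ , j , f≤j , ≤-refl , l≡)) split fresh maw denotes-cb listed)
          ; hits = hits ; hits-unique = hits-unique ; hit-child = hit-child
          ; hit-seen = λ i → let q , f≤q , q<j , l = hit-seen i in q , f≤q , m≤n⇒m≤1+n q<j , l
          ; ticks≤ = ≤-trans (s≤s ticks≤) (≤-reflexive (begin
              suc (τ + (length hits + length maws))          ≡⟨ +-suc τ _ ⟨
              τ + suc (length hits + length maws)            ≡⟨ cong (τ +_) (+-suc (length hits) _) ⟨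
              τ + (length hits + suc (length maws))          ≡⟨ cong (λ z → τ + (length hits + z)) (trans (length-++ maws) (+-comm (length maws) 1)) ⟨
              τ + (length hits + length (maws ∷ʳ (wd c ∷ʳ b))) ∎)) }
          where open ≡-Reasoning
      module _ (marked : ¬ arrs s lMark r < regsᴴ s rS) where
        child-r : ChildAt s c r
        child-r = mark-child (≤-antisym (mark≤ r) (subst (_≤ arrs s lMark r) s≡ (≮⇒≥ marked)))
        cb∈L : L T (wd c ∷ʳ b)
        cb∈L with child-r
        ... | childOf i f≤i i< e with child-sound facts 1≤c c<C f≤i i<
        ...   | _ , b′ , occ′ , l′ , _ , l∈ with rank-injective occ′ occ (trans (sym l′) (trans e l≡))
        ...     | refl = l∈
        earlier : ∀ {c′ b′} → Emitted s c d (suc j) c′ b′ → MAW T (wd c′ ∷ʳ b′) → Emitted s c d j c′ b′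
        earlier em μ with split em
        ... | inj₁ em′ = em′
        ... | inj₂ (refl , refl) = contradiction cb∈L (MAW⇒∉L μ)
        hit : EmitInv k _
        hit = record
          { site = site′ _ _ _ refl refl refl refl refl refl refl refl refl
          ; je≡ = je≡ ; j+k = j+k′ ; f≤j = m≤n⇒m≤1+n f≤j
          ; maws = maws ; listed = Listed-map later earlier listed
          ; hits = r ∷ hits ; hits-unique = Unique-∷ (λ i → not-seen (hit-seen i)) hits-unique
          ; hit-child = λ where
              (here refl) → child-r
              (there i)   → hit-child i
          ; hit-seen = λ where
              (here refl) → j , f≤j , ≤-refl , refl
              (there i)   → let q , f≤q , q<j , l = hit-seen i in q , f≤q , m≤n⇒m≤1+n q<j , l
          ; ticks≤ = ≤-trans (s≤s ticks≤) (≤-reflexive (sym (+-suc τ _))) }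

    record Finished (s : St) : Set where
      field
        facts   : FactsOf wd s
        s≡      : regsᴴ s rS ≡ c
        C≡      : regsᴴ s rC ≡ regsᴴ s₀ rC
        first≡  : arrs s cFirst ≡ arrs s₀ cFirst
        mark≤   : ∀ r → arrs s lMark r ≤ c
        maws    : List (Word σ)
        listed  : Listed wd (Before (suc c)) (outᴴ s) maws
        ticks≤  : ticks s ≤ τ + ((arrs s₀ cFirst (suc c) ∸ arrs s₀ cFirst c) + length maws)

    -- The hits are distinct ranks among the letters of the interval of children of `c`, so there
    -- are at most as many of them as children.
    children-bound : ∀ {s hits} → arrs s cFirst ≡ arrs s₀ cFirst → Unique hits → (∀ {r} → r ∈ hits → ChildAt s c r) →
                     length hits ≤ arrs s₀ cFirst (suc c) ∸ arrs s₀ cFirst c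
    children-bound {s} {hits} first≡ un ch = begin
      length hits                                        ≤⟨ length-⊆ un inside ⟩
      length (List.applyUpTo letterFrom D)               ≡⟨ length-applyUpTo letterFrom D ⟩
      D                                                  ≡⟨ cong (λ f → f (suc c) ∸ f c) first≡ ⟩
      arrs s₀ cFirst (suc c) ∸ arrs s₀ cFirst c          ∎
      where
      open ≤-Reasoning
      f = arrs s cFirst
      D = f (suc c) ∸ f c
      letterFrom : ℕ → ℕ
      letterFrom i = arrs s cLetter (f c + i)
      inside : ∀ {r} → r ∈ hits → r ∈ List.applyUpTo letterFrom D
      inside i with ch i
      ... | childOf j f≤j j< l = subst (_∈ List.applyUpTo letterFrom D)
              (trans (cong (arrs s cLetter) (m+[n∸m]≡n f≤j)) l)
              (∈-applyUpTo⁺ letterFrom (∸-monoˡ-< j< f≤j))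

    emitPhase-correct : ∀ {s o maws₀} → Site wd c s₀ o (τ + length maws₀) a u d v x s → outᴴ s ≡ o → Listed wd (Before c) o maws₀ →
                        WP emitPhase Finished s
    emitPhase-correct {s} {o} {maws₀} site₀ refl listed₀ = run emitPhase
      (tt<N , stt<N , stt<N ,
       WP-mono finish (while-rule EmitInv emitStep-correct stopJ (fl ∸ ff) _ record
         { site = record
             { marks = record
                 { facts = facts ; s≡ = s≡ ; C≡ = C≡ ; first≡ = first≡ ; out≡ = refl ; mark≤ = mark≤
                 ; mark-child = mark-child ; child-mark = child-mark ; ticks≤ = ≤-refl }
             ; word≡ = word≡ ; W≡ = W≡ ; 1≤d = 1≤d ; d<C = d<C ; wd≡ = wd≡ ; a≡ = a≡ ; x≡ = x≡ ; v≡ = v≡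
             ; len≡ = len≡ ; d≡ = d≡ }
         ; je≡ = cong (λ z → arrs s cFirst (suc z)) d≡
         ; j+k = trans (cong (λ z → arrs s cFirst z + (fl ∸ ff)) d≡) (m+[n∸m]≡n f≤l)
         ; f≤j = ≤-reflexive (cong (arrs s cFirst) (sym d≡))
         ; maws = maws₀
         ; listed = Listed-map inj₁ only-before listed₀
         ; hits = [] ; hits-unique = [] ; hit-child = λ () ; hit-seen = λ ()
         ; ticks≤ = ticks≤ }))
      where
      open Site site₀
      open Marked marks
      ff = arrs s cFirst d
      fl = arrs s cFirst (suc d)
      f≤l : ff ≤ fl
      f≤l = proj₁ (proj₂ (Classes.first-mono (Facts.classes facts) 1≤d d<C))
      tt<N : regsᴴ s rTt < N
      tt<N = subst (_< N) (sym d≡) (bounded facts (<⇒≤ d<C))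
      stt<N : suc (regsᴴ s rTt) < N
      stt<N = subst (λ z → suc z < N) (sym d≡) (bounded facts d<C)
      only-before : ∀ {c′ b′} → Before c c′ b′ ⊎ (c′ ≡ c × Occurs b′ × SeenIn s d (arrs s cFirst (regsᴴ s rTt)) (rank b′)) →
                    MAW T (wd c′ ∷ʳ b′) → Before c c′ b′
      only-before (inj₁ p) _ = p
      only-before (inj₂ (_ , _ , i , f≤i , i< , _)) _ =
        contradiction (subst (λ z → i < arrs s cFirst z) d≡ i<) (≤⇒≯ f≤i)
      stopJ : ∀ s′ → EmitInv 0 s′ → ¬ regsᴴ s′ rJ < regsᴴ s′ rJe
      stopJ s′ j j< = <-irrefl (trans (trans (sym (+-identityʳ _)) (EmitInv.j+k j)) (sym (EmitInv.je≡ j))) j<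
      finish : ∀ s′ → ∃[ k ] EmitInv k s′ × ¬ regsᴴ s′ rJ < regsᴴ s′ rJe → Finished s′
      finish s′ (k , j , j≮) = record
        { facts = M.facts ; s≡ = M.s≡ ; C≡ = M.C≡ ; first≡ = M.first≡ ; mark≤ = M.mark≤
        ; maws = J.maws
        ; listed = Listed-map upto all-seen J.listed
        ; ticks≤ = ≤-trans J.ticks≤ (+-monoʳ-≤ τ (+-monoˡ-≤ (length J.maws)
                     (children-bound {s′} M.first≡ J.hits-unique J.hit-child))) }
        where
        module J = EmitInv j
        module M = Marked (Site.marks J.site)
        upto : ∀ {c′ b′} → Emitted s′ c d (regsᴴ s′ rJ) c′ b′ → Before (suc c) c′ b′
        upto (inj₁ (2≤ , <c)) = 2≤ , m≤n⇒m≤1+n <c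
        upto (inj₂ (refl , _)) = 2≤c , ≤-refl
        -- A minimal absent word `wd c ∷ʳ b′` splits with the same u as `wd c`, and u followed by
        -- `b′` is in the language; so `b′` labels a child of `d`, and all of these have been
        -- scanned.
        all-seen : ∀ {c′ b′} → Before (suc c) c′ b′ → MAW T (wd c′ ∷ʳ b′) → Emitted s′ c d (regsᴴ s′ rJ) c′ b′
        all-seen {c′} {b′} (2≤ , ≤c) μ with m≤n⇒m<n∨m≡n (≤-pred ≤c)
        ... | inj₁ c′<c = inj₁ (2≤ , c′<c)
        ... | inj₂ refl with μ
        ...   | a′ , u′ , b″ , e , _ , _ , ub∈L with ∷ʳ-injective (wd c) (a′ ∷ u′) e
        ...     | w≡ , refl with ∷-injective (trans (sym (Site.word≡ J.site)) w≡)
        ...       | refl , refl with child-complete M.facts (Site.1≤d J.site) (Site.d<C J.site)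
                                      (subst (λ z → L T (z ∷ʳ b′)) (sym (Site.wd≡ J.site)) ub∈L)
        ...         | childOf i f≤i i< l , occ =
          inj₂ (refl , occ , i , f≤i , <-≤-trans i< (subst (_≤ regsᴴ s′ rJ) J.je≡ (≮⇒≥ j≮)) , l)

  -- The classes before `c` cost one tick each, and their children, all numbered below `first c`,
  -- are charged twice: once for being marked and once for a possible hit.
  record ReportInv (wd : ℕ → Word σ) (τ₀ k : ℕ) (s : St) : Set where
    field
      c      : ℕ
      c+k    : c + k ≡ regsᴴ s rC
      2≤c    : 2 ≤ c
      facts  : FactsOf wd s
      s≡     : regsᴴ s rS ≡ c
      mark<  : ∀ r → arrs s lMark r < c
      maws   : List (Word σ)
      listed : Listed wd (Before c) (outᴴ s) maws
      ticks≤ : ticks s ≤ τ₀ + (c + 2 * arrs s cFirst c) + length maws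

  outStep-correct : ∀ {wd τ₀} k s → ReportInv wd τ₀ (suc k) s → regsᴴ s rS < regsᴴ s rC → wp outStep (ReportInv wd τ₀ k) (tick s)
  outStep-correct {wd} {τ₀} k s inv s<C = WP-mono
    (λ s₁ marked → WP-mono
      (λ s₂ (a , u , d , v , x , site) → WP-mono finish
        (emitPhase-correct τ 2≤c c<C (weaken site) (Marked.out≡ (Site.marks site)) listed))
      (locate-correct marked 2≤c (subst (c <_) (sym (Marked.C≡ marked)) c<C)))
    (markPhase-correct {wd} {c} {tick s} facts s≡ (≤-trans (s≤s z≤n) 2≤c) c<C mark<)
    where
    open ReportInv inv
    f = arrs s cFirst
    D = f (suc c) ∸ f c
    c<C : c < regsᴴ s rC
    c<C = subst (_< regsᴴ s rC) s≡ s<C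
    τ = suc (τ₀ + (c + 2 * f c)) + D
    f≤f : f c ≤ f (suc c)
    f≤f = proj₁ (proj₂ (Classes.first-mono (Facts.classes facts) (≤-trans (s≤s z≤n) 2≤c) c<C))
    weaken : ∀ {a u d v x s₂} → Site wd c (tick s) (outᴴ s) (suc (ticks s) + D) a u d v x s₂ →
             Site wd c (tick s) (outᴴ s) (τ + length maws) a u d v x s₂
    weaken st′ = record
      { marks = record
          { facts = M.facts ; s≡ = M.s≡ ; C≡ = M.C≡ ; first≡ = M.first≡ ; out≡ = M.out≡ ; mark≤ = M.mark≤
          ; mark-child = M.mark-child ; child-mark = M.child-mark
          ; ticks≤ = ≤-trans M.ticks≤ (≤-trans (s≤s (+-monoˡ-≤ D ticks≤))
                       (≤-reflexive (cong suc (trans (+-assoc (τ₀ + (c + 2 * f c)) (length maws) D)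
                         (trans (cong (τ₀ + (c + 2 * f c) +_) (+-comm (length maws) D)) (sym (+-assoc (τ₀ + (c + 2 * f c)) D (length maws)))))))) }
      ; word≡ = S.word≡ ; W≡ = S.W≡ ; 1≤d = S.1≤d ; d<C = S.d<C ; wd≡ = S.wd≡
      ; a≡ = S.a≡ ; x≡ = S.x≡ ; v≡ = S.v≡ ; len≡ = S.len≡ ; d≡ = S.d≡ }
      where
      module S = Site st′
      module M = Marked S.marks
    finish : ∀ {a u d v x} s₃ → Finished {wd} {c} {tick s} {a} {u} {d} {v} {x} τ 2≤c c<C s₃ → wp (inc rS) (ReportInv wd τ₀ k) s₃
    finish s₃ fin′ = subst (λ z → suc z < N) (sym F.s≡) (bounded facts c<C) , record
      { c = suc c ; c+k = trans (sym (+-suc c k)) (trans c+k (sym F.C≡)) ; 2≤c = m≤n⇒m≤1+n 2≤c ; facts = F.facts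
      ; s≡ = cong suc F.s≡ ; mark< = λ r → s≤s (F.mark≤ r) ; maws = F.maws ; listed = F.listed
      ; ticks≤ = ≤-trans F.ticks≤ (≤-reflexive (trans (collect τ₀ c (f c) D (length F.maws))
                   (cong (λ z → τ₀ + (suc c + 2 * z) + length F.maws)
                     (trans (m+[n∸m]≡n f≤f) (cong (λ g → g (suc c)) (sym F.first≡)))))) }
      where
      module F = Finished fin′
      collect : ∀ τ₀ c f D l → suc (τ₀ + (c + 2 * f)) + D + (D + l) ≡ τ₀ + (suc c + 2 * (f + D)) + l
      collect = solve 5 (λ τ₀ c f D l → con 1 :+ (τ₀ :+ (c :+ con 2 :* f)) :+ D :+ (D :+ l)
                                   := τ₀ :+ ((con 1 :+ c) :+ con 2 :* (f :+ D)) :+ l) refl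

  record Reported (τ₀ : ℕ) (s : St) : Set where
    field
      reports  : List (Report n σ)
      maws     : List (Word σ)
      encodes  : outᴴ s ≡ encodeReports reports
      denote   : AllDenote T reports maws
      lists    : maws Lists MAW T
      ticks≤   : ticks s ≤ τ₀ + 3 * suc (n * n) + length maws

  report-all-correct : ∀ s → Trie s → WP report-all (Reported (ticks s)) s
  report-all-correct s trie = run report-all
    (near (s≤s (s≤s z≤n)) , WP-mono finish (while-rule (ReportInv wd (ticks s)) outStep-correct stopJ (regsᴴ s rC ∸ 2) _ record
      { c = 2 ; c+k = m+[n∸m]≡n (Classes.2≤c₀ classes) ; 2≤c = ≤-refl
      ; facts = record
          { n≡ = Base.n≡ common ; entries = entries ; classes = classes ; nonEmpty = Full.nonEmpty filled
          ; visited = visited ; C≤nn+1 = C≤nn {arrs s} entries filled }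
      ; s≡ = refl ; mark< = λ r → subst (_< 2) (sym (Base.mark0 common r)) (s≤s z≤n)
      ; maws = [] ; listed = record
          { reps = [] ; encodes = Base.out[] common ; denote = [] ; unique = [] ; ok = λ ()
          ; all = λ (2≤c , c<2) _ → contradiction c<2 (≤⇒≯ 2≤c) }
      ; ticks≤ = ≤-trans (m≤m+n (ticks s) _) (m≤m+n _ 0) }))
    where
    open Trie trie
    stopJ : ∀ s′ → ReportInv wd (ticks s) 0 s′ → ¬ regsᴴ s′ rS < regsᴴ s′ rC
    stopJ s′ j s<C = <-irrefl (trans (ReportInv.s≡ j) (trans (sym (+-identityʳ _)) (ReportInv.c+k j))) s<C
    finish : ∀ s′ → ∃[ k ] ReportInv wd (ticks s) k s′ × ¬ regsᴴ s′ rS < regsᴴ s′ rC → Reported (ticks s) s′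
    finish s′ (k , j , s≮C) = record
      { reports = reps ; maws = maws ; encodes = encodes ; denote = denote
      ; lists = unique , λ w → mk⇔ (λ i → proj₁ (ok i)) (exhaustive {w})
      -- At the end `c` and `first c` both equal `C`, so that `c + 2 * first c` is three times the
      -- number `C`, which is at most `suc (n * n)`.
      ; ticks≤ = ≤-trans J.ticks≤ (+-monoˡ-≤ (length maws) (+-monoʳ-≤ (ticks s)
          (subst (λ z → z ≤ 3 * suc (n * n)) (cong₂ (λ y z → y + 2 * z) (sym c≡C) (sym first-c≡))
            (*-monoʳ-≤ 3 (Facts.C≤nn+1 J.facts))))) }
      where
      module J = ReportInv j
      maws = J.maws
      open Listed J.listed
      C = regsᴴ s′ rC
      c≡C : J.c ≡ C
      c≡C = ≤-antisym (m+n≤o⇒m≤o J.c (≤-reflexive J.c+k)) (subst (C ≤_) J.s≡ (≮⇒≥ s≮C))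
      first-c≡ : arrs s′ cFirst J.c ≡ C
      first-c≡ = trans (cong (arrs s′ cFirst) c≡C) (Classes.first-t (Facts.classes J.facts))
      exhaustive : ∀ {w} → MAW T w → w ∈ maws
      exhaustive μ@(a , u , b , refl , _ , au∈L , _) with class-of J.facts au∈L
      ... | c , 1≤c , c<C , w≡ = subst (_∈ maws) e (all (2≤ , subst (c <_) (sym c≡C) c<C) (subst (MAW T) (sym e) μ))
        where
        e : wd c ∷ʳ b ≡ a ∷ u ++ [ b ]
        e = cong (_∷ʳ b) w≡
        2≤ : 2 ≤ c
        2≤ = ≤∧≢⇒< 1≤c λ where refl → contradiction (trans (sym w≡) (Classes.wd-1 (Facts.classes J.facts))) λ ()

-- The algorithm on the machine

algorithm : Cmd
algorithm = call adjacency ⨾ call buildTrie ⨾ call report-all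

-- Cell 0 holds `n`, so the two leading instructions put 5 * n, the size of the input region, into
-- the base register.
program : Program (2 + R)
program = instr (load base (const 0)) ⨾ instr (arith base mul (const 5) (reg base)) ⨾ compile algorithm

≤2^⌈log₂⌉ : ∀ n → n ≤ 2 ^ ⌈log₂ n ⌉
≤2^⌈log₂⌉ = <-rec _ go
  where
  go : ∀ n → (∀ {k} → k < n → k ≤ 2 ^ ⌈log₂ k ⌉) → n ≤ 2 ^ ⌈log₂ n ⌉
  go zero          _  = z≤n
  go (suc zero)    _  = ≤-refl
  go n@(suc (suc k)) ih = begin
    n                              ≡⟨ ⌊n/2⌋+⌈n/2⌉≡n n ⟨
    ⌊ n /2⌋ + ⌈ n /2⌉              ≤⟨ +-monoˡ-≤ ⌈ n /2⌉ (⌊n/2⌋≤⌈n/2⌉ n) ⟩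
    ⌈ n /2⌉ + ⌈ n /2⌉              ≡⟨ cong (⌈ n /2⌉ +_) (+-identityʳ _) ⟨
    2 * ⌈ n /2⌉                    ≤⟨ *-monoʳ-≤ 2 (ih (⌈n/2⌉<n k)) ⟩
    2 * 2 ^ ⌈log₂ ⌈ n /2⌉ ⌉        ≡⟨ cong (λ l → 2 * 2 ^ l) (⌈log₂⌈n/2⌉⌉≡⌈log₂n⌉∸1 n) ⟩
    2 ^ suc (⌈log₂ n ⌉ ∸ 1)        ≡⟨ cong (2 ^_) (m+[n∸m]≡n {1} (⌈log₂⌉-mono-≤ {2} {n} (s≤s (s≤s z≤n)))) ⟩
    2 ^ ⌈log₂ n ⌉                  ∎
    where open ≤-Reasoning

nth-beyond : ∀ xs {i} → length xs ≤ i → nth xs i ≡ 0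
nth-beyond []       _       = refl
nth-beyond (x ∷ xs) (s≤s l) = nth-beyond xs l

nth-< : ∀ {B xs} → 0 < B → All (_< B) xs → ∀ i → nth xs i < B
nth-< 0<B []       i       = 0<B
nth-< 0<B (b ∷ bs) zero    = b
nth-< 0<B (b ∷ bs) (suc i) = nth-< 0<B bs i

module _ {n σ : ℕ} where

  open Encoding {n} {σ}

  length-encodeEdges : ∀ G → length (encodeEdges G) ≡ 3 * length G
  length-encodeEdges []      = refl
  length-encodeEdges (_ ∷ G) = trans (cong (3 +_) (length-encodeEdges G)) (sym (*-suc 3 (length G)))

  encodeEdges-< : ∀ {B} → n ≤ B → σ ≤ B → ∀ G → All (_< B) (encodeEdges G)
  encodeEdges-< n≤ σ≤ [] = []
  encodeEdges-< n≤ σ≤ ((u , v , a) ∷ G) =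
    <-≤-trans (toℕ<n u) n≤ ∷ <-≤-trans (toℕ<n v) n≤ ∷ <-≤-trans (toℕ<n a) σ≤ ∷ encodeEdges-< n≤ σ≤ G

module Correctness {n σ : ℕ} (T : Tree n σ) where

  open Emission T

  nn>0 : 1 ≤ n * n
  nn>0 = ≤-trans nonempty n≤nn

  abstract
    -- The subtracted term is the one that `Reported` adds, so the total is 14 * (n * n) plus the
    -- number of reported words. The 14 is 2 + 1 + 2 + 3 + 6, in multiples of n²: adjacency lists,
    -- initial entries, classes, pairs with their arcs, and reporting.
    algorithm-correct : WP algorithm (Reported (14 * (n * n) ∸ 3 * suc (n * n))) start
    algorithm-correct = run algorithm
      (WP-mono (λ s₁ inv → WP-mono (λ s₂ trie → WP-mono (λ s₃ rep → relax trie rep) (report-all-correct s₂ trie))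
        (buildTrie-correct s₁ inv)) adjacency-correct)
      where
      total-ticks : T₀ + suc (n * n) + n * (n + 2 * m) + 3 * suc (n * n) ≤ 14 * (n * n)
      total-ticks = begin
        m * suc m + n + suc (n * n) + n * (n + 2 * m) + 3 * suc (n * n)
          ≤⟨ +-mono-≤ (+-mono-≤ (+-mono-≤ (+-mono-≤ mm n≤nn) nn+1) linear) (*-monoʳ-≤ 3 nn+1) ⟩
        2 * (n * n) + n * n + 2 * (n * n) + 3 * (n * n) + 3 * (2 * (n * n))
          ≡⟨ solve 1 (λ q → con 2 :* q :+ q :+ con 2 :* q :+ con 3 :* q :+ con 3 :* (con 2 :* q) := con 14 :* q) refl (n * n) ⟩
        14 * (n * n) ∎
        where
        open ≤-Reasoning
        nn+1 : suc (n * n) ≤ 2 * (n * n)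
        nn+1 = ≤-trans (+-monoˡ-≤ (n * n) nn>0) (≤-reflexive (cong (n * n +_) (sym (+-identityʳ _))))
        mm : m * suc m ≤ 2 * (n * n)
        mm = ≤-trans (*-mono-≤ edge-count (≤-trans (s≤s edge-count) (+-monoˡ-≤ n nonempty)))
               (≤-reflexive (trans (*-distribˡ-+ n n n) (cong (n * n +_) (sym (+-identityʳ _)))))
        linear : n * (n + 2 * m) ≤ 3 * (n * n)
        linear = ≤-trans (*-monoʳ-≤ n (+-monoʳ-≤ n (*-monoʳ-≤ 2 edge-count)))
               (≤-reflexive (solve 1 (λ q → q :* (q :+ con 2 :* q) := con 3 :* (q :* q)) refl n))
      3nn≤ : 3 * suc (n * n) ≤ 14 * (n * n)
      3nn≤ = ≤-trans (m≤n+m _ _) total-ticks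
      relax : ∀ {s₂ s₃} → Trie s₂ → Reported (ticks s₂) s₃ → Reported (14 * (n * n) ∸ 3 * suc (n * n)) s₃
      relax {s₂} trie rep = record
        { reports = R.reports ; maws = R.maws ; encodes = R.encodes ; denote = R.denote ; lists = R.lists
        ; ticks≤ = ≤-trans R.ticks≤ (+-monoˡ-≤ (length R.maws) (+-monoˡ-≤ (3 * suc (n * n))
            (m+n≤o⇒m≤o∸n (ticks s₂) (≤-trans (+-monoˡ-≤ _ (Trie.ticks≤ trie)) total-ticks)))) }
        where module R = Reported rep

  -- Input and arrays occupy at most 5 * n² + 15 * (8 * n²) cells, which gives 125. Addresses must
  -- be strictly below `2 ^ w`, and 128 is the next power of two.
  module Machine (c w : ℕ) (125≤c : 125 ≤ c) (128≤ : 128 * (n * n) ≤ 2 ^ w) (σ≤ : σ ≤ 2 ^ w) where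

    S : ℕ
    S = c * n ^ 2

    n^2 : n ^ 2 ≡ n * n
    n^2 = cong (n *_) (*-identityʳ n)

    I+KN≤ : I + K * N ≤ 125 * (n * n)
    I+KN≤ = begin
      5 * n + 15 * (8 * (n * n))           ≤⟨ +-monoˡ-≤ _ (*-monoʳ-≤ 5 n≤nn) ⟩
      5 * (n * n) + 15 * (8 * (n * n))     ≡⟨ solve 1 (λ q → con 5 :* q :+ con 15 :* (con 8 :* q) := con 125 :* q) refl (n * n) ⟩
      125 * (n * n)                        ∎
      where open ≤-Reasoning

    fits : I + K * N ≤ S
    fits = ≤-trans I+KN≤ (subst (λ z → 125 * (n * n) ≤ c * z) (sym n^2) (*-monoˡ-≤ (n * n) 125≤c))

    small-const : ∀ k → k ≤ 128 → k ≤ 2 ^ w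
    small-const k k≤ = ≤-trans (≤-trans k≤ (m≤m*n 128 (n * n) {{>-nonZero nn>0}})) 128≤

    I+KN< : I + K * N < 2 ^ w
    I+KN< = <-≤-trans (≤-<-trans I+KN≤ (*-monoˡ-< (n * n) {{>-nonZero nn>0}} {125} {128} (m≤n+m 126 2))) 128≤

    N≤ : N ≤ 2 ^ w
    N≤ = ≤-trans (≤-trans (m≤n*m N K) (m≤n+m (K * N) I)) (<⇒≤ I+KN<)

    open Simulation {R} {K} input I N {w} {S} fits I+KN< N≤ (small-const 16 (m≤m+n 16 112)) (small-const 8 (m≤m+n 8 120))

    n≤ : n ≤ 2 ^ w
    n≤ = ≤-trans (≤-trans n≤nn (m≤n*m (n * n) 128)) 128≤

    n< : n < 2 ^ w
    n< = <-≤-trans (≤-<-trans n≤nn (m<n*m′ (n * n) nn>0)) 128≤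
      where
      m<n*m′ : ∀ q → 1 ≤ q → q < 128 * q
      m<n*m′ q 1≤q = subst (_< 128 * q) (*-identityˡ q) (*-monoˡ-< q {{>-nonZero 1≤q}} {1} {128} (m≤m+n 2 126))

    input< : ∀ i → input i < 2 ^ w
    input< = nth-< (small-const 1 (m≤m+n 1 127)) (n< ∷ ≤-<-trans edge-count n< ∷ encodeEdges-< n≤ σ≤ G)

    input-beyond : ∀ {i} → I ≤ i → input i ≡ 0
    input-beyond I≤i = nth-beyond (encodeTree T) (≤-trans fitting I≤i)
      where
      fitting : length (encodeTree T) ≤ I
      fitting = begin
        2 + length (Encoding.encodeEdges G)   ≡⟨ cong (2 +_) (length-encodeEdges G) ⟩
        2 + 3 * m                             ≤⟨ +-mono-≤ (const≤ 2) (*-monoʳ-≤ 3 edge-count) ⟩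
        2 * n + 3 * n                         ≡⟨ *-distribʳ-+ n 2 3 ⟨
        5 * n                                 ∎
        where open ≤-Reasoning

    init : State w (2 + R) S
    init = initial (encodeTree T)

    cell≡ : ∀ p → toℕ (lookup (mem init) p) ≡ input (toℕ p)
    cell≡ p = trans (cong toℕ (lookup∘tabulate (λ i → trunc w (nth (encodeTree T) (toℕ i))) p))
                    (toℕ-trunc w (input< (toℕ p)))

    zero≡ : toℕ (trunc w 0) ≡ 0
    zero≡ = toℕ-trunc w (small-const 1 (m≤m+n 1 127))

    register≡ : ∀ i → toℕ (lookup (regs init) i) ≡ 0
    register≡ i = trans (cong toℕ (lookup-replicate i (trunc w 0))) zero≡

    0<S : 0 < S
    0<S = <-≤-trans (0<I z≤n) (≤-trans (m≤m+n I _) fits)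

    p₀ : Fin S
    p₀ = fromℕ< 0<S

    σ₁ σ₂ : State w (2 + R) S
    σ₁ = setReg base (lookup (mem init) p₀) init
    σ₂ = setReg base (eval w mul (trunc w 5) (lookup (regs σ₁) base)) σ₁

    y₂ : MWord w
    y₂ = eval w mul (trunc w 5) (lookup (regs σ₁) base)

    base₁ : toℕ (lookup (regs σ₁) base) ≡ n
    base₁ = trans (cong toℕ (lookup∘update base (regs init) (lookup (mem init) p₀)))
              (trans (cell≡ p₀) (cong input (toℕ-fromℕ< 0<S)))

    σ₂≈start : σ₂ ≈ start
    σ₂≈start = record
      { regs≈ = λ i → trans (cong toℕ (trans (lookup∘update′ {i = suc (suc i)} {j = base} (λ ()) (regs σ₁) y₂)
                  (lookup∘update′ {i = suc (suc i)} {j = base} (λ ()) (regs init) (lookup (mem init) p₀)))) (register≡ (suc (suc i)))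
      ; base≈ = trans (cong toℕ (lookup∘update base (regs σ₁) y₂))
                  (eval≈ mul (toℕ-trunc w (small-const 6 (m≤m+n 6 122))) base₁ (≤-<-trans (m≤m+n I _) I+KN<))
      ; arrs≈ = λ f {j} _ p p≡ → trans (cell≡ p) (input-beyond (subst (I ≤_) (sym p≡) (m≤m+n I _)))
      ; input≈ = λ _ p p≡ → trans (cell≡ p) (cong input p≡)
      ; out≈ = refl }

    -- The cost enters through a variable, so that the arithmetic never unfolds it. One plus the
    -- number of ticks is at most 15 * n² plus the number of words, and the 2 pays for setting the
    -- base register.
    result : ∀ κ → cost algorithm ≡ κ → 2 + 15 * κ ≤ c →
      Σ[ final ∈ State w (2 + R) S ] ∃[ time ]
      Σ[ reports ∈ List (Report n σ) ] Σ[ maws ∈ List (Word σ) ]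
        ⟨ program , init ⟩⇓[ time ] final ×
        map toℕ (output final) ≡ encodeReports reports ×
        AllDenote T reports maws ×
        maws Lists MAW T ×
        time ≤ c * (n ^ 2 + length maws)
    result κ κ≡ bound =
      σ₃ , suc (suc t) , reports , maws ,
      (instr (load p₀ (trans (toℕ-fromℕ< 0<S) (sym zero≡))) ⨾ instr arith ⨾ proj₁ out₃) ,
      trans (_≈_.out≈ (proj₁ (proj₂ out₃))) encodes , denote , lists ,
      time≤ κ bound (subst (λ κ → t ≤ κ * suc δ) κ≡ (proj₂ (proj₂ (proj₂ out₃))))
      where
      s   = proj₁ algorithm-correct
      e   = proj₁ (proj₂ algorithm-correct)
      rep = proj₂ (proj₂ algorithm-correct)
      sim = simulate e σ₂≈start
      σ₃  = proj₁ sim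
      t   = proj₁ (proj₂ sim)
      δ   = proj₁ (proj₂ (proj₂ sim))
      out₃ = proj₂ (proj₂ (proj₂ sim))
      δ≡ : ticks s ≡ δ + 0
      δ≡ = proj₁ (proj₂ (proj₂ out₃))
      open Reported rep
      δ≤ : δ ≤ 14 * (n * n) + length maws
      δ≤ = subst (_≤ 14 * (n * n) + length maws) (trans δ≡ (+-identityʳ δ))
             (≤-trans ticks≤ (+-monoˡ-≤ (length maws) (≤-reflexive (m∸n+n≡m 3nn≤))))
        where
        3nn≤ : 3 * suc (n * n) ≤ 14 * (n * n)
        3nn≤ = ≤-trans (*-monoʳ-≤ 3 (+-monoˡ-≤ (n * n) nn>0))
                 (≤-trans (≤-reflexive (solve 1 (λ q → con 3 :* (q :+ q) := con 6 :* q) refl (n * n))) (*-monoˡ-≤ (n * n) (m≤m+n 6 8)))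
      time≤ : ∀ κ → 2 + 15 * κ ≤ c → t ≤ κ * suc δ → suc (suc t) ≤ c * (n ^ 2 + length maws)
      time≤ κ bound t≤ = begin
        2 + t                                                   ≤⟨ +-mono-≤ (m≤m*n 2 (n * n) {{>-nonZero nn>0}}) (≤-trans t≤ (*-monoʳ-≤ κ (+-mono-≤ nn>0 δ≤))) ⟩
        2 * (n * n) + κ * (n * n + (14 * (n * n) + l))          ≤⟨ m≤m+n _ (2 * l + 14 * κ * l) ⟩
        2 * (n * n) + κ * (n * n + (14 * (n * n) + l)) + (2 * l + 14 * κ * l)
          ≡⟨ solve 3 (λ q κ l → con 2 :* q :+ κ :* (q :+ (con 14 :* q :+ l)) :+ (con 2 :* l :+ con 14 :* κ :* l)
                             := (con 2 :+ con 15 :* κ) :* (q :+ l)) refl (n * n) κ l ⟩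
        (2 + 15 * κ) * (n * n + l)                              ≤⟨ *-monoˡ-≤ (n * n + l) bound ⟩
        c * (n * n + l)                                         ≡⟨ cong (λ q → c * (q + l)) n^2 ⟨
        c * (n ^ 2 + l)                                         ∎
        where
        open ≤-Reasoning
        l = length maws

-- As `suc n` is at least 2, powers of it absorb the constants: 128 is `2 ^ 7`, which with n² gives
-- the exponent 9, and `k` is at most `2 ^ k`, which with `n ^ d` gives k + d.
word-size : ∀ k d n w → 1 ≤ n → (9 + (k + d)) * ⌈log₂ suc n ⌉ ≤ w → 128 * (n * n) ≤ 2 ^ w × k * n ^ d ≤ 2 ^ w
word-size k d n w 1≤n κ≤w = ≤-trans first-bound power≤ , ≤-trans second-bound power≤
  where
  open ≤-Reasoning
  power≤ : suc n ^ (9 + (k + d)) ≤ 2 ^ w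
  power≤ = begin
    suc n ^ (9 + (k + d))                  ≤⟨ ^-monoˡ-≤ (9 + (k + d)) (≤2^⌈log₂⌉ (suc n)) ⟩
    (2 ^ ⌈log₂ suc n ⌉) ^ (9 + (k + d))    ≡⟨ ^-*-assoc 2 ⌈log₂ suc n ⌉ (9 + (k + d)) ⟩
    2 ^ (⌈log₂ suc n ⌉ * (9 + (k + d)))    ≡⟨ cong (2 ^_) (*-comm ⌈log₂ suc n ⌉ (9 + (k + d))) ⟩
    2 ^ ((9 + (k + d)) * ⌈log₂ suc n ⌉)    ≤⟨ ^-monoʳ-≤ 2 κ≤w ⟩
    2 ^ w                                  ∎
  first-bound : 128 * (n * n) ≤ suc n ^ (9 + (k + d))
  first-bound = begin
    2 ^ 7 * (n * n)                        ≤⟨ *-mono-≤ (^-monoˡ-≤ 7 (s≤s 1≤n)) (*-mono-≤ (n≤1+n n) (≤-trans (n≤1+n n) (≤-reflexive (sym (*-identityʳ (suc n)))))) ⟩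
    suc n ^ 7 * suc n ^ 2                  ≡⟨ ^-distribˡ-+-* (suc n) 7 2 ⟨
    suc n ^ 9                              ≤⟨ ^-monoʳ-≤ (suc n) (m≤m+n 9 (k + d)) ⟩
    suc n ^ (9 + (k + d))                  ∎
  k≤2^k : ∀ k → k ≤ 2 ^ k
  k≤2^k zero    = z≤n
  k≤2^k (suc k) = ≤-trans (+-mono-≤ (m^n>0 2 k) (k≤2^k k)) (≤-reflexive (cong (2 ^ k +_) (sym (+-identityʳ _))))
  second-bound : k * n ^ d ≤ suc n ^ (9 + (k + d))
  second-bound = begin
    k * n ^ d                              ≤⟨ *-mono-≤ (≤-trans (k≤2^k k) (^-monoˡ-≤ k (s≤s 1≤n))) (^-monoˡ-≤ d (n≤1+n n)) ⟩
    suc n ^ k * suc n ^ d                  ≡⟨ ^-distribˡ-+-* (suc n) k d ⟨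
    suc n ^ (k + d)                        ≤⟨ ^-monoʳ-≤ (suc n) (m≤n+m (k + d) 9) ⟩
    suc n ^ (9 + (k + d))                  ∎

mainTheorem7 : ∃[ r ] Σ[ P ∈ Program r ]
    ((k d : ℕ) → ∃[ c ] ∃[ κ ]
    ((n σ w : ℕ) → σ ≤ k * n ^ d → κ * ⌈log₂ suc n ⌉ ≤ w → (T : Tree n σ) →
    Σ[ final ∈ State w r (c * n ^ 2) ] ∃[ time ]
    Σ[ reports ∈ List (Report n σ) ] Σ[ maws ∈ List (Word σ) ]
    ⟨ P , initial (encodeTree T) ⟩⇓[ time ] final ×
    map toℕ (output final) ≡ encodeReports reports ×
    AllDenote T reports maws ×
    maws Lists MAW T ×
    time ≤ c * (n ^ 2 + length maws)))
mainTheorem7 = 2 + R , program , λ k d → c , 9 + (k + d) , λ n σ w σ≤ κ≤ T →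
  let 128≤ , kn^d≤ = word-size k d n w (IsTree.nonempty (isTree T)) κ≤
  in Correctness.Machine.result T c w (m≤m+n 125 _) 128≤ (≤-trans σ≤ kn^d≤) (cost algorithm) refl (m≤n+m _ 125)
  where
  -- The summand 125 is for the memory and the rest for the time. Neither depends on `k` and `d`,
  -- which affect only the word size.
  c : ℕ
  c = 125 + (2 + 15 * cost algorithm)
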